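{- For every integer $d \geq 1$ there exist a strictly increasing sequence $(a_n)_{n\geq1}$ of positive integers and a constant $c > 0$ such that $$\frac{a_{n+1}}{a_n} > 1 + \frac{c}{a_n^{1/d}} \qquad \text{for all } n \in \mathbb{N},$$ and such that for almost all $\alpha \in \mathbb{R}$ the discrepancy $D_N$ of $(\{a_n\alpha\})_{n\geq1}$ satisfies $N D_N = O\big((\log N)^{2+\varepsilon}\big)$ as $N\to\infty$, for every $\varepsilon > 0$.
   Context: For real $x$, $\{x\}$ denotes the fractional part of $x$. For a sequence $(x_n)_{n\ge1}$ in $[0,1)$, its discrepancy is $$D_N = \sup_{0 \leq a < b \leq 1} \left| \frac{A_N([a,b))}{N} - (b-a) \right|, \qquad A_N([a,b)) = \#\{1 \leq n \leq N : x_n \in [a,b)\}.$$ -}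

module Defs where

open import Level using (0ℓ)
open import Algebra.Bundles using (CommutativeRing; Semiring)
import Algebra.Definitions.RawMonoid as RawMonoidOps
import Algebra.Definitions.RawSemiring as RawSemiringOps
open import Axiom.ExcludedMiddle using (ExcludedMiddle)
open import Data.Integer.Base using (ℤ; +_; -[1+_])
open import Data.List.Base using (length; filter; applyUpTo)
open import Data.Nat.Base as ℕ using (ℕ; zero; suc; _!)
open import Data.Product.Base using (∃; ∃₂; _×_; _,_)
open import Data.Sum.Base using (inj₁; inj₂)
open import Relation.Binary.Core using (Rel)
open import Relation.Binary.Structures using (IsTotalOrder)
import Relation.Binary.Construct.NonStrictToStrict as ToStrict
open import Relation.Nullary using (¬_; yes; no)

-- The axioms of ℝ.  Classically they determine ℝ up to isomorphism.
record CompleteOrderedField : Set₁ where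
  infix 4 _≤_
  field
    commutativeRing : CommutativeRing 0ℓ 0ℓ
  open CommutativeRing commutativeRing public renaming (Carrier to ℝ)
  field
    _≤_          : Rel ℝ 0ℓ
    isTotalOrder : IsTotalOrder _≈_ _≤_
    +-monoˡ-≤    : ∀ {x y} z → x ≤ y → x + z ≤ y + z
    *-nonNeg     : ∀ {x y} → 0# ≤ x → 0# ≤ y → 0# ≤ x * y
    0≉1          : ¬ (0# ≈ 1#)
    inverse      : ∀ x → ¬ (x ≈ 0#) → ∃ λ y → x * y ≈ 1#

  infix 4 _<_
  _<_ : Rel ℝ 0ℓ
  _<_ = ToStrict._<_ _≈_ _≤_

  IsUpperBound : (ℝ → Set) → ℝ → Set
  IsUpperBound P u = ∀ x → P x → x ≤ u

  IsSupremum : (ℝ → Set) → ℝ → Set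
  IsSupremum P s = IsUpperBound P s × (∀ u → IsUpperBound P u → s ≤ u)

  field
    complete : ∀ (P : ℝ → Set) → ∃ P → ∃ (IsUpperBound P) → ∃ (IsSupremum P)

-- Excluded middle is used to make partial operations total: an operation
-- returns the described real number when it exists and 0 otherwise.
module Analysis (lem : ExcludedMiddle 0ℓ) (R : CompleteOrderedField) where

  open CompleteOrderedField R
  open RawMonoidOps +-rawMonoid using () renaming (_×_ to _·_)
  open RawSemiringOps (Semiring.rawSemiring semiring) using () renaming (_^_ to _^ℕ_)

  the : (ℝ → Set) → ℝ
  the P with lem {P = ∃ P}
  ... | yes (x , _) = x
  ... | no _        = 0#

  ι : ℕ → ℝ
  ι n = n · 1#

  ιℤ : ℤ → ℝ
  ιℤ (+ n)    = ι n
  ιℤ -[1+ n ] = - ι (suc n)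

  infix 8 _⁻¹
  _⁻¹ : ℝ → ℝ
  x ⁻¹ = the λ y → x * y ≈ 1#

  infixl 7 _/_
  _/_ : ℝ → ℝ → ℝ
  x / y = x * y ⁻¹

  ∣_∣ : ℝ → ℝ
  ∣ x ∣ with IsTotalOrder.total isTotalOrder 0# x
  ... | inj₁ _ = x
  ... | inj₂ _ = - x

  sup : (ℝ → Set) → ℝ
  sup P = the (IsSupremum P)

  ⌊_⌋ : ℝ → ℝ
  ⌊ x ⌋ = the λ m → (∃ λ k → m ≈ ιℤ k) × m ≤ x × x < m + 1#

  frac : ℝ → ℝ
  frac x = x - ⌊ x ⌋

  -- ∑ f n = f 0 + … + f (n - 1)
  ∑ : (ℕ → ℝ) → ℕ → ℝ
  ∑ f zero    = 0#
  ∑ f (suc n) = ∑ f n + f n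

  infix 4 _⟶_
  _⟶_ : (ℕ → ℝ) → ℝ → Set
  f ⟶ l = ∀ ε → 0# < ε → ∃ λ n₀ → ∀ n → n₀ ℕ.≤ n → ∣ f n - l ∣ < ε

  exp : ℝ → ℝ
  exp x = the (∑ (λ k → x ^ℕ k / ι (k !)) ⟶_)

  log : ℝ → ℝ
  log x = the λ y → exp y ≈ x

  -- Real powers of a positive base; the value is 0 if x ≤ 0.
  infixr 8 _^_
  _^_ : ℝ → ℝ → ℝ
  x ^ y with lem {P = 0# < x}
  ... | yes _ = exp (y * log x)
  ... | no _  = 0#

  infix 4 _=O_
  _=O_ : (ℕ → ℝ) → (ℕ → ℝ) → Set
  f =O g = ∃₂ λ C n₀ → ∀ n → n₀ ℕ.≤ n → ∣ f n ∣ ≤ C * ∣ g n ∣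

  _∈[_,_⟩ : ℝ → ℝ → ℝ → Set
  x ∈[ a , b ⟩ = a ≤ x × x < b

  -- Sequences (xₙ)ₙ≥₁ are functions on ℕ whose value at 0 is never used:
  -- applyUpTo suc N is the list 1, …, N.
  count : (ℕ → ℝ) → ℕ → ℝ → ℝ → ℕ
  count x N a b =
    length (filter (λ n → lem {P = x n ∈[ a , b ⟩}) (applyUpTo suc N))

  discrepancy : (ℕ → ℝ) → ℕ → ℝ
  discrepancy x N = sup λ v → ∃₂ λ a b →
    0# ≤ a × a < b × b ≤ 1# × v ≈ ∣ ι (count x N a b) / ι N - (b - a) ∣

  -- Lebesgue null sets: coverable by countably many open intervals
  -- (l i , r i) of total length at most ε, for every ε > 0.
  Null : (ℝ → Set) → Set
  Null S = ∀ ε → 0# < ε → ∃₂ λ (l r : ℕ → ℝ) →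
    (∀ i → l i ≤ r i) ×
    (∀ x → S x → ∃ λ i → l i < x × x < r i) ×
    (∀ n → ∑ (λ i → r i - l i) n ≤ ε)

  AlmostAll : (ℝ → Set) → Set
  AlmostAll P = Null λ x → ¬ P x

{-# OPTIONS --safe #-}
module Submission where

open import Level using (0ℓ)
open import Algebra.Bundles using (Semiring)
import Algebra.Definitions.RawSemiring as RawSemiringOps
import Algebra.Properties.CommutativeSemiring.Exp as CommutativeSemiringExp
import Algebra.Properties.Ring as RingProperties
import Algebra.Properties.Semiring.Exp as SemiringExp
import Algebra.Properties.Semiring.Mult as SemiringMult
open import Axiom.ExcludedMiddle using (ExcludedMiddle)
open import Data.Bool.Base as Bool using (Bool; true; false; _∧_)
open import Data.Fin.Base using (Fin; toℕ; fromℕ<)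
import Data.Fin.Properties as Finₚ
open import Data.Integer.Base using (+_; -[1+_])
open import Data.List.Base as List using (List; []; _∷_; _++_; length; filter; applyUpTo)
import Data.List.Properties as Listₚ
open import Data.List.Relation.Unary.All using (All; []; _∷_)
import Data.List.Relation.Unary.All.Properties as Allₚ
open import Data.List.Relation.Unary.Any using (Any; here; there)
import Data.List.Relation.Unary.Any.Properties as Anyₚ
open import Data.Nat.Base as ℕ using (ℕ; zero; suc; _!)
open import Data.Nat.Coprimality using (Coprime; coprime-Bézout; coprime-/gcd)
open import Data.Nat.DivMod using (m%n≤m; m/n≤m; m≡m%n+[m/n]*n; m%n<n; m<n*o⇒m/o<n; m≥n⇒m/n>0; m/n*n≡m)
open import Data.Nat.GCD using (gcd; gcd[m,n]≡0⇒n≡0; gcd[m,n]∣m; gcd[m,n]∣n; module Bézout)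
import Data.Nat.Properties as ℕₚ
import Data.Nat.Tactic.RingSolver as ℕ-Solver
open import Data.Product.Base using (Σ; ∃; ∃₂; _×_; _,_; proj₁; proj₂)
open import Data.Sum.Base using (_⊎_; inj₁; inj₂)
open import Function.Base using (_∘_)
open import Relation.Binary.PropositionalEquality as ≡ using (_≡_)
import Relation.Binary.Reasoning.Setoid as SetoidReasoning
open import Relation.Binary.Structures using (IsTotalOrder)
open import Relation.Nullary using (¬_; yes; no; Dec)
open import Relation.Nullary.Negation using (contradiction)
open import Defs

-- Idea.  Cut ℕ into the blocks 2^(2^m) ≤ n < 2^(2^(m+1)) and put a n = n h,
-- where h = 2^(2^(m+1)(d-1)) on the m-th block.  As h is non-decreasing and
-- a n ≥ n^d, we have a (n+1) / a n ≥ 1 + 1/n ≥ 1 + 1 / (a n)^(1/d).  On a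
-- block the points are an arithmetic progression jθ + γ with θ = hα.
--
-- Write K = 2^(m+1), so that the block has fewer than 2^K elements.  By
-- Borel–Cantelli, for almost all α and all large m, |qθ - p| ≥ 1/(qT) for all
-- 1 ≤ q ≤ 2^K and integers p, where T ≍ K m³: the measure of the exceptional
-- α in [-m, m] is O(m ∑ 1/(qT)) = O(m K / T).  For such θ Dirichlet's theorem
-- splits n ≤ 2^K points into at most T runs of q points, each of bounded
-- discrepancy because jθ is close to jp/q, and fewer than n/2 remaining ones.
-- Hence the block has discrepancy O(K T) = O(4^m m³), and log N ≍ 2^m.

-- A decision procedure for identities of commutative rings.  A polynomial is
-- a list of monomials with coefficients (p , n), which stand for p - n.


-- Keeping the multiplier constant on a block turns the problem into one about rotations, but every
-- block brings a new θ, and the block errors add up. Doubly exponential blocks keep their number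
-- near log log N, so the addition costs one factor m. In the resulting 4^m m^4, the first factor is
-- of order (log N)^2 and the second is a power of log log N, absorbed by (log N)^ε.
--
-- The measure estimate is uniform in h: the number of centres u/(qh) in a window grows like qh
-- while their radius shrinks like 1/(qh). Of the three factors m in T, one pays for the window
-- [-m, m] and two make the measures summable.
--
-- Continued fractions are avoided: Dirichlet's theorem is applied afresh to the points left over,
-- and since these are fewer than half each time, K rounds suffice.
--
-- `log` and real powers are specified only through the series of `exp`, so the functional equation,
-- monotonicity and the existence of logarithms of x ≥ 1 are derived from it, by explicit
-- inequalities instead of continuity.

infixl 6 _⊕_ _⊖_
infixl 7 _⊗_
infix  8 ⊝_

data Expr : Set where
  var     : ℕ → Expr
  con     : ℕ → Expr
  𝟎 𝟏     : Expr
  _⊕_ _⊗_ _⊖_ : Expr → Expr → Expr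
  ⊝_      : Expr → Expr

Coeff Monomial Polynomial : Set
Coeff      = ℕ × ℕ
Monomial   = List ℕ
Polynomial = List (Coeff × Monomial)

_+ᶜ_ _*ᶜ_ : Coeff → Coeff → Coeff
(p , n) +ᶜ (p′ , n′) = p ℕ.+ p′ , n ℕ.+ n′
(p , n) *ᶜ (p′ , n′) = p ℕ.* p′ ℕ.+ n ℕ.* n′ , p ℕ.* n′ ℕ.+ n ℕ.* p′

insert : ℕ → Monomial → Monomial
insert i []       = i ∷ []
insert i (j ∷ m) with i ℕ.≤ᵇ j
... | true  = i ∷ j ∷ m
... | false = j ∷ insert i m

_*ᵐ_ : Monomial → Monomial → Monomial
[]      *ᵐ n = n
(i ∷ m) *ᵐ n = insert i (m *ᵐ n)

addTerm : Coeff → Monomial → Polynomial → Polynomial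
addTerm c m [] = (c , m) ∷ []
addTerm c m ((d , n) ∷ p) with Listₚ.≡-dec ℕₚ._≟_ m n
... | yes _ = (c +ᶜ d , n) ∷ p
... | no _  = (d , n) ∷ addTerm c m p

-- Sums, differences, negatives and products are all built from this one accumulating operation
-- `c m p + r`, so a single soundness argument carries them all.
addScaled : Coeff → Monomial → Polynomial → Polynomial → Polynomial
addScaled c m []            r = r
addScaled c m ((d , n) ∷ p) r = addTerm (c *ᶜ d) (m *ᵐ n) (addScaled c m p r)

_*ᵖ_ : Polynomial → Polynomial → Polynomial
[]            *ᵖ q = []
((c , m) ∷ p) *ᵖ q = addScaled c m q (p *ᵖ q)

normalForm : Expr → Polynomial
normalForm (var i)   = ((1 , 0) , i ∷ []) ∷ []
normalForm (con n) = ((n , 0) , []) ∷ []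
normalForm 𝟎       = []
normalForm 𝟏       = ((1 , 0) , []) ∷ []
normalForm (a ⊕ b) = addScaled (1 , 0) [] (normalForm a) (normalForm b)
normalForm (a ⊗ b) = normalForm a *ᵖ normalForm b
normalForm (a ⊖ b) = addScaled (0 , 1) [] (normalForm b) (normalForm a)
normalForm (⊝ a)   = addScaled (0 , 1) [] (normalForm a) []

-- `addTerm` merges equal monomials but keeps those whose coefficients cancel, so a zero polynomial
-- may still have entries, each of the form `(p , p)`.
vanishes : Polynomial → Bool
vanishes []                  = true
vanishes (((p , n) , _) ∷ q) = (p ℕ.≡ᵇ n) ∧ vanishes q

module Development (lem : ExcludedMiddle 0ℓ) (R : CompleteOrderedField) where
  open CompleteOrderedField R
  open Analysis lem R
  open RawSemiringOps (Semiring.rawSemiring semiring) using () renaming (_^_ to _^ℕ_)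

  -- Soundness of the polynomial normal form in the ring of reals.

  module RingSolver where
    open SemiringMult semiring using (×-homo-+; ×1-homo-*)
    open RingProperties ring using (-‿distribˡ-*; -‿distribʳ-*; -‿+-comm; -‿involutive)
    module ≈-R = SetoidReasoning setoid

    ι-+ : ∀ m n → ι (m ℕ.+ n) ≈ ι m + ι n
    ι-+ = ×-homo-+ 1#

    ι-* : ∀ m n → ι (m ℕ.* n) ≈ ι m * ι n
    ι-* = ×1-homo-*

    ι-1 : ι 1 ≈ 1#
    ι-1 = +-identityʳ 1#

    module _ (ρ : List ℝ) where

      at : List ℝ → ℕ → ℝ
      at []      _       = 0#
      at (x ∷ _) zero    = x
      at (_ ∷ ρ) (suc i) = at ρ i

      ⟦_⟧ : Expr → ℝ
      ⟦ var i ⟧  = at ρ i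
      ⟦ con n ⟧ = ι n
      ⟦ 𝟎 ⟧     = 0#
      ⟦ 𝟏 ⟧     = 1#
      ⟦ a ⊕ b ⟧ = ⟦ a ⟧ + ⟦ b ⟧
      ⟦ a ⊗ b ⟧ = ⟦ a ⟧ * ⟦ b ⟧
      ⟦ a ⊖ b ⟧ = ⟦ a ⟧ - ⟦ b ⟧
      ⟦ ⊝ a ⟧   = - ⟦ a ⟧

      ⟦_⟧ᶜ : Coeff → ℝ
      ⟦ p , n ⟧ᶜ = ι p - ι n

      ⟦_⟧ᵐ : Monomial → ℝ
      ⟦ [] ⟧ᵐ    = 1#
      ⟦ i ∷ m ⟧ᵐ = at ρ i * ⟦ m ⟧ᵐ

      ⟦_⟧ᵖ : Polynomial → ℝ
      ⟦ [] ⟧ᵖ          = 0#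
      ⟦ (c , m) ∷ p ⟧ᵖ = ⟦ c ⟧ᶜ * ⟦ m ⟧ᵐ + ⟦ p ⟧ᵖ

      open ≈-R

      private
        interchange : ∀ a b c d → (a + b) + (c + d) ≈ (a + c) + (b + d)
        interchange a b c d = begin
          (a + b) + (c + d)  ≈⟨ +-assoc a b (c + d) ⟩
          a + (b + (c + d))  ≈⟨ +-congˡ (+-assoc b c d) ⟨
          a + ((b + c) + d)  ≈⟨ +-congˡ (+-congʳ (+-comm b c)) ⟩
          a + ((c + b) + d)  ≈⟨ +-congˡ (+-assoc c b d) ⟩
          a + (c + (b + d))  ≈⟨ +-assoc a c (b + d) ⟨
          (a + c) + (b + d)  ∎

        swapˡ : ∀ a b c → a * (b * c) ≈ b * (a * c)
        swapˡ a b c = begin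
          a * (b * c)  ≈⟨ *-assoc a b c ⟨
          (a * b) * c  ≈⟨ *-congʳ (*-comm a b) ⟩
          (b * a) * c  ≈⟨ *-assoc b a c ⟩
          b * (a * c)  ∎

        *-interchange : ∀ a b c d → (a * b) * (c * d) ≈ (a * c) * (b * d)
        *-interchange a b c d = begin
          (a * b) * (c * d)  ≈⟨ *-assoc a b (c * d) ⟩
          a * (b * (c * d))  ≈⟨ *-congˡ (swapˡ b c d) ⟩
          a * (c * (b * d))  ≈⟨ *-assoc a c (b * d) ⟨
          (a * c) * (b * d)  ∎

      +ᶜ-sound : ∀ c d → ⟦ c +ᶜ d ⟧ᶜ ≈ ⟦ c ⟧ᶜ + ⟦ d ⟧ᶜ
      +ᶜ-sound (p , n) (p′ , n′) = begin
        ι (p ℕ.+ p′) - ι (n ℕ.+ n′)         ≈⟨ +-cong (ι-+ p p′) (-‿cong (ι-+ n n′)) ⟩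
        (ι p + ι p′) - (ι n + ι n′)         ≈⟨ +-congˡ (-‿+-comm (ι n) (ι n′)) ⟨
        (ι p + ι p′) + (- ι n + - ι n′)     ≈⟨ interchange _ _ _ _ ⟩
        (ι p - ι n) + (ι p′ - ι n′)         ∎

      *ᶜ-sound : ∀ c d → ⟦ c *ᶜ d ⟧ᶜ ≈ ⟦ c ⟧ᶜ * ⟦ d ⟧ᶜ
      *ᶜ-sound (p , n) (p′ , n′) = begin
        ι (p ℕ.* p′ ℕ.+ n ℕ.* n′) - ι (p ℕ.* n′ ℕ.+ n ℕ.* p′)
          ≈⟨ +-cong (hom p p′ n n′) (-‿cong (hom p n′ n p′)) ⟩
        (ι p * ι p′ + ι n * ι n′) - (ι p * ι n′ + ι n * ι p′)
          ≈⟨ +-congˡ (-‿+-comm _ _) ⟨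
        (ι p * ι p′ + ι n * ι n′) + (- (ι p * ι n′) + - (ι n * ι p′))
          ≈⟨ +-congˡ (+-comm _ _) ⟩
        (ι p * ι p′ + ι n * ι n′) + (- (ι n * ι p′) + - (ι p * ι n′))
          ≈⟨ interchange _ _ _ _ ⟩
        (ι p * ι p′ + - (ι n * ι p′)) + (ι n * ι n′ + - (ι p * ι n′))
          ≈⟨ +-cong (+-congˡ (-‿distribˡ-* _ _)) (+-cong neg-neg (-‿distribʳ-* _ _)) ⟩
        (ι p * ι p′ + - ι n * ι p′) + (- ι n * - ι n′ + ι p * - ι n′)
          ≈⟨ +-cong (sym (distribʳ _ _ _)) (trans (+-comm _ _) (sym (distribʳ _ _ _))) ⟩
        (ι p - ι n) * ι p′ + (ι p - ι n) * - ι n′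
          ≈⟨ distribˡ _ _ _ ⟨
        (ι p - ι n) * (ι p′ - ι n′) ∎
        where
        hom : ∀ a b c d → ι (a ℕ.* b ℕ.+ c ℕ.* d) ≈ ι a * ι b + ι c * ι d
        hom a b c d = trans (ι-+ (a ℕ.* b) (c ℕ.* d)) (+-cong (ι-* a b) (ι-* c d))
        neg-neg : ι n * ι n′ ≈ - ι n * - ι n′
        neg-neg = begin
          ι n * ι n′        ≈⟨ -‿involutive _ ⟨
          - - (ι n * ι n′)  ≈⟨ -‿cong (-‿distribʳ-* _ _) ⟩
          - (ι n * - ι n′)  ≈⟨ -‿distribˡ-* _ _ ⟩
          - ι n * - ι n′    ∎

      insert-sound : ∀ i m → ⟦ insert i m ⟧ᵐ ≈ at ρ i * ⟦ m ⟧ᵐ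
      insert-sound i [] = refl
      insert-sound i (j ∷ m) with i ℕ.≤ᵇ j
      ... | true  = refl
      ... | false = begin
        at ρ j * ⟦ insert i m ⟧ᵐ     ≈⟨ *-congˡ (insert-sound i m) ⟩
        at ρ j * (at ρ i * ⟦ m ⟧ᵐ)   ≈⟨ swapˡ _ _ _ ⟩
        at ρ i * (at ρ j * ⟦ m ⟧ᵐ)   ∎

      *ᵐ-sound : ∀ m n → ⟦ m *ᵐ n ⟧ᵐ ≈ ⟦ m ⟧ᵐ * ⟦ n ⟧ᵐ
      *ᵐ-sound []      n = sym (*-identityˡ _)
      *ᵐ-sound (i ∷ m) n = begin
        ⟦ insert i (m *ᵐ n) ⟧ᵐ       ≈⟨ insert-sound i (m *ᵐ n) ⟩
        at ρ i * ⟦ m *ᵐ n ⟧ᵐ         ≈⟨ *-congˡ (*ᵐ-sound m n) ⟩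
        at ρ i * (⟦ m ⟧ᵐ * ⟦ n ⟧ᵐ)   ≈⟨ *-assoc _ _ _ ⟨
        (at ρ i * ⟦ m ⟧ᵐ) * ⟦ n ⟧ᵐ   ∎

      addTerm-sound : ∀ c m p → ⟦ addTerm c m p ⟧ᵖ ≈ ⟦ c ⟧ᶜ * ⟦ m ⟧ᵐ + ⟦ p ⟧ᵖ
      addTerm-sound c m [] = refl
      addTerm-sound c m ((d , n) ∷ p) with Listₚ.≡-dec ℕₚ._≟_ m n
      ... | yes ≡.refl = begin
        ⟦ c +ᶜ d ⟧ᶜ * ⟦ n ⟧ᵐ + ⟦ p ⟧ᵖ                    ≈⟨ +-congʳ (*-congʳ (+ᶜ-sound c d)) ⟩
        (⟦ c ⟧ᶜ + ⟦ d ⟧ᶜ) * ⟦ n ⟧ᵐ + ⟦ p ⟧ᵖ              ≈⟨ +-congʳ (distribʳ _ _ _) ⟩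
        (⟦ c ⟧ᶜ * ⟦ n ⟧ᵐ + ⟦ d ⟧ᶜ * ⟦ n ⟧ᵐ) + ⟦ p ⟧ᵖ     ≈⟨ +-assoc _ _ _ ⟩
        ⟦ c ⟧ᶜ * ⟦ n ⟧ᵐ + (⟦ d ⟧ᶜ * ⟦ n ⟧ᵐ + ⟦ p ⟧ᵖ)     ∎
      ... | no _ = begin
        ⟦ d ⟧ᶜ * ⟦ n ⟧ᵐ + ⟦ addTerm c m p ⟧ᵖ             ≈⟨ +-congˡ (addTerm-sound c m p) ⟩
        ⟦ d ⟧ᶜ * ⟦ n ⟧ᵐ + (⟦ c ⟧ᶜ * ⟦ m ⟧ᵐ + ⟦ p ⟧ᵖ)     ≈⟨ +-assoc _ _ _ ⟨
        (⟦ d ⟧ᶜ * ⟦ n ⟧ᵐ + ⟦ c ⟧ᶜ * ⟦ m ⟧ᵐ) + ⟦ p ⟧ᵖ     ≈⟨ +-congʳ (+-comm _ _) ⟩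
        (⟦ c ⟧ᶜ * ⟦ m ⟧ᵐ + ⟦ d ⟧ᶜ * ⟦ n ⟧ᵐ) + ⟦ p ⟧ᵖ     ≈⟨ +-assoc _ _ _ ⟩
        ⟦ c ⟧ᶜ * ⟦ m ⟧ᵐ + (⟦ d ⟧ᶜ * ⟦ n ⟧ᵐ + ⟦ p ⟧ᵖ)     ∎

      addScaled-sound : ∀ c m p r →
        ⟦ addScaled c m p r ⟧ᵖ ≈ (⟦ c ⟧ᶜ * ⟦ m ⟧ᵐ) * ⟦ p ⟧ᵖ + ⟦ r ⟧ᵖ
      addScaled-sound c m [] r = sym (trans (+-congʳ (zeroʳ _)) (+-identityˡ _))
      addScaled-sound c m ((d , n) ∷ p) r = begin
        ⟦ addTerm (c *ᶜ d) (m *ᵐ n) (addScaled c m p r) ⟧ᵖ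
          ≈⟨ addTerm-sound (c *ᶜ d) (m *ᵐ n) (addScaled c m p r) ⟩
        ⟦ c *ᶜ d ⟧ᶜ * ⟦ m *ᵐ n ⟧ᵐ + ⟦ addScaled c m p r ⟧ᵖ
          ≈⟨ +-cong (*-cong (*ᶜ-sound c d) (*ᵐ-sound m n)) (addScaled-sound c m p r) ⟩
        (⟦ c ⟧ᶜ * ⟦ d ⟧ᶜ) * (⟦ m ⟧ᵐ * ⟦ n ⟧ᵐ) + ((⟦ c ⟧ᶜ * ⟦ m ⟧ᵐ) * ⟦ p ⟧ᵖ + ⟦ r ⟧ᵖ)
          ≈⟨ +-congʳ (*-interchange _ _ _ _) ⟩
        (⟦ c ⟧ᶜ * ⟦ m ⟧ᵐ) * (⟦ d ⟧ᶜ * ⟦ n ⟧ᵐ) + ((⟦ c ⟧ᶜ * ⟦ m ⟧ᵐ) * ⟦ p ⟧ᵖ + ⟦ r ⟧ᵖ)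
          ≈⟨ +-assoc _ _ _ ⟨
        (⟦ c ⟧ᶜ * ⟦ m ⟧ᵐ) * (⟦ d ⟧ᶜ * ⟦ n ⟧ᵐ) + (⟦ c ⟧ᶜ * ⟦ m ⟧ᵐ) * ⟦ p ⟧ᵖ + ⟦ r ⟧ᵖ
          ≈⟨ +-congʳ (distribˡ _ _ _) ⟨
        (⟦ c ⟧ᶜ * ⟦ m ⟧ᵐ) * (⟦ d ⟧ᶜ * ⟦ n ⟧ᵐ + ⟦ p ⟧ᵖ) + ⟦ r ⟧ᵖ ∎

      *ᵖ-sound : ∀ p q → ⟦ p *ᵖ q ⟧ᵖ ≈ ⟦ p ⟧ᵖ * ⟦ q ⟧ᵖ
      *ᵖ-sound [] q = sym (zeroˡ _)
      *ᵖ-sound ((c , m) ∷ p) q = begin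
        ⟦ addScaled c m q (p *ᵖ q) ⟧ᵖ                     ≈⟨ addScaled-sound c m q (p *ᵖ q) ⟩
        (⟦ c ⟧ᶜ * ⟦ m ⟧ᵐ) * ⟦ q ⟧ᵖ + ⟦ p *ᵖ q ⟧ᵖ          ≈⟨ +-congˡ (*ᵖ-sound p q) ⟩
        (⟦ c ⟧ᶜ * ⟦ m ⟧ᵐ) * ⟦ q ⟧ᵖ + ⟦ p ⟧ᵖ * ⟦ q ⟧ᵖ      ≈⟨ distribʳ _ _ _ ⟨
        (⟦ c ⟧ᶜ * ⟦ m ⟧ᵐ + ⟦ p ⟧ᵖ) * ⟦ q ⟧ᵖ               ∎

      private
        ⟦n,0⟧ : ∀ n → ⟦ n , 0 ⟧ᶜ ≈ ι n
        ⟦n,0⟧ n = trans (+-congˡ -0#≈0#) (+-identityʳ _)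
          where open RingProperties ring using (-0#≈0#)

        ⟦1,0⟧ : ⟦ 1 , 0 ⟧ᶜ ≈ 1#
        ⟦1,0⟧ = trans (⟦n,0⟧ 1) ι-1

        one : ⟦ 1 , 0 ⟧ᶜ * 1# ≈ 1#
        one = trans (*-identityʳ _) ⟦1,0⟧

        minus : ∀ x → (⟦ 0 , 1 ⟧ᶜ * 1#) * x ≈ - x
        minus x = begin
          (⟦ 0 , 1 ⟧ᶜ * 1#) * x  ≈⟨ *-congʳ (trans (*-identityʳ _) (trans (+-identityˡ _) (-‿cong ι-1))) ⟩
          - 1# * x               ≈⟨ -‿distribˡ-* _ _ ⟨
          - (1# * x)             ≈⟨ -‿cong (*-identityˡ x) ⟩
          - x                    ∎

      normalForm-sound : ∀ e → ⟦ normalForm e ⟧ᵖ ≈ ⟦ e ⟧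
      normalForm-sound (var i) = begin
        ⟦ 1 , 0 ⟧ᶜ * (at ρ i * 1#) + 0#  ≈⟨ +-identityʳ _ ⟩
        ⟦ 1 , 0 ⟧ᶜ * (at ρ i * 1#)       ≈⟨ *-cong ⟦1,0⟧ (*-identityʳ _) ⟩
        1# * at ρ i                      ≈⟨ *-identityˡ _ ⟩
        at ρ i                           ∎
      normalForm-sound (con n) = trans (+-identityʳ _) (trans (*-identityʳ _) (⟦n,0⟧ n))
      normalForm-sound 𝟎 = refl
      normalForm-sound 𝟏 = trans (+-identityʳ _) one
      normalForm-sound (a ⊕ b) = begin
        ⟦ addScaled (1 , 0) [] (normalForm a) (normalForm b) ⟧ᵖ
          ≈⟨ addScaled-sound (1 , 0) [] (normalForm a) (normalForm b) ⟩
        (⟦ 1 , 0 ⟧ᶜ * 1#) * ⟦ normalForm a ⟧ᵖ + ⟦ normalForm b ⟧ᵖ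
          ≈⟨ +-cong (trans (*-congʳ one) (*-identityˡ _)) (normalForm-sound b) ⟩
        ⟦ normalForm a ⟧ᵖ + ⟦ b ⟧
          ≈⟨ +-congʳ (normalForm-sound a) ⟩
        ⟦ a ⟧ + ⟦ b ⟧ ∎
      normalForm-sound (a ⊗ b) =
        trans (*ᵖ-sound (normalForm a) (normalForm b))
              (*-cong (normalForm-sound a) (normalForm-sound b))
      normalForm-sound (a ⊖ b) = begin
        ⟦ addScaled (0 , 1) [] (normalForm b) (normalForm a) ⟧ᵖ
          ≈⟨ addScaled-sound (0 , 1) [] (normalForm b) (normalForm a) ⟩
        (⟦ 0 , 1 ⟧ᶜ * 1#) * ⟦ normalForm b ⟧ᵖ + ⟦ normalForm a ⟧ᵖ
          ≈⟨ +-cong (trans (minus _) (-‿cong (normalForm-sound b))) (normalForm-sound a) ⟩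
        - ⟦ b ⟧ + ⟦ a ⟧
          ≈⟨ +-comm _ _ ⟩
        ⟦ a ⟧ - ⟦ b ⟧ ∎
      normalForm-sound (⊝ a) = begin
        ⟦ addScaled (0 , 1) [] (normalForm a) [] ⟧ᵖ
          ≈⟨ addScaled-sound (0 , 1) [] (normalForm a) [] ⟩
        (⟦ 0 , 1 ⟧ᶜ * 1#) * ⟦ normalForm a ⟧ᵖ + 0#
          ≈⟨ trans (+-identityʳ _) (trans (minus _) (-‿cong (normalForm-sound a))) ⟩
        - ⟦ a ⟧ ∎

      vanishes-sound : ∀ p → Bool.T (vanishes p) → ⟦ p ⟧ᵖ ≈ 0#
      vanishes-sound [] _ = refl
      vanishes-sound (((p , n) , m) ∷ q) t with p ℕ.≡ᵇ n in eq
      ... | true = begin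
        (ι p - ι n) * ⟦ m ⟧ᵐ + ⟦ q ⟧ᵖ  ≈⟨ +-cong (*-congʳ p-n) (vanishes-sound q t) ⟩
        0# * ⟦ m ⟧ᵐ + 0#               ≈⟨ trans (+-identityʳ _) (zeroˡ _) ⟩
        0#                             ∎
        where
        p-n : ι p - ι n ≈ 0#
        p-n with ≡.refl ← ℕₚ.≡ᵇ⇒≡ p n (≡.subst Bool.T (≡.sym eq) _) = -‿inverseʳ _

      opaque
        -- When the normal form of the difference vanishes, the hidden argument has the unit type
        -- and is inferred, so checking an identity is a computation with natural numbers only.
        solve : ∀ e₁ e₂ {_ : Bool.T (vanishes (normalForm (e₁ ⊖ e₂)))} → ⟦ e₁ ⟧ ≈ ⟦ e₂ ⟧
        solve e₁ e₂ {t} = begin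
          ⟦ e₁ ⟧                      ≈⟨ +-identityʳ _ ⟨
          ⟦ e₁ ⟧ + 0#                 ≈⟨ +-congˡ (-‿inverseˡ _) ⟨
          ⟦ e₁ ⟧ + (- ⟦ e₂ ⟧ + ⟦ e₂ ⟧) ≈⟨ +-assoc _ _ _ ⟨
          ⟦ e₁ ⊖ e₂ ⟧ + ⟦ e₂ ⟧        ≈⟨ +-congʳ (trans (sym (normalForm-sound (e₁ ⊖ e₂))) (vanishes-sound (normalForm (e₁ ⊖ e₂)) t)) ⟩
          0# + ⟦ e₂ ⟧                 ≈⟨ +-identityˡ _ ⟩
          ⟦ e₂ ⟧                      ∎

  open RingSolver public

  -- Ordered field arithmetic, absolute values, and the naturals inside the reals.

  module OrderedField where
    open IsTotalOrder isTotalOrder public using (antisym)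
      renaming (refl to ≤-refl; trans to ≤-trans; reflexive to ≤-reflexive; total to ≤-total)

    private variable
      a b c e l r x y z : ℝ

    -- The device behind most inequalities below: the hypotheses are combined by hand into one
    -- inequality `l ≤ r`, and the claim differs from it by a ring identity, which is left to
    -- `solve`.
    ≤-by : l ≤ r → b - a ≈ r - l → a ≤ b
    ≤-by {l} {r} {b} {a} l≤r eq =
      ≤-trans (≤-reflexive (solve (a ∷ l ∷ []) (var 0) (var 1 ⊕ (var 0 ⊖ var 1))))
      (≤-trans (+-monoˡ-≤ (a - l) l≤r)
      (≤-reflexive (begin
        r + (a - l)  ≈⟨ solve (r ∷ a ∷ l ∷ []) (var 0 ⊕ (var 1 ⊖ var 2)) (var 0 ⊖ var 2 ⊕ var 1) ⟩
        (r - l) + a  ≈⟨ +-congʳ eq ⟨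
        (b - a) + a  ≈⟨ solve (b ∷ a ∷ []) (var 0 ⊖ var 1 ⊕ var 1) (var 0) ⟩
        b            ∎)))
      where open ≈-R

    ≈-by : l ≈ r → b - a ≈ r - l → a ≈ b
    ≈-by {l} {r} {b} {a} l≈r eq = begin
      a            ≈⟨ solve (a ∷ l ∷ []) (var 0) (var 1 ⊖ var 1 ⊕ var 0) ⟩
      (l - l) + a  ≈⟨ +-congʳ (+-congʳ l≈r) ⟩
      (r - l) + a  ≈⟨ +-congʳ eq ⟨
      (b - a) + a  ≈⟨ solve (b ∷ a ∷ []) (var 0 ⊖ var 1 ⊕ var 1) (var 0) ⟩
      b            ∎
      where open ≈-R

    <-by : l < r → b - a ≈ r - l → a < b
    <-by {l} {r} {b} {a} (l≤r , l≉r) eq = ≤-by l≤r eq , λ a≈b → l≉r (≈-by a≈b (sym eq))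

    <⇒≤ : x < y → x ≤ y
    <⇒≤ = proj₁

    <-≤-trans : x < y → y ≤ z → x < z
    <-≤-trans (x≤y , x≉y) y≤z =
      ≤-trans x≤y y≤z , λ x≈z → x≉y (antisym x≤y (≤-trans y≤z (≤-reflexive (sym x≈z))))

    ≤-<-trans : x ≤ y → y < z → x < z
    ≤-<-trans x≤y (y≤z , y≉z) =
      ≤-trans x≤y y≤z , λ x≈z → y≉z (antisym y≤z (≤-trans (≤-reflexive (sym x≈z)) x≤y))

    <⇒≱ : x < y → ¬ (y ≤ x)
    <⇒≱ (x≤y , x≉y) y≤x = x≉y (antisym x≤y y≤x)

    ≤-or-> : ∀ x y → x ≤ y ⊎ y < x
    ≤-or-> x y with lem {P = x ≤ y}
    ... | yes x≤y = inj₁ x≤y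
    ... | no  x≰y with ≤-total x y
    ...   | inj₁ x≤y = inj₁ x≤y
    ...   | inj₂ y≤x = inj₂ (y≤x , λ y≈x → x≰y (≤-reflexive (sym y≈x)))

    ≮⇒≥ : ¬ (x < y) → y ≤ x
    ≮⇒≥ {x} {y} x≮y with ≤-or-> y x
    ... | inj₁ y≤x = y≤x
    ... | inj₂ x<y = contradiction x<y x≮y

    infixl 6 _+≤_ _+<≤_

    _+≤_ : a ≤ b → x ≤ y → a + x ≤ b + y
    _+≤_ {a} {b} {x} {y} a≤b x≤y =
      ≤-trans (+-monoˡ-≤ x a≤b) (≤-by x≤y (solve (a ∷ b ∷ x ∷ y ∷ []) (var 1 ⊕ var 3 ⊖ (var 1 ⊕ var 2))
          (var 3 ⊖ var 2)))

    _+<≤_ : a < b → x ≤ y → a + x < b + y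
    _+<≤_ {a} {b} {x} {y} a<b x≤y =
      <-≤-trans {y = b + x} (<-by a<b (solve (a ∷ b ∷ x ∷ []) (var 1 ⊕ var 2 ⊖ (var 0 ⊕ var 2))
          (var 1 ⊖ var 0))) (≤-by x≤y (solve (b ∷ x ∷ y ∷ []) (var 0 ⊕ var 2 ⊖ (var 0 ⊕ var 1))
              (var 2 ⊖ var 1)))

    0≤⇒≤ : 0# ≤ b - a → a ≤ b
    0≤⇒≤ {b} {a} p = ≤-by p (solve (a ∷ b ∷ []) (var 1 ⊖ var 0) (var 1 ⊖ var 0 ⊖ 𝟎))

    ≤⇒0≤ : a ≤ b → 0# ≤ b - a
    ≤⇒0≤ {a} {b} p = ≤-by p (solve (a ∷ b ∷ []) (var 1 ⊖ var 0 ⊖ 𝟎) (var 1 ⊖ var 0))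

    <⇒0< : a < b → 0# < b - a
    <⇒0< {a} {b} p = <-by p (solve (a ∷ b ∷ []) (var 1 ⊖ var 0 ⊖ 𝟎) (var 1 ⊖ var 0))

    +-nonNeg : 0# ≤ x → 0# ≤ y → 0# ≤ x + y
    +-nonNeg {x} {y} p q = ≤-by (p +≤ q) (solve (x ∷ y ∷ []) (var 0 ⊕ var 1 ⊖ 𝟎)
        (var 0 ⊕ var 1 ⊖ (𝟎 ⊕ 𝟎)))

    infixr 7 _*≤_
    _*≤_ : 0# ≤ c → x ≤ y → c * x ≤ c * y
    _*≤_ {c} {x} {y} 0≤c x≤y = ≤-by (*-nonNeg 0≤c (≤⇒0≤ x≤y)) (solve (c ∷ x ∷ y ∷ [])
        (var 0 ⊗ var 2 ⊖ var 0 ⊗ var 1) (var 0 ⊗ (var 2 ⊖ var 1) ⊖ 𝟎))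

    *-mono-≤ : 0# ≤ a → a ≤ b → 0# ≤ x → x ≤ y → a * x ≤ b * y
    *-mono-≤ {a} {b} {x} {y} 0≤a a≤b 0≤x x≤y =
      ≤-by ((≤-trans 0≤a a≤b) *≤ x≤y +≤ 0≤x *≤ a≤b) (solve (a ∷ b ∷ x ∷ y ∷ [])
          (var 1 ⊗ var 3 ⊖ var 0 ⊗ var 2)
          (var 1 ⊗ var 3 ⊕ var 2 ⊗ var 1 ⊖ (var 1 ⊗ var 2 ⊕ var 2 ⊗ var 0)))

    sq-nonNeg : ∀ x → 0# ≤ x * x
    sq-nonNeg x with ≤-total 0# x
    ... | inj₁ 0≤x = *-nonNeg 0≤x 0≤x
    ... | inj₂ x≤0 = ≤-trans (*-nonNeg 0≤-x 0≤-x) (≤-reflexive (solve (x ∷ []) (⊝ var 0 ⊗ (⊝ var 0))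
        (var 0 ⊗ var 0)))
      where
      0≤-x : 0# ≤ - x
      0≤-x = ≤-by x≤0 (solve (x ∷ []) (⊝ var 0 ⊖ 𝟎) (𝟎 ⊖ var 0))

    0≤1 : 0# ≤ 1#
    0≤1 = ≤-trans (sq-nonNeg 1#) (≤-reflexive (solve [] (𝟏 ⊗ 𝟏) 𝟏))

    0<1 : 0# < 1#
    0<1 = 0≤1 , 0≉1

    pos⇒≉0 : 0# < x → ¬ (x ≈ 0#)
    pos⇒≉0 (_ , 0≉x) x≈0 = 0≉x (sym x≈0)

    *-pos : 0# < x → 0# < y → 0# < x * y
    *-pos {x} {y} 0<x 0<y = *-nonNeg (<⇒≤ 0<x) (<⇒≤ 0<y) , λ 0≈xy →
      let (i , xi≈1) = inverse x (pos⇒≉0 0<x) in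
      proj₂ 0<y (begin
        0#           ≈⟨ solve (i ∷ []) 𝟎 (var 0 ⊗ 𝟎) ⟩
        i * 0#       ≈⟨ *-congˡ 0≈xy ⟩
        i * (x * y)  ≈⟨ solve (i ∷ x ∷ y ∷ []) (var 0 ⊗ (var 1 ⊗ var 2)) (var 1 ⊗ var 0 ⊗ var 2) ⟩
        (x * i) * y  ≈⟨ *-congʳ xi≈1 ⟩
        1# * y       ≈⟨ solve (y ∷ []) (𝟏 ⊗ var 0) (var 0) ⟩
        y            ∎)
      where open ≈-R

    infixr 7 _*<_
    _*<_ : 0# < c → x < y → c * x < c * y
    _*<_ {c} {x} {y} 0<c x<y = <-by (*-pos 0<c (<⇒0< x<y)) (solve (c ∷ x ∷ y ∷ [])
        (var 0 ⊗ var 2 ⊖ var 0 ⊗ var 1) (var 0 ⊗ (var 2 ⊖ var 1) ⊖ 𝟎))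

    *-cancel-≤ : 0# < c → c * x ≤ c * y → x ≤ y
    *-cancel-≤ {c} {x} {y} 0<c cx≤cy with ≤-or-> x y
    ... | inj₁ x≤y = x≤y
    ... | inj₂ y<x = contradiction cx≤cy (<⇒≱ (0<c *< y<x))

    *-cancel-< : 0# ≤ c → c * x < c * y → x < y
    *-cancel-< {c} {x} {y} 0≤c cx<cy with ≤-or-> y x
    ... | inj₁ y≤x = contradiction (0≤c *≤ y≤x) (<⇒≱ cx<cy)
    ... | inj₂ x<y = x<y

    *-cancel-≈ : 0# < c → c * x ≈ c * y → x ≈ y
    *-cancel-≈ 0<c eq = antisym (*-cancel-≤ 0<c (≤-reflexive eq)) (*-cancel-≤ 0<c (≤-reflexive (sym eq)))

    opaque
      -- Inverses, floors, suprema, `exp` and `log` are all reached through this one fact: an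
      -- existence proof yields the defining property of the chosen value. Uniqueness is proved
      -- separately where it matters.
      the-spec : ∀ (P : ℝ → Set) → ∃ P → P (the P)
      the-spec P e with lem {P = ∃ P}
      ... | yes (_ , p) = p
      ... | no ¬e       = contradiction e ¬e

    ⁻¹-inverse : 0# < x → x * x ⁻¹ ≈ 1#
    ⁻¹-inverse {x} 0<x = the-spec (λ y → x * y ≈ 1#) (inverse x (pos⇒≉0 0<x))

    ⁻¹-pos : 0# < x → 0# < x ⁻¹
    ⁻¹-pos {x} 0<x = *-cancel-< (<⇒≤ 0<x) (<-by 0<1 (begin
      x * x ⁻¹ - x * 0#  ≈⟨ +-cong (⁻¹-inverse 0<x) (-‿cong (zeroʳ x)) ⟩
      1# - 0#            ∎))
      where open ≈-R

    /-cancel : 0# < x → x * (y / x) ≈ y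
    /-cancel {x} {y} 0<x = begin
      x * (y * x ⁻¹)  ≈⟨ solve (x ∷ y ∷ x ⁻¹ ∷ []) (var 0 ⊗ (var 1 ⊗ var 2)) (var 1 ⊗ (var 0 ⊗ var 2)) ⟩
      y * (x * x ⁻¹)  ≈⟨ *-congˡ (⁻¹-inverse 0<x) ⟩
      y * 1#          ≈⟨ *-identityʳ y ⟩
      y               ∎
      where open ≈-R

    ∣∣-≤ : - e ≤ x → x ≤ e → ∣ x ∣ ≤ e
    ∣∣-≤ {e} {x} -e≤x x≤e with IsTotalOrder.total isTotalOrder 0# x
    ... | inj₁ _ = x≤e
    ... | inj₂ _ = ≤-by -e≤x (solve (e ∷ x ∷ []) (var 0 ⊖ ⊝ var 1) (var 1 ⊖ ⊝ var 0))

    x≤∣x∣ : ∀ x → x ≤ ∣ x ∣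
    x≤∣x∣ x with IsTotalOrder.total isTotalOrder 0# x
    ... | inj₁ _   = ≤-refl
    ... | inj₂ x≤0 = ≤-by (x≤0 +≤ x≤0) (solve (x ∷ []) (⊝ var 0 ⊖ var 0) (𝟎 ⊕ 𝟎 ⊖ (var 0 ⊕ var 0)))

    -x≤∣x∣ : ∀ x → - x ≤ ∣ x ∣
    -x≤∣x∣ x with IsTotalOrder.total isTotalOrder 0# x
    ... | inj₁ 0≤x = ≤-by (0≤x +≤ 0≤x) (solve (x ∷ []) (var 0 ⊖ ⊝ var 0) (var 0 ⊕ var 0 ⊖ (𝟎 ⊕ 𝟎)))
    ... | inj₂ _   = ≤-refl

    ∣∣-nonNeg : ∀ x → 0# ≤ ∣ x ∣
    ∣∣-nonNeg x with IsTotalOrder.total isTotalOrder 0# x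
    ... | inj₁ 0≤x = 0≤x
    ... | inj₂ x≤0 = ≤-by x≤0 (solve (x ∷ []) (⊝ var 0 ⊖ 𝟎) (𝟎 ⊖ var 0))

    ∣∣-< : - e < x → x < e → ∣ x ∣ < e
    ∣∣-< {e} {x} -e<x x<e with IsTotalOrder.total isTotalOrder 0# x
    ... | inj₁ _ = x<e
    ... | inj₂ _ = <-by -e<x (solve (e ∷ x ∷ []) (var 0 ⊖ ⊝ var 1) (var 1 ⊖ ⊝ var 0))

    ι-nonNeg : ∀ n → 0# ≤ ι n
    ι-nonNeg zero    = ≤-refl
    ι-nonNeg (suc n) = +-nonNeg 0≤1 (ι-nonNeg n)

    ι-pos : ∀ {n} → 1 ℕ.≤ n → 0# < ι n
    ι-pos {suc n} _ = <-by (0<1 +<≤ ι-nonNeg n) (solve (ι n ∷ []) (𝟏 ⊕ var 0 ⊖ 𝟎) (𝟏 ⊕ var 0 ⊖ (𝟎 ⊕ 𝟎)))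

    ι-mono-≤ : ∀ {m n} → m ℕ.≤ n → ι m ≤ ι n
    ι-mono-≤ {n = n} ℕ.z≤n = ι-nonNeg n
    ι-mono-≤ (ℕ.s≤s m≤n)   = ≤-refl +≤ ι-mono-≤ m≤n

    ι-mono-< : ∀ {m n} → m ℕ.< n → ι m < ι n
    ι-mono-< {m} m<n = <-≤-trans (<-by 0<1 (solve (ι m ∷ []) (𝟏 ⊕ var 0 ⊖ var 0) (𝟏 ⊖ 𝟎))) (ι-mono-≤ m<n)

    ι-cancel-≤ : ∀ {m n} → ι m ≤ ι n → m ℕ.≤ n
    ι-cancel-≤ {m} {n} p with m ℕₚ.≤? n
    ... | yes m≤n = m≤n
    ... | no  m≰n = contradiction p (<⇒≱ (ι-mono-< (ℕₚ.≰⇒> m≰n)))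

    ι-cancel-< : ∀ {m n} → ι m < ι n → m ℕ.< n
    ι-cancel-< {m} {n} p with m ℕₚ.<? n
    ... | yes m<n = m<n
    ... | no  m≮n = contradiction (ι-mono-≤ (ℕₚ.≮⇒≥ m≮n)) (<⇒≱ p)

    1≤ι : ∀ {n} → 1 ℕ.≤ n → 1# ≤ ι n
    1≤ι p = ≤-trans (≤-reflexive (sym ι-1)) (ι-mono-≤ p)

    ι-^ : ∀ m k → ι (m ℕ.^ k) ≈ ι m ^ℕ k
    ι-^ m zero    = ι-1
    ι-^ m (suc k) = trans (ι-* m (m ℕ.^ k)) (*-congˡ (ι-^ m k))

    opaque
      -- If `x` exceeded every cast, the casts would have a supremum `s`; since they are closed
      -- under adding 1, `s - 1` would be an upper bound too.
      archimedean : ∀ x → ∃ λ n → x ≤ ι n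
      archimedean x with lem {P = ∃ λ n → x ≤ ι n}
      ... | yes p = p
      ... | no ¬p = contradiction s≤s-1 (<⇒≱ (<-by 0<1 (solve (s ∷ []) (var 0 ⊖ (var 0 ⊖ 𝟏)) (𝟏 ⊖ 𝟎))))
        where
        IsCast : ℝ → Set
        IsCast y = ∃ λ n → y ≈ ι n
        bound : ∀ y → IsCast y → y ≤ x
        bound y (n , y≈n) with ≤-or-> y x
        ... | inj₁ y≤x = y≤x
        ... | inj₂ x<y = contradiction (n , ≤-trans (<⇒≤ x<y) (≤-reflexive y≈n)) ¬p
        supremum : ∃ (IsSupremum IsCast)
        supremum = complete IsCast (0# , 0 , refl) (x , bound)
        s : ℝ
        s = proj₁ supremum
        s≤s-1 : s ≤ s - 1#
        s≤s-1 = proj₂ (proj₂ supremum) (s - 1#) λ y (n , y≈n) →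
          ≤-by (proj₁ (proj₂ supremum) (1# + y) (suc n , +-congˡ y≈n)) (solve (y ∷ s ∷ [])
              (var 1 ⊖ 𝟏 ⊖ var 0) (var 1 ⊖ (𝟏 ⊕ var 0)))

    ½ : ℝ
    ½ = ι 2 ⁻¹

    0<2 : 0# < ι 2
    0<2 = ι-pos {2} (ℕ.s≤s ℕ.z≤n)

    ½-spec : ι 2 * ½ ≈ 1#
    ½-spec = ⁻¹-inverse 0<2

    0<½ : 0# < ½
    0<½ = ⁻¹-pos 0<2

  open OrderedField public

  -- Finite sums, integers among the reals, and floors.

  module SumsAndFloors where
    private variable
      x y u w : ℝ

    ∑-cong : ∀ {f g : ℕ → ℝ} n → (∀ i → i ℕ.< n → f i ≈ g i) → ∑ f n ≈ ∑ g n
    ∑-cong zero    _ = refl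
    ∑-cong (suc n) h = +-cong (∑-cong n λ i i<n → h i (ℕₚ.m<n⇒m<1+n i<n)) (h n ℕₚ.≤-refl)

    ∑-mono : ∀ {f g : ℕ → ℝ} n → (∀ i → i ℕ.< n → f i ≤ g i) → ∑ f n ≤ ∑ g n
    ∑-mono zero    _ = ≤-refl
    ∑-mono (suc n) h = ∑-mono n (λ i i<n → h i (ℕₚ.m<n⇒m<1+n i<n)) +≤ h n ℕₚ.≤-refl

    ∑-+ : ∀ (f g : ℕ → ℝ) n → ∑ (λ i → f i + g i) n ≈ ∑ f n + ∑ g n
    ∑-+ f g zero    = solve [] 𝟎 (𝟎 ⊕ 𝟎)
    ∑-+ f g (suc n) = trans (+-congʳ (∑-+ f g n)) (solve (∑ f n ∷ ∑ g n ∷ f n ∷ g n ∷ [])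
        (var 0 ⊕ var 1 ⊕ (var 2 ⊕ var 3)) (var 0 ⊕ var 2 ⊕ (var 1 ⊕ var 3)))

    ∑-*ˡ : ∀ c (f : ℕ → ℝ) n → ∑ (λ i → c * f i) n ≈ c * ∑ f n
    ∑-*ˡ c f zero    = solve (c ∷ []) 𝟎 (var 0 ⊗ 𝟎)
    ∑-*ˡ c f (suc n) = trans (+-congʳ (∑-*ˡ c f n)) (solve (c ∷ ∑ f n ∷ f n ∷ [])
        (var 0 ⊗ var 1 ⊕ var 0 ⊗ var 2) (var 0 ⊗ (var 1 ⊕ var 2)))

    ∑-- : ∀ (f g : ℕ → ℝ) n → ∑ (λ i → f i - g i) n ≈ ∑ f n - ∑ g n
    ∑-- f g zero    = solve [] 𝟎 (𝟎 ⊖ 𝟎)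
    ∑-- f g (suc n) = trans (+-congʳ (∑-- f g n)) (solve (∑ f n ∷ ∑ g n ∷ f n ∷ g n ∷ [])
        (var 0 ⊖ var 1 ⊕ (var 2 ⊖ var 3)) (var 0 ⊕ var 2 ⊖ (var 1 ⊕ var 3)))

    ∑-const : ∀ c n → ∑ (λ _ → c) n ≈ ι n * c
    ∑-const c zero    = solve (c ∷ []) 𝟎 (con 0 ⊗ var 0)
    ∑-const c (suc n) = trans (+-congʳ (∑-const c n)) (solve (ι n ∷ c ∷ []) (var 0 ⊗ var 1 ⊕ var 1)
        ((𝟏 ⊕ var 0) ⊗ var 1))

    ∑-split : ∀ (f : ℕ → ℝ) m n → ∑ f (m ℕ.+ n) ≈ ∑ f m + ∑ (λ i → f (m ℕ.+ i)) n
    ∑-split f m zero rewrite ℕₚ.+-identityʳ m = sym (+-identityʳ _)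
    ∑-split f m (suc n) rewrite ℕₚ.+-suc m n = trans (+-congʳ (∑-split f m n)) (+-assoc _ _ _)

    ∑-head : ∀ (f : ℕ → ℝ) n → ∑ f (suc n) ≈ f 0 + ∑ (λ i → f (suc i)) n
    ∑-head f n = trans (∑-split f 1 n) (+-congʳ (+-identityˡ (f 0)))

    ∑-nonNeg : ∀ {f : ℕ → ℝ} n → (∀ i → 0# ≤ f i) → 0# ≤ ∑ f n
    ∑-nonNeg zero    _ = ≤-refl
    ∑-nonNeg (suc n) h = +-nonNeg (∑-nonNeg n h) (h n)

    -- Differences of naturals instead of images of ℤ: closure under the ring operations then needs
    -- no case distinction on signs. `int-ιℤ` translates back for the definition of `⌊_⌋`, which
    -- speaks of ℤ.
    IsInt : ℝ → Set
    IsInt u = ∃₂ λ m n → u ≈ ι m - ι n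

    int-resp : u ≈ w → IsInt u → IsInt w
    int-resp u≈w (m , n , eq) = m , n , trans (sym u≈w) eq

    int-ι : ∀ n → IsInt (ι n)
    int-ι n = n , 0 , solve (ι n ∷ []) (var 0) (var 0 ⊖ con 0)

    int-1 : IsInt 1#
    int-1 = int-resp ι-1 (int-ι 1)

    int-+ : IsInt u → IsInt w → IsInt (u + w)
    int-+ {u} {w} (m , n , eq) (m′ , n′ , eq′) = m ℕ.+ m′ , n ℕ.+ n′ , (begin
      u + w                          ≈⟨ +-cong eq eq′ ⟩
      (ι m - ι n) + (ι m′ - ι n′)    ≈⟨ solve (ι m ∷ ι n ∷ ι m′ ∷ ι n′ ∷ [])
          (var 0 ⊖ var 1 ⊕ (var 2 ⊖ var 3)) (var 0 ⊕ var 2 ⊖ (var 1 ⊕ var 3)) ⟩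
      (ι m + ι m′) - (ι n + ι n′)    ≈⟨ +-cong (ι-+ m m′) (-‿cong (ι-+ n n′)) ⟨
      ι (m ℕ.+ m′) - ι (n ℕ.+ n′)    ∎)
      where open ≈-R

    int-neg : IsInt u → IsInt (- u)
    int-neg {u} (m , n , eq) = n , m , trans (-‿cong eq) (solve (ι m ∷ ι n ∷ []) (⊝ (var 0 ⊖ var 1))
        (var 1 ⊖ var 0))

    int-- : IsInt u → IsInt w → IsInt (u - w)
    int-- p q = int-+ p (int-neg q)

    int-ι* : ∀ k → IsInt u → IsInt (ι k * u)
    int-ι* {u} k (m , n , eq) = k ℕ.* m , k ℕ.* n , (begin
      ι k * u                      ≈⟨ *-congˡ eq ⟩
      ι k * (ι m - ι n)            ≈⟨ solve (ι k ∷ ι m ∷ ι n ∷ []) (var 0 ⊗ (var 1 ⊖ var 2))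
          (var 0 ⊗ var 1 ⊖ var 0 ⊗ var 2) ⟩
      ι k * ι m - ι k * ι n        ≈⟨ +-cong (ι-* k m) (-‿cong (ι-* k n)) ⟨
      ι (k ℕ.* m) - ι (k ℕ.* n)    ∎)
      where open ≈-R

    ∑-int : ∀ {f : ℕ → ℝ} n → (∀ i → IsInt (f i)) → IsInt (∑ f n)
    ∑-int zero    _ = int-ι 0
    ∑-int (suc n) h = int-+ (∑-int n h) (h n)

    opaque
      int-nonNeg : IsInt u → 0# ≤ u → ∃ λ n → u ≈ ι n
      int-nonNeg {u} (m , n , eq) 0≤u = m ℕ.∸ n , (begin
        u                              ≈⟨ eq ⟩
        ι m - ι n                      ≈⟨ +-congʳ (reflexive (≡.cong ι (ℕₚ.m∸n+n≡m n≤m))) ⟨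
        ι (m ℕ.∸ n ℕ.+ n) - ι n        ≈⟨ +-congʳ (ι-+ (m ℕ.∸ n) n) ⟩
        ι (m ℕ.∸ n) + ι n - ι n        ≈⟨ solve (ι (m ℕ.∸ n) ∷ ι n ∷ []) (var 0 ⊕ var 1 ⊖ var 1) (var 0) ⟩
        ι (m ℕ.∸ n)                    ∎)
        where
        open ≈-R
        n≤m : n ℕ.≤ m
        n≤m = ι-cancel-≤ (≤-by (≤-trans 0≤u (≤-reflexive eq)) (solve (ι m ∷ ι n ∷ []) (var 0 ⊖ var 1)
            (var 0 ⊖ var 1 ⊖ 𝟎)))

    int-discrete : IsInt u → IsInt w → u < w → u + 1# ≤ w
    int-discrete {u} {w} p q u<w with int-nonNeg (int-- q p) (≤⇒0≤ (<⇒≤ u<w))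
    ... | zero  , eq = contradiction (≈-by (sym eq) (solve (u ∷ w ∷ []) (var 1 ⊖ var 0)
        (var 1 ⊖ var 0 ⊖ 𝟎))) (proj₂ u<w)
    ... | suc n , eq =
      ≤-by (≤-trans (1≤ι {suc n} (ℕ.s≤s ℕ.z≤n)) (≤-reflexive (sym eq))) (solve (u ∷ w ∷ [])
          (var 1 ⊖ (var 0 ⊕ 𝟏)) (var 1 ⊖ var 0 ⊖ 𝟏))

    ιℤ-int : ∀ k → IsInt (ιℤ k)
    ιℤ-int (+ n)    = int-ι n
    ιℤ-int -[1+ n ] = int-neg (int-ι (suc n))

    opaque
      int-ιℤ : IsInt u → ∃ λ k → u ≈ ιℤ k
      int-ιℤ {u} p with ≤-or-> 0# u
      ... | inj₁ 0≤u with (n , eq) ← int-nonNeg p 0≤u = + n , eq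
      ... | inj₂ u<0 with int-nonNeg (int-neg p) (≤-by (<⇒≤ u<0) (solve (u ∷ []) (⊝ var 0 ⊖ 𝟎)
          (𝟎 ⊖ var 0)))
      ...   | zero  , eq = contradiction (≈-by {b = 0#} {u} (sym eq) (solve (u ∷ []) (𝟎 ⊖ var 0)
          (⊝ var 0 ⊖ 𝟎))) (proj₂ u<0)
      ...   | suc n , eq = -[1+ n ] , trans (solve (u ∷ []) (var 0) (⊝ (⊝ var 0))) (-‿cong eq)

    private
      ℕ-floor : ∀ N {y} → 0# ≤ y → y < ι N → ∃ λ k → ι k ≤ y × y < ι k + 1#
      ℕ-floor zero    0≤y y<N = contradiction 0≤y (<⇒≱ y<N)
      ℕ-floor (suc N) {y} 0≤y y<N with ≤-or-> (ι N) y
      ... | inj₁ N≤y = N , N≤y , <-≤-trans y<N (≤-reflexive (+-comm 1# (ι N)))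
      ... | inj₂ y<N′ = ℕ-floor N 0≤y y<N′

      IsFloor : ℝ → ℝ → Set
      IsFloor x m = (∃ λ k → m ≈ ιℤ k) × m ≤ x × x < m + 1#

      opaque
        floor-exists : ∀ x → ∃ (IsFloor x)
        floor-exists x = ι k - ι n , int-ιℤ (k , n , refl) ,
          ≤-by k≤ (solve (x ∷ ι k ∷ ι n ∷ []) (var 0 ⊖ (var 1 ⊖ var 2)) (var 0 ⊕ var 2 ⊖ var 1)) , <-by <k+1 (
              solve (x ∷ ι k ∷ ι n ∷ []) (var 1 ⊖ var 2 ⊕ 𝟏 ⊖ var 0) (var 1 ⊕ 𝟏 ⊖ (var 0 ⊕ var 2)))
          where
          n N k : ℕ
          n = proj₁ (archimedean (- x))
          N = proj₁ (archimedean (x + ι n))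
          found : ∃ λ k → ι k ≤ x + ι n × x + ι n < ι k + 1#
          found = ℕ-floor (suc N)
            (≤-by (proj₂ (archimedean (- x))) (solve (x ∷ ι n ∷ []) (var 0 ⊕ var 1 ⊖ 𝟎)
                (var 1 ⊖ ⊝ var 0)))
            (≤-<-trans (proj₂ (archimedean (x + ι n))) (ι-mono-< {N} ℕₚ.≤-refl))
          k = proj₁ found
          k≤ : ι k ≤ x + ι n
          k≤ = proj₁ (proj₂ found)
          <k+1 : x + ι n < ι k + 1#
          <k+1 = proj₂ (proj₂ found)

      opaque
        ⌊⌋-spec : ∀ x → IsFloor x ⌊ x ⌋
        ⌊⌋-spec x = the-spec (IsFloor x) (floor-exists x)

    ⌊⌋-int : ∀ x → IsInt ⌊ x ⌋
    ⌊⌋-int x with ((k , eq) , _) ← ⌊⌋-spec x = int-resp (sym eq) (ιℤ-int k)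

    ⌊⌋-≤ : ∀ x → ⌊ x ⌋ ≤ x
    ⌊⌋-≤ x = proj₁ (proj₂ (⌊⌋-spec x))

    <⌊⌋+1 : ∀ x → x < ⌊ x ⌋ + 1#
    <⌊⌋+1 x = proj₂ (proj₂ (⌊⌋-spec x))

    ≤⌊⌋ : IsInt u → u ≤ x → u ≤ ⌊ x ⌋
    ≤⌊⌋ {u} {x} p u≤x with ≤-or-> u ⌊ x ⌋
    ... | inj₁ q = q
    ... | inj₂ q = contradiction (≤-trans (int-discrete (⌊⌋-int x) p q) u≤x) (<⇒≱ (<⌊⌋+1 x))

    ⌊⌋-unique : IsInt u → u ≤ x → x < u + 1# → ⌊ x ⌋ ≈ u
    ⌊⌋-unique {u} {x} p u≤x x<u+1 = antisym ⌊x⌋≤u (≤⌊⌋ p u≤x)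
      where
      ⌊x⌋≤u : ⌊ x ⌋ ≤ u
      ⌊x⌋≤u with ≤-or-> ⌊ x ⌋ u
      ... | inj₁ q = q
      ... | inj₂ q = contradiction (≤-trans (int-discrete p (⌊⌋-int x) q) (⌊⌋-≤ x)) (<⇒≱ x<u+1)

    ⌊⌋-mono : x ≤ y → ⌊ x ⌋ ≤ ⌊ y ⌋
    ⌊⌋-mono {x} x≤y = ≤⌊⌋ (⌊⌋-int x) (≤-trans (⌊⌋-≤ x) x≤y)

    ⌊⌋-cong : x ≈ y → ⌊ x ⌋ ≈ ⌊ y ⌋
    ⌊⌋-cong eq = antisym (⌊⌋-mono (≤-reflexive eq)) (⌊⌋-mono (≤-reflexive (sym eq)))

    ⌊⌋-+int : ∀ x → IsInt u → ⌊ x + u ⌋ ≈ ⌊ x ⌋ + u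
    ⌊⌋-+int {u} x p = ⌊⌋-unique (int-+ (⌊⌋-int x) p) (⌊⌋-≤ x +≤ ≤-refl)
      (<-by (<⌊⌋+1 x) (solve (x ∷ u ∷ ⌊ x ⌋ ∷ []) (var 2 ⊕ var 1 ⊕ 𝟏 ⊖ (var 0 ⊕ var 1))
          (var 2 ⊕ 𝟏 ⊖ var 0)))

  open SumsAndFloors public

  -- Discrepancy of rotations through floor sums, and rotations close to a rational one.

  module BalancedSums where
    private variable
      γ γ′ θ E F u s : ℝ
      m n : ℕ

    floorSum : ℝ → ℝ → ℕ → ℝ
    floorSum θ γ n = ∑ (λ j → ⌊ ι j * θ + γ ⌋) n

    floorSum-cong : ∀ n → γ ≈ γ′ → floorSum θ γ n ≈ floorSum θ γ′ n
    floorSum-cong n eq = ∑-cong n λ _ _ → ⌊⌋-cong (+-congˡ eq)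

    floorSum-+int : ∀ θ γ n → IsInt u → floorSum θ (γ + u) n ≈ floorSum θ γ n + ι n * u
    floorSum-+int {u} θ γ n p = begin
      ∑ (λ j → ⌊ ι j * θ + (γ + u) ⌋) n
        ≈⟨ ∑-cong n (λ j _ → trans (⌊⌋-cong (sym (+-assoc _ _ _))) (⌊⌋-+int (ι j * θ + γ) p)) ⟩
      ∑ (λ j → ⌊ ι j * θ + γ ⌋ + u) n       ≈⟨ ∑-+ _ _ n ⟩
      floorSum θ γ n + ∑ (λ _ → u) n        ≈⟨ +-congˡ (∑-const u n) ⟩
      floorSum θ γ n + ι n * u              ∎
      where open ≈-R

    floorSum-split : ∀ θ γ m n →
      floorSum θ γ (m ℕ.+ n) ≈ floorSum θ γ m + floorSum θ (ι m * θ + γ) n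
    floorSum-split θ γ m n = trans (∑-split _ m n) (+-congˡ (∑-cong n λ j _ → ⌊⌋-cong (begin
      ι (m ℕ.+ j) * θ + γ        ≈⟨ +-congʳ (*-congʳ (ι-+ m j)) ⟩
      (ι m + ι j) * θ + γ        ≈⟨ solve (ι m ∷ ι j ∷ θ ∷ γ ∷ []) ((var 0 ⊕ var 1) ⊗ var 2 ⊕ var 3)
          (var 1 ⊗ var 2 ⊕ (var 0 ⊗ var 2 ⊕ var 3)) ⟩
      ι j * θ + (ι m * θ + γ)    ∎)))
      where open ≈-R

    -- Balanced θ n E bounds the discrepancy of n consecutive terms of every
    -- translate of (jθ): the points x with {x} ∈ [a , b) are counted by
    -- ⌊x - a⌋ - ⌊x - b⌋.  The reverse inequality is the instance with γ and γ′
    -- exchanged.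

    record Balanced (θ : ℝ) (n : ℕ) (E : ℝ) : Set where
      field
        bound : ∀ γ γ′ → floorSum θ γ n - floorSum θ γ′ n ≤ ι n * (γ - γ′) + E

    open Balanced public

    balanced-0 : 0# ≤ E → Balanced θ 0 E
    balanced-0 {E} 0≤E .bound γ γ′ = ≤-by 0≤E (solve (γ ∷ γ′ ∷ E ∷ [])
        (con 0 ⊗ (var 0 ⊖ var 1) ⊕ var 2 ⊖ (𝟎 ⊖ 𝟎)) (var 2 ⊖ 𝟎))

    balanced-mono : E ≤ F → Balanced θ n E → Balanced θ n F
    balanced-mono E≤F b .bound γ γ′ = ≤-trans (b .bound γ γ′) (≤-refl +≤ E≤F)

    balanced-+ : Balanced θ m E → Balanced θ n F → Balanced θ (m ℕ.+ n) (E + F)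
    balanced-+ {θ} {m} {E} {n} {F} b b′ .bound γ γ′ =
      ≤-trans (≤-reflexive (+-cong (floorSum-split θ γ m n) (-‿cong (floorSum-split θ γ′ m n))))
      (≤-trans (≤-by (b .bound γ γ′ +≤ b′ .bound (ι m * θ + γ) (ι m * θ + γ′))
        (solve (floorSum θ γ m ∷ floorSum θ γ′ m ∷ floorSum θ (ι m * θ + γ) n ∷ floorSum θ (ι m * θ + γ′) n ∷ ι m ∷ ι n ∷ θ ∷ γ ∷ γ′ ∷ E ∷ F ∷ [])
            ((var 4 ⊕ var 5) ⊗ (var 7 ⊖ var 8) ⊕ (var 9 ⊕ var 10) ⊖ (var 0 ⊕ var 2 ⊖ (var 1 ⊕ var 3)))
            (var 4 ⊗ (var 7 ⊖ var 8) ⊕ var 9 ⊕ (var 5 ⊗ (var 4 ⊗ var 6 ⊕ var 7 ⊖ (var 4 ⊗ var 6 ⊕ var 8)) ⊕ var 10) ⊖ (var 0 ⊖ var 1 ⊕ (var 2 ⊖ var 3)))))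
      (≤-reflexive (+-congʳ (*-congʳ (sym (ι-+ m n))))))

    balanced-* : ∀ k → Balanced θ n E → Balanced θ (k ℕ.* n) (ι k * E)
    balanced-* {E = E} zero b = balanced-mono (≤-reflexive (solve (E ∷ []) 𝟎 (con 0 ⊗ var 0))) (balanced-0 ≤-refl)
    balanced-* {E = E} (suc k) b =
      balanced-mono (≤-reflexive (solve (E ∷ ι k ∷ []) (var 0 ⊕ var 1 ⊗ var 0) ((𝟏 ⊕ var 1) ⊗ var 0))) (balanced-+ b (balanced-* k b))

    -- Replacing `θ` by `θ + z` adds the same integer, the sum of all `j z`, to both floor sums, and
    -- it cancels in their difference.
    balanced-shift : ∀ z → Balanced (θ + ι z) n E → Balanced θ n E
    balanced-shift {θ} {n} {E} z b .bound γ γ′ = ≤-trans (≤-reflexive (begin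
      floorSum θ γ n - floorSum θ γ′ n
        ≈⟨ solve (floorSum θ γ n ∷ floorSum θ γ′ n ∷ ∑ (λ j → ι j * ι z) n ∷ []) (var 0 ⊖ var 1)
            (var 0 ⊕ var 2 ⊖ (var 1 ⊕ var 2)) ⟩
      (floorSum θ γ n + ∑ (λ j → ι j * ι z) n) - (floorSum θ γ′ n + ∑ (λ j → ι j * ι z) n)
        ≈⟨ +-cong (shifted γ) (-‿cong (shifted γ′)) ⟨
      floorSum (θ + ι z) γ n - floorSum (θ + ι z) γ′ n ∎)) (b .bound γ γ′)
      where
      open ≈-R
      shifted : ∀ γ → floorSum (θ + ι z) γ n ≈ floorSum θ γ n + ∑ (λ j → ι j * ι z) n
      shifted γ = trans (∑-cong n λ j _ → trans
        (⌊⌋-cong (solve (ι j ∷ θ ∷ ι z ∷ γ ∷ []) (var 0 ⊗ (var 1 ⊕ var 2) ⊕ var 3)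
            (var 0 ⊗ var 1 ⊕ var 3 ⊕ var 0 ⊗ var 2)))
        (⌊⌋-+int (ι j * θ + γ) (int-ι* j (int-ι z)))) (∑-+ _ _ n)

    module Rational (p q : ℕ) (1≤q : 1 ℕ.≤ q) where
      private
        0<q : 0# < ι q
        0<q = ι-pos 1≤q
        i : ℝ
        i = ι q ⁻¹
        qi≈1 : ι q * i ≈ 1#
        qi≈1 = ⁻¹-inverse 0<q
        ψ : ℝ
        ψ = ι p / ι q
        G : ℝ → ℝ
        G γ = floorSum ψ γ q
        open ≈-R

      -- Split the sum over `k + q` terms once after `k` and once after `q`. As `q ψ = p` is an
      -- integer, the last `k` terms of the second splitting repeat the first `k` terms, each raised
      -- by `p`.
      window : ∀ k γ → floorSum ψ (ι k * ψ + γ) q ≈ G γ + ι k * ι p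
      window k γ = ≈-by (begin
        floorSum ψ γ k + floorSum ψ (ι k * ψ + γ) q   ≈⟨ floorSum-split ψ γ k q ⟨
        floorSum ψ γ (k ℕ.+ q)                        ≈⟨ reflexive (≡.cong (floorSum ψ γ) (ℕₚ.+-comm k q)) ⟩
        floorSum ψ γ (q ℕ.+ k)                        ≈⟨ floorSum-split ψ γ q k ⟩
        G γ + floorSum ψ (ι q * ψ + γ) k              ≈⟨ +-congˡ (floorSum-cong k
                                                          (trans (+-comm _ _) (+-congˡ (/-cancel 0<q)))) ⟩
        G γ + floorSum ψ (γ + ι p) k                  ≈⟨ +-congˡ (floorSum-+int ψ γ k (int-ι p)) ⟩
        G γ + (floorSum ψ γ k + ι k * ι p)            ∎)
        (solve (floorSum ψ γ k ∷ floorSum ψ (ι k * ψ + γ) q ∷ G γ ∷ ι k ∷ ι p ∷ [])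
            (var 2 ⊕ var 3 ⊗ var 4 ⊖ var 1) (var 2 ⊕ (var 0 ⊕ var 3 ⊗ var 4) ⊖ (var 0 ⊕ var 1)))

      -- The hypothesis says `k ψ = u + s/q`. Up to the integer `u`, translating `γ` by `s/q` is
      -- therefore a shift of the summation window by `k`, whose effect `window` computes.
      shift-by : ∀ k → IsInt u → ι k * ι p ≈ ι q * u + s → ∀ γ → G (γ + s * i) ≈ G γ + s
      shift-by {u} {s} k int eq γ = ≈-by (begin
        G (γ + s * i) + ι q * u             ≈⟨ floorSum-+int ψ (γ + s * i) q int ⟨
        G (γ + s * i + u)                   ≈⟨ floorSum-cong q argument ⟩
        floorSum ψ (ι k * ψ + γ) q          ≈⟨ window k γ ⟩
        G γ + ι k * ι p                     ≈⟨ +-congˡ eq ⟩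
        G γ + (ι q * u + s)                 ∎)
        (solve (G (γ + s * i) ∷ ι q ∷ u ∷ G γ ∷ s ∷ []) (var 3 ⊕ var 4 ⊖ var 0)
            (var 3 ⊕ (var 1 ⊗ var 2 ⊕ var 4) ⊖ (var 0 ⊕ var 1 ⊗ var 2)))
        where
        argument : γ + s * i + u ≈ ι k * ψ + γ
        argument = begin
          γ + s * i + u                    ≈⟨ +-congˡ (trans (sym (*-identityˡ u)) (*-congʳ (sym qi≈1))) ⟩
          γ + s * i + ι q * i * u          ≈⟨ solve (γ ∷ s ∷ i ∷ ι q ∷ u ∷ [])
              (var 0 ⊕ var 1 ⊗ var 2 ⊕ var 3 ⊗ var 2 ⊗ var 4) ((var 3 ⊗ var 4 ⊕ var 1) ⊗ var 2 ⊕ var 0) ⟩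
          (ι q * u + s) * i + γ            ≈⟨ +-congʳ (*-congʳ eq) ⟨
          ι k * ι p * i + γ                ≈⟨ solve (ι k ∷ ι p ∷ i ∷ γ ∷ [])
              (var 0 ⊗ var 1 ⊗ var 2 ⊕ var 3) (var 0 ⊗ (var 1 ⊗ var 2) ⊕ var 3) ⟩
          ι k * ψ + γ                      ∎

      -- If k p = 1 + y q then translating γ by n/q amounts to shifting the
      -- summation window by n k.
      shift-ℕ : Coprime p q → ∀ n γ → G (γ + ι n * i) ≈ G γ + ι n
      shift-ℕ c n γ with coprime-Bézout c
      ... | Bézout.+- x y eq = shift-by (n ℕ.* x) (int-ι (n ℕ.* y)) (begin
        ι (n ℕ.* x) * ι p               ≈⟨ *-congʳ (ι-* n x) ⟩
        ι n * ι x * ι p                 ≈⟨ trans (*-assoc _ _ _) (*-congˡ (sym (ι-* x p))) ⟩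
        ι n * ι (x ℕ.* p)               ≈⟨ *-congˡ (reflexive (≡.cong ι eq)) ⟨
        ι n * (1# + ι (y ℕ.* q))        ≈⟨ *-congˡ (+-congˡ (ι-* y q)) ⟩
        ι n * (1# + ι y * ι q)          ≈⟨ solve (ι n ∷ ι y ∷ ι q ∷ []) (var 0 ⊗ (𝟏 ⊕ var 1 ⊗ var 2))
            (var 2 ⊗ (var 0 ⊗ var 1) ⊕ var 0) ⟩
        ι q * (ι n * ι y) + ι n         ≈⟨ +-congʳ (*-congˡ (ι-* n y)) ⟨
        ι q * ι (n ℕ.* y) + ι n         ∎) γ
      ... | Bézout.-+ x y eq = ≈-by (sym (begin
        G γ                             ≈⟨ floorSum-cong q (solve (γ ∷ ι n ∷ i ∷ []) (var 0)
            (var 0 ⊕ var 1 ⊗ var 2 ⊕ ⊝ var 1 ⊗ var 2)) ⟩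
        G (γ + ι n * i + - ι n * i)     ≈⟨ shift-by (n ℕ.* x) (int-ι (n ℕ.* y)) negative (γ + ι n * i) ⟩
        G (γ + ι n * i) + - ι n         ∎)) (solve (G γ ∷ G (γ + ι n * i) ∷ ι n ∷ [])
            (var 0 ⊕ var 2 ⊖ var 1) (var 0 ⊖ (var 1 ⊖ var 2)))
        where
        negative : ι (n ℕ.* x) * ι p ≈ ι q * ι (n ℕ.* y) + - ι n
        negative = begin
          ι (n ℕ.* x) * ι p                   ≈⟨ *-congʳ (ι-* n x) ⟩
          ι n * ι x * ι p                     ≈⟨ trans (*-assoc _ _ _) (*-congˡ (sym (ι-* x p))) ⟩
          ι n * ι (x ℕ.* p)                   ≈⟨ solve (ι n ∷ ι (x ℕ.* p) ∷ []) (var 0 ⊗ var 1)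
              (var 0 ⊗ (𝟏 ⊕ var 1) ⊖ var 0) ⟩
          ι n * (1# + ι (x ℕ.* p)) - ι n      ≈⟨ +-congʳ (*-congˡ (reflexive (≡.cong ι eq))) ⟩
          ι n * ι (y ℕ.* q) - ι n             ≈⟨ +-congʳ (*-congˡ (ι-* y q)) ⟩
          ι n * (ι y * ι q) - ι n             ≈⟨ solve (ι n ∷ ι y ∷ ι q ∷ [])
              (var 0 ⊗ (var 1 ⊗ var 2) ⊖ var 0) (var 2 ⊗ (var 0 ⊗ var 1) ⊖ var 0) ⟩
          ι q * (ι n * ι y) + - ι n           ≈⟨ +-congʳ (*-congˡ (ι-* n y)) ⟨
          ι q * ι (n ℕ.* y) + - ι n           ∎

      shift-int : Coprime p q → IsInt u → ∀ γ → G (γ + u * i) ≈ G γ + u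
      shift-int {u} c (m , n , eq) γ = ≈-by (begin
        G (γ + u * i) + ι n             ≈⟨ shift-ℕ c n (γ + u * i) ⟨
        G (γ + u * i + ι n * i)         ≈⟨ floorSum-cong q (+-congʳ (+-congˡ (*-congʳ eq))) ⟩
        G (γ + (ι m - ι n) * i + ι n * i) ≈⟨ floorSum-cong q (solve (γ ∷ ι m ∷ ι n ∷ i ∷ [])
            (var 0 ⊕ (var 1 ⊖ var 2) ⊗ var 3 ⊕ var 2 ⊗ var 3) (var 0 ⊕ var 1 ⊗ var 3)) ⟩
        G (γ + ι m * i)                 ≈⟨ shift-ℕ c m γ ⟩
        G γ + ι m                       ≈⟨ solve (G γ ∷ ι m ∷ ι n ∷ []) (var 0 ⊕ var 1)
            (var 0 ⊕ (var 1 ⊖ var 2) ⊕ var 2) ⟩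
        G γ + (ι m - ι n) + ι n         ≈⟨ +-congʳ (+-congˡ eq) ⟨
        G γ + u + ι n                   ∎) (solve (G (γ + u * i) ∷ ι n ∷ G γ ∷ u ∷ [])
            (var 2 ⊕ var 3 ⊖ var 0) (var 2 ⊕ var 3 ⊕ var 1 ⊖ (var 0 ⊕ var 1)))

      G-mono : γ ≤ γ′ → G γ ≤ G γ′
      G-mono γ≤γ′ = ∑-mono q λ _ _ → ⌊⌋-mono (≤-refl +≤ γ≤γ′)

      -- With `t = q (γ - γ′)`, the point `γ` is at most `γ′ + (⌊t⌋ + 1)/q`. Monotonicity of `G` and
      -- its exact behaviour under translation by multiples of 1/q bound the difference by
      -- `⌊t⌋ + 1`, hence by `t + 1`.
      G-balanced : Coprime p q → Balanced ψ q 1#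
      G-balanced c .bound γ γ′ = ≤-by (G-le +≤ ⌊⌋-≤ t) (
          solve (G γ ∷ G γ′ ∷ ⌊ t ⌋ ∷ ι q ∷ γ ∷ γ′ ∷ []) (var 3 ⊗ (var 4 ⊖ var 5) ⊕ 𝟏 ⊖ (var 0 ⊖ var 1))
          (var 1 ⊕ (var 2 ⊕ 𝟏) ⊕ var 3 ⊗ (var 4 ⊖ var 5) ⊖ (var 0 ⊕ var 2)))
        where
        t : ℝ
        t = ι q * (γ - γ′)
        γ≤ : γ ≤ γ′ + (⌊ t ⌋ + 1#) * i
        γ≤ = *-cancel-≤ 0<q (≤-trans (≤-by (<⇒≤ (<⌊⌋+1 t)) (solve (γ ∷ γ′ ∷ ι q ∷ ⌊ t ⌋ ∷ [])
            (var 2 ⊗ var 1 ⊕ 𝟏 ⊗ (var 3 ⊕ 𝟏) ⊖ var 2 ⊗ var 0) (var 3 ⊕ 𝟏 ⊖ var 2 ⊗ (var 0 ⊖ var 1))))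
          (≤-reflexive (begin
            ι q * γ′ + 1# * (⌊ t ⌋ + 1#)         ≈⟨ +-congˡ (*-congʳ qi≈1) ⟨
            ι q * γ′ + ι q * i * (⌊ t ⌋ + 1#)    ≈⟨ solve (ι q ∷ γ′ ∷ i ∷ ⌊ t ⌋ ∷ [])
                (var 0 ⊗ var 1 ⊕ var 0 ⊗ var 2 ⊗ (var 3 ⊕ 𝟏)) (var 0 ⊗ (var 1 ⊕ (var 3 ⊕ 𝟏) ⊗ var 2)) ⟩
            ι q * (γ′ + (⌊ t ⌋ + 1#) * i)        ∎)))
        G-le : G γ ≤ G γ′ + (⌊ t ⌋ + 1#)
        G-le = ≤-trans (G-mono γ≤) (≤-reflexive (shift-int c (int-+ (⌊⌋-int t) int-1) γ′))

      -- For `j < q` the points `j θ` and `j ψ` differ by at most 1/q, so the floor sum of `θ` lies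
      -- between the values of `G` at `γ - 1/q` and `γ + 1/q`, that is, within 1 of `G γ`. The 3 is
      -- one for each of `γ` and `γ′` plus one from `G-balanced`.
      balanced-near : Coprime p q →
        - 1# ≤ ι q * (ι q * θ - ι p) → ι q * (ι q * θ - ι p) ≤ 1# → Balanced θ q (ι 3)
      balanced-near {θ} c lo hi .bound γ γ′ =
        ≤-by (upper +≤ lower +≤ G-balanced c .bound γ γ′)
          (solve (floorSum θ γ q ∷ floorSum θ γ′ q ∷ G γ ∷ G γ′ ∷ ι q ∷ γ ∷ γ′ ∷ [])
              (var 4 ⊗ (var 5 ⊖ var 6) ⊕ con 3 ⊖ (var 0 ⊖ var 1))
              (var 2 ⊕ 𝟏 ⊕ var 1 ⊕ (var 4 ⊗ (var 5 ⊖ var 6) ⊕ 𝟏) ⊖ (var 0 ⊕ (var 3 ⊖ 𝟏) ⊕ (var 2 ⊖ var 3))))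
        where
        δ : ℝ
        δ = ι q * θ - ι p
        qψ≈p : ι q * ψ ≈ ι p
        qψ≈p = /-cancel 0<q
        near : ∀ j → j ℕ.< q → ∀ {ε} → ι q * ε ≤ 1# → ι j * ε ≤ 1#
        near j j<q {ε} qε≤1 with ≤-or-> 0# ε
        ... | inj₁ 0≤ε = ≤-trans (≤-by (0≤ε *≤ ι-mono-≤ (ℕₚ.<⇒≤ j<q)) (solve (ε ∷ ι j ∷ ι q ∷ [])
            (var 2 ⊗ var 0 ⊖ var 1 ⊗ var 0) (var 0 ⊗ var 2 ⊖ var 0 ⊗ var 1))) qε≤1
        ... | inj₂ ε<0 = ≤-trans (≤-by (ι-nonNeg j *≤ <⇒≤ ε<0) (solve (ι j ∷ ε ∷ []) (𝟎 ⊖ var 0 ⊗ var 1)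
            (var 0 ⊗ 𝟎 ⊖ var 0 ⊗ var 1))) 0≤1
        upper : floorSum θ γ q ≤ G γ + 1#
        upper = ≤-trans (∑-mono q λ j j<q → ⌊⌋-mono (*-cancel-≤ 0<q (
          ≤-by (near j j<q hi +≤ ≤-reflexive (*-congˡ {ι j} (sym qψ≈p)) +≤ ≤-reflexive (sym qi≈1))
            (solve (ι j ∷ ι q ∷ θ ∷ ι p ∷ ψ ∷ i ∷ γ ∷ [])
                (var 1 ⊗ (var 0 ⊗ var 4 ⊕ (var 6 ⊕ var 5)) ⊖ var 1 ⊗ (var 0 ⊗ var 2 ⊕ var 6))
                (𝟏 ⊕ var 0 ⊗ (var 1 ⊗ var 4) ⊕ var 1 ⊗ var 5 ⊖ (var 0 ⊗ (var 1 ⊗ var 2 ⊖ var 3) ⊕ var 0 ⊗ var 3 ⊕ 𝟏))))))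
          (≤-reflexive (trans (floorSum-cong {γ = γ + i} q (solve (γ ∷ i ∷ []) (var 0 ⊕ var 1)
              (var 0 ⊕ 𝟏 ⊗ var 1))) (shift-int c int-1 γ)))
        lower : G γ′ - 1# ≤ floorSum θ γ′ q
        lower = ≤-trans
          (≤-reflexive (sym (trans (floorSum-cong {γ = γ′ - i} q (solve (γ′ ∷ i ∷ []) (var 0 ⊖ var 1)
              (var 0 ⊕ ⊝ 𝟏 ⊗ var 1))) (shift-int c (int-neg int-1) γ′))))
          (∑-mono q λ j j<q → ⌊⌋-mono (*-cancel-≤ 0<q (
          ≤-by (near j j<q {ε = - δ} (≤-by lo (solve (ι q ∷ θ ∷ ι p ∷ [])
              (𝟏 ⊖ var 0 ⊗ (⊝ (var 0 ⊗ var 1 ⊖ var 2))) (var 0 ⊗ (var 0 ⊗ var 1 ⊖ var 2) ⊖ ⊝ 𝟏))) +≤ ≤-reflexive (*-congˡ {ι j} qψ≈p) +≤ ≤-reflexive (sym qi≈1))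
            (solve (ι j ∷ ι q ∷ θ ∷ ι p ∷ ψ ∷ i ∷ γ′ ∷ [])
                (var 1 ⊗ (var 0 ⊗ var 2 ⊕ var 6) ⊖ var 1 ⊗ (var 0 ⊗ var 4 ⊕ (var 6 ⊖ var 5)))
                (𝟏 ⊕ var 0 ⊗ var 3 ⊕ var 1 ⊗ var 5 ⊖ (var 0 ⊗ (⊝ (var 1 ⊗ var 2 ⊖ var 3)) ⊕ var 0 ⊗ (var 1 ⊗ var 4) ⊕ 𝟏))))))

  open BalancedSums public

  -- Dirichlet's theorem and the decomposition of badly approximable rotations into runs.

  module DirichletApproximation where
    private variable
      c e t θ : ℝ
      n : ℕ

    scale-down : 0# ≤ c → c ≤ e → - 1# < e * t → e * t < 1# → - 1# < c * t × c * t < 1#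
    scale-down {c} {e} {t} 0≤c c≤e lo hi with ≤-or-> 0# t
    ... | inj₁ 0≤t = <-by (0<1 +<≤ *-nonNeg 0≤c 0≤t) (solve (c ∷ t ∷ []) (var 0 ⊗ var 1 ⊖ ⊝ 𝟏)
        (𝟏 ⊕ var 0 ⊗ var 1 ⊖ (𝟎 ⊕ 𝟎))) ,
      ≤-<-trans (≤-by (*-nonNeg (≤⇒0≤ c≤e) 0≤t) (solve (c ∷ e ∷ t ∷ []) (var 1 ⊗ var 2 ⊖ var 0 ⊗ var 2)
          ((var 1 ⊖ var 0) ⊗ var 2 ⊖ 𝟎))) hi
    ... | inj₂ t<0 = <-≤-trans lo (≤-by (*-nonNeg (≤⇒0≤ c≤e) (≤⇒0≤ (<⇒≤ t<0))) (
        solve (c ∷ e ∷ t ∷ []) (var 0 ⊗ var 2 ⊖ var 1 ⊗ var 2) ((var 1 ⊖ var 0) ⊗ (𝟎 ⊖ var 2) ⊖ 𝟎))) ,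
      <-by (0<1 +<≤ *-nonNeg 0≤c (≤⇒0≤ (<⇒≤ t<0))) (solve (c ∷ t ∷ []) (𝟏 ⊖ var 0 ⊗ var 1)
          (𝟏 ⊕ var 0 ⊗ (𝟎 ⊖ var 1) ⊖ (𝟎 ⊕ 𝟎)))

    frac-nonNeg : ∀ x → 0# ≤ frac x
    frac-nonNeg x = ≤⇒0≤ (⌊⌋-≤ x)

    frac<1 : ∀ x → frac x < 1#
    frac<1 x = <-by (<⌊⌋+1 x) (solve (x ∷ ⌊ x ⌋ ∷ []) (𝟏 ⊖ (var 0 ⊖ var 1)) (var 1 ⊕ 𝟏 ⊖ var 0))

    record Approximation (θ : ℝ) (n : ℕ) : Set where
      field
        p q   : ℕ
        1≤q   : 1 ℕ.≤ q
        q≤n   : q ℕ.≤ n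
        lower : - 1# < ι n * (ι q * θ - ι p)
        upper : ι n * (ι q * θ - ι p) < 1#

    opaque
      -- Cancelling the gcd divides the approximation error by a number at least 1. Lowest terms are
      -- required by `Rational.balanced-near`, and the pigeonhole argument does not supply them.
      reduce : Approximation θ n → Σ (Approximation θ n) λ A → Coprime (Approximation.p A) (Approximation.q A)
      reduce {θ} {n} A = record
        { p = p ℕ./ g ; q = q ℕ./ g
        ; 1≤q = ℕₚ.n≢0⇒n>0 λ q/g≡0 → ℕₚ.m<n⇒n≢0 1≤q (≡.trans (≡.sym q/g*g) (≡.cong (ℕ._* g) q/g≡0))
        ; q≤n = ℕₚ.≤-trans (m/n≤m q g) q≤n
        ; lower = <-by (proj₁ smaller) (solve (ι n ∷ ι (p ℕ./ g) ∷ ι (q ℕ./ g) ∷ θ ∷ [])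
            (var 0 ⊗ (var 2 ⊗ var 3 ⊖ var 1) ⊖ ⊝ 𝟏) (𝟏 ⊗ (var 0 ⊗ (var 2 ⊗ var 3 ⊖ var 1)) ⊖ ⊝ 𝟏))
        ; upper = <-by (proj₂ smaller) (solve (ι n ∷ ι (p ℕ./ g) ∷ ι (q ℕ./ g) ∷ θ ∷ [])
            (𝟏 ⊖ var 0 ⊗ (var 2 ⊗ var 3 ⊖ var 1)) (𝟏 ⊖ 𝟏 ⊗ (var 0 ⊗ (var 2 ⊗ var 3 ⊖ var 1))))
        } , coprime-/gcd p q
        where
        open Approximation A
        g : ℕ
        g = gcd p q
        instance
          g≢0 : ℕ.NonZero g
          g≢0 = ℕ.≢-nonZero λ g≡0 → ℕₚ.m<n⇒n≢0 1≤q (gcd[m,n]≡0⇒n≡0 p g≡0)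
        p/g*g : p ℕ./ g ℕ.* g ≡ p
        p/g*g = m/n*n≡m (gcd[m,n]∣m p q)
        q/g*g : q ℕ./ g ℕ.* g ≡ q
        q/g*g = m/n*n≡m (gcd[m,n]∣n p q)
        s : ℝ
        s = ι n * (ι (q ℕ./ g) * θ - ι (p ℕ./ g))
        gt : ι n * (ι q * θ - ι p) ≈ ι g * s
        gt = begin
          ι n * (ι q * θ - ι p)
            ≈⟨ *-congˡ (+-cong (*-congʳ (reflexive (≡.cong ι q/g*g))) (-‿cong (reflexive (≡.cong ι p/g*g)))) ⟨
          ι n * (ι (q ℕ./ g ℕ.* g) * θ - ι (p ℕ./ g ℕ.* g))
            ≈⟨ *-congˡ (+-cong (*-congʳ (ι-* (q ℕ./ g) g)) (-‿cong (ι-* (p ℕ./ g) g))) ⟩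
          ι n * (ι (q ℕ./ g) * ι g * θ - ι (p ℕ./ g) * ι g)
            ≈⟨ solve (ι n ∷ ι (q ℕ./ g) ∷ ι (p ℕ./ g) ∷ ι g ∷ θ ∷ [])
                (var 0 ⊗ (var 1 ⊗ var 3 ⊗ var 4 ⊖ var 2 ⊗ var 3))
                (var 3 ⊗ (var 0 ⊗ (var 1 ⊗ var 4 ⊖ var 2))) ⟩
          ι g * s ∎
          where open ≈-R
        smaller : - 1# < 1# * s × 1# * s < 1#
        smaller = scale-down 0≤1 (1≤ι (ℕ.>-nonZero⁻¹ g))
          (<-≤-trans lower (≤-reflexive gt)) (≤-<-trans (≤-reflexive (sym gt)) upper)

    -- Pigeonhole: the fractional parts of `j θ` for the `n + 1` indices from 0 to `n`, scaled by
    -- `n`, fall into `n` unit cells. Two in one cell differ by less than 1, and their difference is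
    -- `n (q θ - p)` with `q = j - i`. The condition `0# ≤ θ` makes the difference `p` of the floors
    -- a natural number.
    module Dirichlet (θ : ℝ) (0≤θ : 0# ≤ θ) (n : ℕ) (1≤n : 1 ℕ.≤ n) where
      private
        y : ℕ → ℝ
        y j = ι n * frac (ι j * θ)

        cell : ∀ j → ∃ λ k → k ℕ.< n × ⌊ y j ⌋ ≈ ι k
        cell j = k , ι-cancel-< (≤-<-trans (≤-reflexive (sym eq)) (≤-<-trans (⌊⌋-≤ (y j)) y<n)) , eq
          where
          found : ∃ λ k → ⌊ y j ⌋ ≈ ι k
          found = int-nonNeg (⌊⌋-int (y j))
            (≤⌊⌋ (int-ι 0) (*-nonNeg (ι-nonNeg n) (frac-nonNeg (ι j * θ))))
          k : ℕ
          k = proj₁ found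
          eq : ⌊ y j ⌋ ≈ ι k
          eq = proj₂ found
          y<n : y j < ι n
          y<n = <-≤-trans (ι-pos 1≤n *< frac<1 (ι j * θ)) (≤-reflexive (*-identityʳ (ι n)))

        collision : ∃₂ λ (i j : Fin (suc n)) → toℕ i ℕ.< toℕ j ×
          fromℕ< (proj₁ (proj₂ (cell (toℕ i)))) ≡ fromℕ< (proj₁ (proj₂ (cell (toℕ j))))
        collision = Finₚ.pigeonhole ℕₚ.≤-refl (λ i → fromℕ< (proj₁ (proj₂ (cell (toℕ i)))))

        i j q : ℕ
        i = toℕ (proj₁ collision)
        j = toℕ (proj₁ (proj₂ collision))
        q = j ℕ.∸ i
        i<j : i ℕ.< j
        i<j = proj₁ (proj₂ (proj₂ collision))

        same-cell : ⌊ y i ⌋ ≈ ⌊ y j ⌋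
        same-cell = trans (proj₂ (proj₂ (cell i))) (trans (reflexive (≡.cong ι same))
          (sym (proj₂ (proj₂ (cell j)))))
          where
          same : proj₁ (cell i) ≡ proj₁ (cell j)
          same = ≡.trans (≡.sym (Finₚ.toℕ-fromℕ< (proj₁ (proj₂ (cell i)))))
            (≡.trans (≡.cong toℕ (proj₂ (proj₂ (proj₂ collision))))
            (Finₚ.toℕ-fromℕ< (proj₁ (proj₂ (cell j)))))

        ιq : ι q ≈ ι j - ι i
        ιq = begin
          ι q                    ≈⟨ solve (ι q ∷ ι i ∷ []) (var 0) (var 0 ⊕ var 1 ⊖ var 1) ⟩
          ι q + ι i - ι i        ≈⟨ +-congʳ (ι-+ q i) ⟨
          ι (q ℕ.+ i) - ι i      ≈⟨ +-congʳ (reflexive (≡.cong ι (ℕₚ.m∸n+n≡m (ℕₚ.<⇒≤ i<j)))) ⟩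
          ι j - ι i              ∎
          where open ≈-R

        P : ∃ λ p → ⌊ ι j * θ ⌋ - ⌊ ι i * θ ⌋ ≈ ι p
        P = int-nonNeg (int-- (⌊⌋-int (ι j * θ)) (⌊⌋-int (ι i * θ)))
          (≤⇒0≤ (⌊⌋-mono (≤-by (0≤θ *≤ ι-mono-≤ (ℕₚ.<⇒≤ i<j)) (solve (ι i ∷ ι j ∷ θ ∷ [])
              (var 1 ⊗ var 2 ⊖ var 0 ⊗ var 2) (var 2 ⊗ var 1 ⊖ var 2 ⊗ var 0)))))

        difference : ι n * (ι q * θ - ι (proj₁ P)) ≈ y j - y i
        difference = begin
          ι n * (ι q * θ - ι (proj₁ P))
            ≈⟨ *-congˡ (+-cong (*-congʳ ιq) (-‿cong (sym (proj₂ P)))) ⟩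
          ι n * ((ι j - ι i) * θ - (⌊ ι j * θ ⌋ - ⌊ ι i * θ ⌋))
            ≈⟨ solve (ι n ∷ ι i ∷ ι j ∷ θ ∷ ⌊ ι j * θ ⌋ ∷ ⌊ ι i * θ ⌋ ∷ [])
                (var 0 ⊗ ((var 2 ⊖ var 1) ⊗ var 3 ⊖ (var 4 ⊖ var 5)))
                (var 0 ⊗ (var 2 ⊗ var 3 ⊖ var 4) ⊖ var 0 ⊗ (var 1 ⊗ var 3 ⊖ var 5)) ⟩
          y j - y i ∎
          where open ≈-R

      opaque
        approximation : Approximation θ n
        approximation = record
          { p = proj₁ P ; q = q
          ; 1≤q = ℕₚ.m<n⇒0<n∸m i<j
          ; q≤n = ℕₚ.≤-trans (ℕₚ.m∸n≤m j i) (ℕₚ.<⇒≤pred (Finₚ.toℕ<n (proj₁ (proj₂ collision))))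
          ; lower = <-≤-trans (<-by (<⌊⌋+1 (y i) +<≤ (≤-trans (≤-reflexive same-cell) (⌊⌋-≤ (y j))))
              (solve (y i ∷ y j ∷ ⌊ y i ⌋ ∷ []) (var 1 ⊖ var 0 ⊖ ⊝ 𝟏)
                  (var 2 ⊕ 𝟏 ⊕ var 1 ⊖ (var 0 ⊕ var 2)))) (≤-reflexive (sym difference))
          ; upper = ≤-<-trans (≤-reflexive difference)
              (<-by (<⌊⌋+1 (y j) +<≤ (≤-trans (≤-reflexive (sym same-cell)) (⌊⌋-≤ (y i))))
              (solve (y i ∷ y j ∷ ⌊ y j ⌋ ∷ []) (𝟏 ⊖ (var 1 ⊖ var 0))
                  (var 2 ⊕ 𝟏 ⊕ var 0 ⊖ (var 1 ⊕ var 2))))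
          }

    -- The bound `|q θ - u| ≥ 1/(q T)`, cleared of denominators. Stated as the negation of two
    -- strict inequalities, it fails on a union of open intervals, the shape in which null sets are
    -- covered.
    BadlyApproximable : ℕ → ℕ → ℝ → Set
    BadlyApproximable T N θ = ∀ q u → 1 ℕ.≤ q → q ℕ.≤ N → IsInt u →
      ¬ (- 1# < ι (q ℕ.* T) * (ι q * θ - u) × ι (q ℕ.* T) * (ι q * θ - u) < 1#)

    badlyApproximable-shift : ∀ {T N} z → BadlyApproximable T N θ → BadlyApproximable T N (θ + ι z)
    badlyApproximable-shift {θ} {T} z bad q u 1≤q q≤N int (lo , hi) =
      bad q (u - ι q * ι z) 1≤q q≤N (int-- int (int-ι* q (int-ι z)))
        (<-by lo (solve (ι (q ℕ.* T) ∷ ι q ∷ θ ∷ ι z ∷ u ∷ [])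
            (var 0 ⊗ (var 1 ⊗ var 2 ⊖ (var 4 ⊖ var 1 ⊗ var 3)) ⊖ ⊝ 𝟏)
            (var 0 ⊗ (var 1 ⊗ (var 2 ⊕ var 3) ⊖ var 4) ⊖ ⊝ 𝟏)) ,
         <-by hi (solve (ι (q ℕ.* T) ∷ ι q ∷ θ ∷ ι z ∷ u ∷ [])
             (𝟏 ⊖ var 0 ⊗ (var 1 ⊗ var 2 ⊖ (var 4 ⊖ var 1 ⊗ var 3)))
             (𝟏 ⊖ var 0 ⊗ (var 1 ⊗ (var 2 ⊕ var 3) ⊖ var 4))))

    private
      -- The quotient is at least 1, so `m` is at least `n` plus the remainder, and hence at least
      -- twice the remainder.
      m%n<½m : ∀ m n .{{_ : ℕ.NonZero n}} k → n ℕ.≤ m → m ℕ.< 2 ℕ.* k → m ℕ.% n ℕ.< k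
      m%n<½m m n k n≤m m<2k = ℕₚ.*-cancelˡ-< 2 (m ℕ.% n) k (ℕₚ.≤-<-trans (begin
        2 ℕ.* (m ℕ.% n)                  ≡⟨ ≡.cong (m ℕ.% n ℕ.+_) (ℕₚ.+-identityʳ (m ℕ.% n)) ⟩
        m ℕ.% n ℕ.+ m ℕ.% n              ≤⟨ ℕₚ.+-monoʳ-≤ (m ℕ.% n) (ℕₚ.<⇒≤ (m%n<n m n)) ⟩
        m ℕ.% n ℕ.+ n                    ≡⟨ ≡.cong (m ℕ.% n ℕ.+_) (ℕₚ.*-identityˡ n) ⟨
        m ℕ.% n ℕ.+ 1 ℕ.* n              ≤⟨ ℕₚ.+-monoʳ-≤ (m ℕ.% n) (ℕₚ.*-monoˡ-≤ n (m≥n⇒m/n>0 n≤m)) ⟩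
        m ℕ.% n ℕ.+ m ℕ./ n ℕ.* n        ≡⟨ m≡m%n+[m/n]*n m n ⟨
        m                                ∎) m<2k)
        where open ℕₚ.≤-Reasoning

    module _ (T N : ℕ) where

      -- The points split into `n mod q` leftover ones and `n / q` runs of `q`, each run costing 3.
      -- There are fewer than `T` runs: if `T q ≤ n`, the Dirichlet bound `|q θ - p| < 1/n` would
      -- give `|q θ - p| < 1/(q T)`, which is excluded.
      balanced-step : ∀ {E} → BadlyApproximable T N θ → n ℕ.≤ N →
        (A : Approximation θ n) → let open Approximation A in Coprime p q →
        .{{_ : ℕ.NonZero q}} → Balanced θ (n ℕ.% q) E → Balanced θ n (E + ι T * ι 3)
      balanced-step {θ} {n} {E} bad n≤N A coprime rest =
        ≡.subst (λ l → Balanced θ l (E + ι T * ι 3)) (≡.sym (m≡m%n+[m/n]*n n q))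
          (balanced-mono total (balanced-+ rest
            (balanced-* (n ℕ./ q) (Rational.balanced-near p q 1≤q coprime
              (<⇒≤ (proj₁ near)) (<⇒≤ (proj₂ near))))))
        where
        open Approximation A
        near : - 1# < ι q * (ι q * θ - ι p) × ι q * (ι q * θ - ι p) < 1#
        near = scale-down (ι-nonNeg q) (ι-mono-≤ q≤n) lower upper
        n<T*q : n ℕ.< T ℕ.* q
        n<T*q = ℕₚ.≰⇒> λ T*q≤n → bad q (ι p) 1≤q (ℕₚ.≤-trans q≤n n≤N) (int-ι p)
          (scale-down (ι-nonNeg (q ℕ.* T))
            (ι-mono-≤ (ℕₚ.≤-trans (ℕₚ.≤-reflexive (ℕₚ.*-comm q T)) T*q≤n)) lower upper)
        total : E + ι (n ℕ./ q) * ι 3 ≤ E + ι T * ι 3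
        total = ≤-by (ι-nonNeg 3 *≤ ι-mono-≤ (ℕₚ.<⇒≤ (m<n*o⇒m/o<n {n} {T} {q} n<T*q)))
          (solve (E ∷ ι T ∷ ι (n ℕ./ q) ∷ []) (var 0 ⊕ var 1 ⊗ con 3 ⊖ (var 0 ⊕ var 2 ⊗ con 3))
              (con 3 ⊗ var 1 ⊖ con 3 ⊗ var 2))

      -- Each round costs `3 T` and leaves fewer than `2^(k-1)` points, to which Dirichlet's theorem
      -- is applied again with their own number in place of `n`.
      badlyApproximable⇒balanced-nonNeg : 0# ≤ θ → BadlyApproximable T N θ →
        ∀ k n → n ℕ.< 2 ℕ.^ k → n ℕ.≤ N → Balanced θ n (ι k * (ι T * ι 3))
      badlyApproximable⇒balanced-nonNeg _ _ k zero _ _ =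
        balanced-0 (*-nonNeg (ι-nonNeg k) (*-nonNeg (ι-nonNeg T) (ι-nonNeg 3)))
      badlyApproximable⇒balanced-nonNeg _ _ zero (suc n) (ℕ.s≤s ()) _
      badlyApproximable⇒balanced-nonNeg {θ} 0≤θ bad (suc k) n@(suc _) n<2^k n≤N =
        go (reduce (Dirichlet.approximation θ 0≤θ n (ℕ.s≤s ℕ.z≤n)))
        where
        go : Σ (Approximation θ n) (λ A → Coprime (Approximation.p A) (Approximation.q A)) →
          Balanced θ n (ι (suc k) * (ι T * ι 3))
        go (A , coprime) = balanced-mono (≤-reflexive (solve (ι k ∷ ι T ∷ [])
            (var 0 ⊗ (var 1 ⊗ con 3) ⊕ var 1 ⊗ con 3) ((𝟏 ⊕ var 0) ⊗ (var 1 ⊗ con 3))))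
          (balanced-step bad n≤N A coprime {{q≢0}}
            (badlyApproximable⇒balanced-nonNeg 0≤θ bad k (ℕ._%_ n q {{q≢0}})
              (m%n<½m n q {{q≢0}} (2 ℕ.^ k) q≤n n<2^k) (ℕₚ.≤-trans (m%n≤m n q {{q≢0}}) n≤N)))
          where
          open Approximation A
          q≢0 : ℕ.NonZero q
          q≢0 = ℕ.>-nonZero 1≤q

      -- Hypothesis and conclusion are both invariant under adding an integer to `θ`, which reduces
      -- the claim to `0# ≤ θ`.
      badlyApproximable⇒balanced : BadlyApproximable T N θ →
        ∀ k n → n ℕ.< 2 ℕ.^ k → n ℕ.≤ N → Balanced θ n (ι k * (ι T * ι 3))
      badlyApproximable⇒balanced {θ} bad k n n<2^k n≤N = balanced-shift z
        (badlyApproximable⇒balanced-nonNeg 0≤θ+z (badlyApproximable-shift z bad) k n n<2^k n≤N)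
        where
        z : ℕ
        z = proj₁ (archimedean (- θ))
        0≤θ+z : 0# ≤ θ + ι z
        0≤θ+z = ≤-by (proj₂ (archimedean (- θ))) (solve (θ ∷ ι z ∷ []) (var 0 ⊕ var 1 ⊖ 𝟎)
            (var 1 ⊖ ⊝ var 0))

  open DirichletApproximation public

  -- Limits, and absolute convergence of the exponential series.

  module ExponentialSeries where
    open SemiringExp semiring using (^-congˡ)

    private variable
      x y X Y l r B : ℝ
      f g : ℕ → ℝ

    -- A bound on the absolute value as two inequalities, which `≤-by` can use directly without
    -- splitting on the sign of `x`.
    Within : ℝ → ℝ → Set
    Within x X = - X ≤ x × x ≤ X

    within-∣∣ : ∀ x → Within x ∣ x ∣
    within-∣∣ x = ≤-by (-x≤∣x∣ x) (solve (x ∷ ∣ x ∣ ∷ []) (var 0 ⊖ ⊝ var 1) (var 1 ⊖ ⊝ var 0)) , x≤∣x∣ x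

    within-+ : Within x X → Within y Y → Within (x + y) (X + Y)
    within-+ {x} {X} {y} {Y} (a , b) (c , d) = ≤-by (a +≤ c) (solve (x ∷ X ∷ y ∷ Y ∷ [])
        (var 0 ⊕ var 2 ⊖ ⊝ (var 1 ⊕ var 3)) (var 0 ⊕ var 2 ⊖ (⊝ var 1 ⊖ var 3))) , b +≤ d

    private
      halve : 0# ≤ x + x → 0# ≤ x
      halve {x} p = *-cancel-≤ 0<2 (≤-by p (solve (x ∷ []) (con 2 ⊗ var 0 ⊖ con 2 ⊗ 𝟎)
          (var 0 ⊕ var 0 ⊖ 𝟎)))

    -- No sign cases: `2 (XY + xy) = (X + x)(Y + y) + (X - x)(Y - y)` and `2 (XY - xy) = (X - x)(Y +
    -- y) + (X + x)(Y - y)` are sums of products of nonnegative factors.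
    within-* : Within x X → Within y Y → Within (x * y) (X * Y)
    within-* {x} {X} {y} {Y} (a , b) (c , d) =
      0≤⇒≤ (halve (≤-by (*-nonNeg (≤⇒0≤ a) (≤⇒0≤ c) +≤ *-nonNeg (≤⇒0≤ b) (≤⇒0≤ d)) (
          solve (x ∷ X ∷ y ∷ Y ∷ [])
          (var 0 ⊗ var 2 ⊖ ⊝ (var 1 ⊗ var 3) ⊕ (var 0 ⊗ var 2 ⊖ ⊝ (var 1 ⊗ var 3)) ⊖ 𝟎)
          ((var 0 ⊖ ⊝ var 1) ⊗ (var 2 ⊖ ⊝ var 3) ⊕ (var 1 ⊖ var 0) ⊗ (var 3 ⊖ var 2) ⊖ (𝟎 ⊕ 𝟎))))) ,
      0≤⇒≤ (halve (≤-by (*-nonNeg (≤⇒0≤ b) (≤⇒0≤ c) +≤ *-nonNeg (≤⇒0≤ a) (≤⇒0≤ d)) (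
          solve (x ∷ X ∷ y ∷ Y ∷ [])
          (var 1 ⊗ var 3 ⊖ var 0 ⊗ var 2 ⊕ (var 1 ⊗ var 3 ⊖ var 0 ⊗ var 2) ⊖ 𝟎)
          ((var 1 ⊖ var 0) ⊗ (var 2 ⊖ ⊝ var 3) ⊕ (var 0 ⊖ ⊝ var 1) ⊗ (var 3 ⊖ var 2) ⊖ (𝟎 ⊕ 𝟎)))))

    within-mono : X ≤ Y → Within x X → Within x Y
    within-mono {X} {Y} X≤Y (a , b) = ≤-trans (≤-by X≤Y (solve (X ∷ Y ∷ []) (⊝ var 0 ⊖ ⊝ var 1)
        (var 1 ⊖ var 0))) a , ≤-trans b X≤Y

    ∑-within : ∀ n → (∀ i → i ℕ.< n → Within (f i) (g i)) → Within (∑ f n) (∑ g n)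
    ∑-within zero    _ = ≤-reflexive (solve [] (⊝ 𝟎) 𝟎) , ≤-refl
    ∑-within (suc n) h =
      within-+ (∑-within n λ i i<n → h i (ℕₚ.m<n⇒m<1+n i<n)) (h n ℕₚ.≤-refl)

    ∣∣<⇒within : ∣ x ∣ < B → Within x B
    ∣∣<⇒within p = within-mono (<⇒≤ p) (within-∣∣ _)

    lim-const : (λ _ → x) ⟶ x
    lim-const {x} ε 0<ε = 0 , λ _ _ → ≤-<-trans
      (∣∣-≤ (≤-reflexive (solve (x ∷ []) (⊝ 𝟎) (var 0 ⊖ var 0))) (≤-reflexive (solve (x ∷ [])
          (var 0 ⊖ var 0) 𝟎))) 0<ε

    lim-≤ : ∀ n₁ → (∀ n → n₁ ℕ.≤ n → f n ≤ g n) → f ⟶ l → g ⟶ r → l ≤ r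
    lim-≤ {f} {g} {l} {r} n₁ f≤g f⟶l g⟶r with ≤-or-> l r
    ... | inj₁ l≤r = l≤r
    ... | inj₂ r<l = contradiction (f≤g n (ℕₚ.m≤m⊔n n₁ _)) (<⇒≱ g<f)
      where
      ε : ℝ
      ε = ½ * (l - r)
      0<ε : 0# < ε
      0<ε = *-pos 0<½ (<⇒0< r<l)
      n : ℕ
      n = n₁ ℕ.⊔ (proj₁ (f⟶l ε 0<ε) ℕ.⊔ proj₁ (g⟶r ε 0<ε))
      f-near : Within (f n - l) ε
      f-near = ∣∣<⇒within (proj₂ (f⟶l ε 0<ε) n (ℕₚ.≤-trans (ℕₚ.m≤m⊔n _ _) (ℕₚ.m≤n⊔m n₁ _)))
      g-near : ∣ g n - r ∣ < ε
      g-near = proj₂ (g⟶r ε 0<ε) n (ℕₚ.≤-trans (ℕₚ.m≤n⊔m _ _) (ℕₚ.m≤n⊔m n₁ _))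
      g<f : g n < f n
      g<f = <-by (≤-<-trans (x≤∣x∣ _) g-near +<≤ proj₁ f-near +<≤
          ≤-reflexive (*-congʳ {l - r} ½-spec))
        (solve (g n ∷ f n ∷ l ∷ r ∷ ½ ∷ []) (var 1 ⊖ var 0)
            (var 4 ⊗ (var 2 ⊖ var 3) ⊕ (var 1 ⊖ var 2) ⊕ 𝟏 ⊗ (var 2 ⊖ var 3) ⊖ (var 0 ⊖ var 3 ⊖ var 4 ⊗ (var 2 ⊖ var 3) ⊕ con 2 ⊗ var 4 ⊗ (var 2 ⊖ var 3))))

    lim-+ : f ⟶ l → g ⟶ r → (λ n → f n + g n) ⟶ (l + r)
    lim-+ {f} {l} {g} {r} f⟶l g⟶r ε 0<ε = n₁ ℕ.⊔ n₂ , λ n p →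
      let a = proj₂ (f⟶l δ 0<δ) n (ℕₚ.≤-trans (ℕₚ.m≤m⊔n n₁ n₂) p)
          b = proj₂ (g⟶r δ 0<δ) n (ℕₚ.≤-trans (ℕₚ.m≤n⊔m n₁ n₂) p)
          (u , v) = within-+ (within-∣∣ (f n - l)) (within-∣∣ (g n - r))
      in ≤-<-trans (∣∣-≤ (≤-by u (solve (f n ∷ g n ∷ l ∷ r ∷ ∣ f n - l ∣ ∷ ∣ g n - r ∣ ∷ [])
             (var 0 ⊕ var 1 ⊖ (var 2 ⊕ var 3) ⊖ ⊝ (var 4 ⊕ var 5))
             (var 0 ⊖ var 2 ⊕ (var 1 ⊖ var 3) ⊖ ⊝ (var 4 ⊕ var 5))))
                         (≤-by v (solve (f n ∷ g n ∷ l ∷ r ∷ ∣ f n - l ∣ ∷ ∣ g n - r ∣ ∷ [])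
                             (var 4 ⊕ var 5 ⊖ (var 0 ⊕ var 1 ⊖ (var 2 ⊕ var 3)))
                             (var 4 ⊕ var 5 ⊖ (var 0 ⊖ var 2 ⊕ (var 1 ⊖ var 3))))))
         (<-≤-trans (a +<≤ <⇒≤ b) (≤-reflexive (trans (solve (½ ∷ ε ∷ [])
             (var 0 ⊗ var 1 ⊕ var 0 ⊗ var 1) (con 2 ⊗ var 0 ⊗ var 1)) (trans (*-congʳ ½-spec) (*-identityˡ ε)))))
      where
      δ : ℝ
      δ = ½ * ε
      0<δ : 0# < δ
      0<δ = *-pos 0<½ 0<ε
      n₁ n₂ : ℕ
      n₁ = proj₁ (f⟶l δ 0<δ)
      n₂ = proj₁ (g⟶r δ 0<δ)

    lim-* : f ⟶ l → g ⟶ r → (λ n → f n * g n) ⟶ (l * r)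
    lim-* {f} {l} {g} {r} f⟶l g⟶r ε 0<ε = n₁ ℕ.⊔ n₂ , λ n p →
      let a = ∣∣<⇒within (proj₂ (f⟶l δ 0<δ) n (ℕₚ.≤-trans (ℕₚ.m≤m⊔n n₁ n₂) p))
          b = ∣∣<⇒within (proj₂ (g⟶r δ 0<δ) n (ℕₚ.≤-trans (ℕₚ.m≤n⊔m n₁ n₂) p))
          (u , v) = within-+ (within-+ (within-* a b) (within-* (within-∣∣ l) b)) (within-* (within-∣∣ r) a)
      in ≤-<-trans (∣∣-≤ (≤-by u (solve (f n ∷ g n ∷ l ∷ r ∷ δ ∷ ∣ l ∣ ∷ ∣ r ∣ ∷ [])
             (var 0 ⊗ var 1 ⊖ var 2 ⊗ var 3 ⊖ ⊝ (var 4 ⊗ var 4 ⊕ var 5 ⊗ var 4 ⊕ var 6 ⊗ var 4))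
             ((var 0 ⊖ var 2) ⊗ (var 1 ⊖ var 3) ⊕ var 2 ⊗ (var 1 ⊖ var 3) ⊕ var 3 ⊗ (var 0 ⊖ var 2) ⊖ ⊝ (var 4 ⊗ var 4 ⊕ var 5 ⊗ var 4 ⊕ var 6 ⊗ var 4))))
                         (≤-by v (solve (f n ∷ g n ∷ l ∷ r ∷ δ ∷ ∣ l ∣ ∷ ∣ r ∣ ∷ [])
                             (var 4 ⊗ var 4 ⊕ var 5 ⊗ var 4 ⊕ var 6 ⊗ var 4 ⊖ (var 0 ⊗ var 1 ⊖ var 2 ⊗ var 3))
                             (var 4 ⊗ var 4 ⊕ var 5 ⊗ var 4 ⊕ var 6 ⊗ var 4 ⊖ ((var 0 ⊖ var 2) ⊗ (var 1 ⊖ var 3) ⊕ var 2 ⊗ (var 1 ⊖ var 3) ⊕ var 3 ⊗ (var 0 ⊖ var 2)))))) small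
      where
      W δ : ℝ
      -- The summand `ε` forces `δ < 1`, so that `δ δ` is below `δ`; the remaining summands then
      -- bound `δ δ + |l| δ + |r| δ` by `W δ = ε`.
      W = ε + (1# + (∣ l ∣ + ∣ r ∣))
      δ = ε / W
      0<W : 0# < W
      0<W = <-≤-trans 0<ε (≤-by (+-nonNeg 0≤1 (+-nonNeg (∣∣-nonNeg l) (∣∣-nonNeg r))) (
          solve (ε ∷ ∣ l ∣ ∷ ∣ r ∣ ∷ []) (var 0 ⊕ (𝟏 ⊕ (var 1 ⊕ var 2)) ⊖ var 0)
          (𝟏 ⊕ (var 1 ⊕ var 2) ⊖ 𝟎)))
      0<δ : 0# < δ
      0<δ = *-pos 0<ε (⁻¹-pos 0<W)
      Wδ≈ε : W * δ ≈ ε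
      Wδ≈ε = /-cancel 0<W
      δ<1 : δ < 1#
      δ<1 = *-cancel-< (<⇒≤ 0<W) (≤-<-trans (≤-reflexive Wδ≈ε)
        (<-by (0<1 +<≤ +-nonNeg (∣∣-nonNeg l) (∣∣-nonNeg r)) (solve (ε ∷ ∣ l ∣ ∷ ∣ r ∣ ∷ [])
            ((var 0 ⊕ (𝟏 ⊕ (var 1 ⊕ var 2))) ⊗ 𝟏 ⊖ var 0) (𝟏 ⊕ (var 1 ⊕ var 2) ⊖ (𝟎 ⊕ 𝟎)))))
      small : δ * δ + ∣ l ∣ * δ + ∣ r ∣ * δ < ε
      small = <-by (0<δ *< δ<1 +<≤ <⇒≤ (*-pos 0<ε 0<δ) +<≤ ≤-reflexive Wδ≈ε)
        (solve (ε ∷ δ ∷ ∣ l ∣ ∷ ∣ r ∣ ∷ []) (var 0 ⊖ (var 1 ⊗ var 1 ⊕ var 2 ⊗ var 1 ⊕ var 3 ⊗ var 1))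
            (var 1 ⊗ 𝟏 ⊕ var 0 ⊗ var 1 ⊕ var 0 ⊖ (var 1 ⊗ var 1 ⊕ 𝟎 ⊕ (var 0 ⊕ (𝟏 ⊕ (var 2 ⊕ var 3))) ⊗ var 1)))
      n₁ n₂ : ℕ
      n₁ = proj₁ (f⟶l δ 0<δ)
      n₂ = proj₁ (g⟶r δ 0<δ)

    lim-neg : f ⟶ l → (λ n → - f n) ⟶ (- l)
    lim-neg {f} {l} f⟶l ε 0<ε = proj₁ (f⟶l ε 0<ε) , λ n p →
      let (u , v) = within-∣∣ (f n - l) in
      ≤-<-trans (∣∣-≤ (≤-by v (solve (f n ∷ l ∷ ∣ f n - l ∣ ∷ []) (⊝ var 0 ⊖ ⊝ var 1 ⊖ ⊝ var 2)
          (var 2 ⊖ (var 0 ⊖ var 1)))) (≤-by u (solve (f n ∷ l ∷ ∣ f n - l ∣ ∷ [])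
              (var 2 ⊖ (⊝ var 0 ⊖ ⊝ var 1)) (var 0 ⊖ var 1 ⊖ ⊝ var 2))))
        (proj₂ (f⟶l ε 0<ε) n p)

    lim-double : f ⟶ l → (λ n → f (n ℕ.+ n)) ⟶ l
    lim-double f⟶l ε 0<ε = proj₁ (f⟶l ε 0<ε) , λ n p →
      proj₂ (f⟶l ε 0<ε) (n ℕ.+ n) (ℕₚ.≤-trans p (ℕₚ.m≤m+n n n))

    private
      monotone : (∀ n → f n ≤ f (suc n)) → ∀ m k → f m ≤ f (m ℕ.+ k)
      monotone inc m zero    rewrite ℕₚ.+-identityʳ m = ≤-refl
      monotone inc m (suc k) rewrite ℕₚ.+-suc m k = ≤-trans (monotone inc m k) (inc (m ℕ.+ k))

    monotone-≤ : (∀ n → f n ≤ f (suc n)) → ∀ {m n} → m ℕ.≤ n → f m ≤ f n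
    monotone-≤ {f} inc {m} {n} m≤n =
      ≤-trans (monotone inc m (n ℕ.∸ m)) (≤-reflexive (reflexive (≡.cong f (ℕₚ.m+[n∸m]≡n m≤n))))

    opaque
      monotone-converges : (∀ n → f n ≤ f (suc n)) → (∀ n → f n ≤ B) → ∃ λ l → f ⟶ l
      monotone-converges {f} {B} inc bounded = s , converges
        where
        Value : ℝ → Set
        Value v = ∃ λ n → v ≈ f n
        supremum : ∃ (IsSupremum Value)
        supremum = complete Value (f 0 , 0 , refl)
          (B , λ v (n , v≈) → ≤-trans (≤-reflexive v≈) (bounded n))
        s : ℝ
        s = proj₁ supremum
        f≤s : ∀ n → f n ≤ s
        f≤s n = proj₁ (proj₂ supremum) (f n) (n , refl)
        exceeds : ∀ ε → 0# < ε → ∃ λ n → s - ε < f n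
        exceeds ε 0<ε with lem {P = ∃ λ n → s - ε < f n}
        ... | yes p = p
        ... | no ¬p = contradiction
          (proj₂ (proj₂ supremum) (s - ε) (λ v (n , v≈) →
            ≤-trans (≤-reflexive v≈) (≮⇒≥ λ q → ¬p (n , q))))
          (<⇒≱ (<-by 0<ε (solve (s ∷ ε ∷ []) (var 0 ⊖ (var 0 ⊖ var 1)) (var 1 ⊖ 𝟎))))
        converges : f ⟶ s
        converges ε 0<ε = proj₁ (exceeds ε 0<ε) , λ n p → ∣∣-<
          (<-by (<-≤-trans (proj₂ (exceeds ε 0<ε)) (monotone-≤ inc p)) (solve (s ∷ ε ∷ f n ∷ [])
              (var 2 ⊖ var 0 ⊖ ⊝ var 1) (var 2 ⊖ (var 0 ⊖ var 1))))
          (<-by (0<ε +<≤ f≤s n) (solve (s ∷ ε ∷ f n ∷ []) (var 1 ⊖ (var 2 ⊖ var 0))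
              (var 1 ⊕ var 0 ⊖ (𝟎 ⊕ var 2))))

    private
      0<k! : ∀ k → 0# < ι (k !)
      0<k! k = ι-pos (ℕₚ.1≤n! k)

    ^ℕ-nonNeg : ∀ k → 0# ≤ x → 0# ≤ x ^ℕ k
    ^ℕ-nonNeg zero    _   = 0≤1
    ^ℕ-nonNeg (suc k) 0≤x = *-nonNeg 0≤x (^ℕ-nonNeg k 0≤x)

    opaque
      expTerm : ℕ → ℝ → ℝ
      expTerm k x = x ^ℕ k / ι (k !)

      expTerm-0 : ∀ x → expTerm 0 x ≈ 1#
      expTerm-0 x = trans (sym (*-congʳ ι-1)) (⁻¹-inverse (0<k! 0))

      -- Outside this opaque block the factorials are hidden, and products of series terms are
      -- computed from this recurrence.
      expTerm-suc : ∀ k x → ι (suc k) * expTerm (suc k) x ≈ x * expTerm k x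
      expTerm-suc k x = begin
        A * (x * P * j)            ≈⟨ solve (A ∷ x ∷ P ∷ j ∷ []) (var 0 ⊗ (var 1 ⊗ var 2 ⊗ var 3))
            (var 1 ⊗ var 2 ⊗ (var 0 ⊗ var 3) ⊗ 𝟏) ⟩
        x * P * (A * j) * 1#       ≈⟨ *-congˡ (⁻¹-inverse (0<k! k)) ⟨
        x * P * (A * j) * (F * i)  ≈⟨ solve (A ∷ x ∷ P ∷ j ∷ F ∷ i ∷ [])
            (var 1 ⊗ var 2 ⊗ (var 0 ⊗ var 3) ⊗ (var 4 ⊗ var 5))
            (var 1 ⊗ (var 2 ⊗ var 5) ⊗ (var 0 ⊗ var 4 ⊗ var 3)) ⟩
        x * (P * i) * (A * F * j)  ≈⟨ *-congˡ (trans (*-congʳ (sym (ι-* (suc k) (k !)))) (⁻¹-inverse (0<k! (suc k)))) ⟩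
        x * (P * i) * 1#           ≈⟨ *-identityʳ _ ⟩
        x * (P * i)                ∎
        where
        open ≈-R
        A P F i j : ℝ
        A = ι (suc k)
        P = x ^ℕ k
        F = ι (k !)
        i = F ⁻¹
        j = ι ((suc k) !) ⁻¹

      expTerm-nonNeg : ∀ k → 0# ≤ x → 0# ≤ expTerm k x
      expTerm-nonNeg k 0≤x = *-nonNeg (^ℕ-nonNeg k 0≤x) (<⇒≤ (⁻¹-pos (0<k! k)))

      expTerm-within : ∀ k → Within x X → Within (expTerm k x) (expTerm k X)
      expTerm-within {x} {X} k w = within-* (power k)
        (≤-by (i≥0 +≤ i≥0) (solve (ι (k !) ⁻¹ ∷ []) (var 0 ⊖ ⊝ var 0) (var 0 ⊕ var 0 ⊖ (𝟎 ⊕ 𝟎))) , ≤-refl)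
        where
        i≥0 : 0# ≤ ι (k !) ⁻¹
        i≥0 = <⇒≤ (⁻¹-pos (0<k! k))
        power : ∀ k → Within (x ^ℕ k) (X ^ℕ k)
        power zero    = ≤-by (0≤1 +≤ 0≤1) (solve [] (𝟏 ⊖ ⊝ 𝟏) (𝟏 ⊕ 𝟏 ⊖ (𝟎 ⊕ 𝟎))) , ≤-refl
        power (suc k) = within-* w (power k)

      expTerm-cong : ∀ k → x ≈ y → expTerm k x ≈ expTerm k y
      expTerm-cong k eq = *-congʳ (^-congˡ k eq)

      expTerm-≤^ : ∀ k → 0# ≤ x → expTerm k x ≤ x ^ℕ k
      expTerm-≤^ {x} k 0≤x = ≤-trans (^ℕ-nonNeg k 0≤x *≤ *-cancel-≤ (0<k! k)
        (≤-trans (≤-reflexive (⁻¹-inverse (0<k! k)))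
          (≤-trans (1≤ι (ℕₚ.1≤n! k)) (≤-reflexive (sym (*-identityʳ _))))))
        (≤-reflexive (*-identityʳ _))

    expSum : ℕ → ℝ → ℝ
    expSum n x = ∑ (λ k → expTerm k x) n

    expSum-mono : 0# ≤ x → ∀ {m n} → m ℕ.≤ n → expSum m x ≤ expSum n x
    expSum-mono {x} 0≤x = monotone-≤ λ n → ≤-by (expTerm-nonNeg n 0≤x) (
        solve (expSum n x ∷ expTerm n x ∷ []) (var 0 ⊕ var 1 ⊖ var 0) (var 1 ⊖ 𝟎))

    opaque
      -- Ratio test: for `k ≥ m ≥ 2x` each term is at most half the preceding one, so the partial
      -- sum plus twice the next term no longer increases.
      expSum-bounded : 0# ≤ x → ∃ λ B → ∀ n → expSum n x ≤ B
      expSum-bounded {x} 0≤x = expSum m x + ι 2 * expTerm m x , λ n →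
        ≤-trans (expSum-mono 0≤x (ℕₚ.m≤n+m n m))
        (≤-by (tail n +≤ expTerm-nonNeg (m ℕ.+ n) 0≤x +≤ expTerm-nonNeg (m ℕ.+ n) 0≤x)
          (solve (expSum m x ∷ expTerm m x ∷ expSum (m ℕ.+ n) x ∷ expTerm (m ℕ.+ n) x ∷ [])
              (var 0 ⊕ con 2 ⊗ var 1 ⊖ var 2)
              (var 0 ⊕ con 2 ⊗ var 1 ⊕ var 3 ⊕ var 3 ⊖ (var 2 ⊕ con 2 ⊗ var 3 ⊕ 𝟎 ⊕ 𝟎))))
        where
        m : ℕ
        m = proj₁ (archimedean (ι 2 * x))
        ratio : ∀ k → m ℕ.≤ k → ι 2 * expTerm (suc k) x ≤ expTerm k x
        ratio k m≤k = *-cancel-≤ (ι-pos {suc k} (ℕ.s≤s ℕ.z≤n)) (≤-trans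
          (≤-reflexive (begin
            ι (suc k) * (ι 2 * expTerm (suc k) x)  ≈⟨ solve (ι k ∷ expTerm (suc k) x ∷ [])
                ((𝟏 ⊕ var 0) ⊗ (con 2 ⊗ var 1)) (con 2 ⊗ ((𝟏 ⊕ var 0) ⊗ var 1)) ⟩
            ι 2 * (ι (suc k) * expTerm (suc k) x)  ≈⟨ *-congˡ (expTerm-suc k x) ⟩
            ι 2 * (x * expTerm k x)                ≈⟨ solve (x ∷ expTerm k x ∷ [])
                (con 2 ⊗ (var 0 ⊗ var 1)) (var 1 ⊗ (con 2 ⊗ var 0)) ⟩
            expTerm k x * (ι 2 * x)                ∎))
          (≤-trans (expTerm-nonNeg k 0≤x *≤ ≤-trans (proj₂ (archimedean (ι 2 * x)))
              (ι-mono-≤ (ℕₚ.m≤n⇒m≤1+n m≤k)))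
            (≤-reflexive (*-comm _ _))))
          where open ≈-R
        Tail : ℕ → Set
        Tail k = expSum k x + ι 2 * expTerm k x ≤ expSum m x + ι 2 * expTerm m x
        tail : ∀ i → Tail (m ℕ.+ i)
        tail zero    = ≡.subst Tail (≡.sym (ℕₚ.+-identityʳ m)) ≤-refl
        tail (suc i) = ≡.subst Tail (≡.sym (ℕₚ.+-suc m i))
          (≤-by (ratio (m ℕ.+ i) (ℕₚ.m≤m+n m i) +≤ tail i)
          (solve (expSum m x ∷ expTerm m x ∷ expSum (m ℕ.+ i) x ∷ expTerm (m ℕ.+ i) x ∷ expTerm (suc (m ℕ.+ i)) x ∷ [])
              (var 0 ⊕ con 2 ⊗ var 1 ⊖ (var 2 ⊕ var 3 ⊕ con 2 ⊗ var 4))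
              (var 3 ⊕ (var 0 ⊕ con 2 ⊗ var 1) ⊖ (con 2 ⊗ var 4 ⊕ (var 2 ⊕ con 2 ⊗ var 3)))))

    opaque
      -- The partial sums at `x` plus those at `|x|` are nondecreasing and bounded, as are those at
      -- `|x|` alone; the difference of the two limits is the limit sought. This replaces an
      -- argument with Cauchy sequences.
      expSum-converges : ∀ x → ∃ λ l → (λ n → expSum n x) ⟶ l
      expSum-converges x = proj₁ sum-converges - proj₁ abs-converges , transfer
        where
        ∣x∣ : ℝ
        ∣x∣ = ∣ x ∣
        sums-bounded : ∃ λ B → ∀ n → expSum n ∣x∣ ≤ B
        sums-bounded = expSum-bounded (∣∣-nonNeg x)
        w : ∀ k → Within (expTerm k x) (expTerm k ∣x∣)
        w k = expTerm-within k (within-∣∣ x)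
        sum-converges : ∃ λ l → (λ n → expSum n x + expSum n ∣x∣) ⟶ l
        sum-converges = monotone-converges {B = proj₁ sums-bounded + proj₁ sums-bounded}
          (λ n → ≤-by (proj₁ (w n)) (
              solve (expSum n x ∷ expSum n ∣x∣ ∷ expTerm n x ∷ expTerm n ∣x∣ ∷ [])
              (var 0 ⊕ var 2 ⊕ (var 1 ⊕ var 3) ⊖ (var 0 ⊕ var 1)) (var 2 ⊖ ⊝ var 3)))
          (λ n → ≤-by (proj₂ (∑-within n λ i _ → w i) +≤ proj₂ sums-bounded n +≤ proj₂ sums-bounded n)
            (solve (expSum n x ∷ expSum n ∣x∣ ∷ proj₁ sums-bounded ∷ [])
                (var 2 ⊕ var 2 ⊖ (var 0 ⊕ var 1)) (var 1 ⊕ var 2 ⊕ var 2 ⊖ (var 0 ⊕ var 1 ⊕ var 1))))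
        abs-converges : ∃ λ l → (λ n → expSum n ∣x∣) ⟶ l
        abs-converges = monotone-converges (λ n → expSum-mono (∣∣-nonNeg x) (ℕₚ.n≤1+n n)) (proj₂ sums-bounded)
        transfer : (λ n → expSum n x) ⟶ (proj₁ sum-converges - proj₁ abs-converges)
        transfer ε 0<ε = proj₁ limit , λ n p → ≤-<-trans
          (∣∣-≤ (≤-by (proj₁ (within-∣∣ (difference n))) (equal n)) (≤-by (proj₂ (within-∣∣ (difference n))) (equal′ n)))
          (proj₂ limit n p)
          where
          S A : ℝ
          S = proj₁ sum-converges
          A = proj₁ abs-converges
          difference : ℕ → ℝ
          difference n = expSum n x + expSum n ∣x∣ + - expSum n ∣x∣ - (S + - A)
          limit : ∃ λ n₀ → ∀ n → n₀ ℕ.≤ n → ∣ difference n ∣ < ε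
          limit = lim-+ (proj₂ sum-converges) (lim-neg (proj₂ abs-converges)) ε 0<ε
          equal : ∀ n → expSum n x - (S - A) - - ∣ difference n ∣ ≈ difference n - - ∣ difference n ∣
          equal n = solve (expSum n x ∷ expSum n ∣x∣ ∷ S ∷ A ∷ ∣ difference n ∣ ∷ [])
              (var 0 ⊖ (var 2 ⊖ var 3) ⊖ ⊝ var 4) (var 0 ⊕ var 1 ⊖ var 1 ⊖ (var 2 ⊖ var 3) ⊖ ⊝ var 4)
          equal′ : ∀ n → ∣ difference n ∣ - (expSum n x - (S - A)) ≈ ∣ difference n ∣ - difference n
          equal′ n = solve (expSum n x ∷ expSum n ∣x∣ ∷ S ∷ A ∷ ∣ difference n ∣ ∷ [])
              (var 4 ⊖ (var 0 ⊖ (var 2 ⊖ var 3))) (var 4 ⊖ (var 0 ⊕ var 1 ⊖ var 1 ⊖ (var 2 ⊖ var 3)))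

    opaque
      unfolding expTerm
      exp-lim : ∀ x → (λ n → expSum n x) ⟶ exp x
      exp-lim x = the-spec ((λ n → expSum n x) ⟶_) (expSum-converges x)

  open ExponentialSeries public

  -- The functional equation of `exp`, by the Cauchy product.

  module CauchyProduct where
    private variable
      x y X Y : ℝ

    exp-cong : x ≈ y → exp x ≈ exp y
    exp-cong {x} {y} eq = antisym
      (lim-≤ 0 (λ n _ → ≤-reflexive (sums n)) (exp-lim x) (exp-lim y))
      (lim-≤ 0 (λ n _ → ≤-reflexive (sym (sums n))) (exp-lim y) (exp-lim x))
      where
      sums : ∀ n → expSum n x ≈ expSum n y
      sums n = ∑-cong n λ k _ → expTerm-cong k eq

    private
      suc-∸ : ∀ {i n} → i ℕ.≤ n → suc n ℕ.∸ i ≡ suc (n ℕ.∸ i)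
      suc-∸ i≤n = ℕₚ.+-∸-assoc 1 i≤n

      convolution : ℕ → ℝ → ℝ → ℕ → ℝ
      convolution n x y i = expTerm i x * expTerm (n ℕ.∸ i) y

      ι-split : ∀ {i n} → i ℕ.≤ n → ι n ≈ ι i + ι (n ℕ.∸ i)
      ι-split {i} {n} i≤n = trans (reflexive (≡.cong ι (≡.sym (ℕₚ.m+[n∸m]≡n i≤n)))) (ι-+ i (n ℕ.∸ i))

    opaque
      -- No binomial coefficients are involved: multiply by `suc n`, write it as `i + (suc n - i)`
      -- in the `i`-th summand, and lower one index in each part by `expTerm-suc`. The result is
      -- `x + y` times the identity for `n`.
      binomial : ∀ n x y → ∑ (convolution n x y) (suc n) ≈ expTerm n (x + y)
      binomial zero x y = begin
        0# + expTerm 0 x * expTerm 0 y  ≈⟨ +-identityˡ _ ⟩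
        expTerm 0 x * expTerm 0 y       ≈⟨ *-cong (expTerm-0 x) (expTerm-0 y) ⟩
        1# * 1#                         ≈⟨ *-identityˡ 1# ⟩
        1#                              ≈⟨ expTerm-0 (x + y) ⟨
        expTerm 0 (x + y)               ∎
        where open ≈-R
      binomial (suc n) x y = *-cancel-≈ (ι-pos {suc n} (ℕ.s≤s ℕ.z≤n)) (begin
        ι (suc n) * ∑ (convolution (suc n) x y) (suc (suc n))
          ≈⟨ ∑-*ˡ (ι (suc n)) _ (suc (suc n)) ⟨
        ∑ (λ i → ι (suc n) * convolution (suc n) x y i) (suc (suc n))
          ≈⟨ ∑-cong (suc (suc n)) (λ i i<2+n → trans
              (*-congʳ (ι-split (ℕₚ.<⇒≤pred i<2+n)))
              (solve (ι i ∷ ι (suc n ℕ.∸ i) ∷ expTerm i x ∷ expTerm (suc n ℕ.∸ i) y ∷ [])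
                  ((var 0 ⊕ var 1) ⊗ (var 2 ⊗ var 3)) (var 0 ⊗ var 2 ⊗ var 3 ⊕ var 2 ⊗ (var 1 ⊗ var 3)))) ⟩
        ∑ (λ i → left i + right i) (suc (suc n))
          ≈⟨ ∑-+ left right (suc (suc n)) ⟩
        ∑ left (suc (suc n)) + ∑ right (suc (suc n))
          ≈⟨ +-cong left-sum right-sum ⟩
        x * ∑ (convolution n x y) (suc n) + y * ∑ (convolution n x y) (suc n)
          ≈⟨ distribʳ _ x y ⟨
        (x + y) * ∑ (convolution n x y) (suc n)
          ≈⟨ *-congˡ (binomial n x y) ⟩
        (x + y) * expTerm n (x + y)
          ≈⟨ expTerm-suc n (x + y) ⟨
        ι (suc n) * expTerm (suc n) (x + y) ∎)
        where
        open ≈-R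
        left right : ℕ → ℝ
        left i = (ι i * expTerm i x) * expTerm (suc n ℕ.∸ i) y
        right i = expTerm i x * (ι (suc n ℕ.∸ i) * expTerm (suc n ℕ.∸ i) y)
        left-sum : ∑ left (suc (suc n)) ≈ x * ∑ (convolution n x y) (suc n)
        left-sum = begin
          ∑ left (suc (suc n))                           ≈⟨ ∑-head left (suc n) ⟩
          left 0 + ∑ (λ i → left (suc i)) (suc n)        ≈⟨ +-cong (
              solve (expTerm 0 x ∷ expTerm (suc n) y ∷ []) (con 0 ⊗ var 0 ⊗ var 1) 𝟎)
                                                            (∑-cong (suc n) λ i _ → trans (*-congʳ (expTerm-suc i x)) (*-assoc _ _ _)) ⟩
          0# + ∑ (λ i → x * convolution n x y i) (suc n) ≈⟨ trans (+-identityˡ _) (∑-*ˡ x _ (suc n)) ⟩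
          x * ∑ (convolution n x y) (suc n)              ∎
        right-sum : ∑ right (suc (suc n)) ≈ y * ∑ (convolution n x y) (suc n)
        right-sum = begin
          ∑ right (suc n) + right (suc n)                ≈⟨ +-cong (∑-cong (suc n) λ i i<1+n → step i (ℕₚ.<⇒≤pred i<1+n)) last ⟩
          ∑ (λ i → y * convolution n x y i) (suc n) + 0# ≈⟨ trans (+-identityʳ _) (∑-*ˡ y _ (suc n)) ⟩
          y * ∑ (convolution n x y) (suc n)              ∎
          where
          step : ∀ i → i ℕ.≤ n → right i ≈ y * convolution n x y i
          step i i≤n = begin
            right i
              ≈⟨ reflexive (≡.cong (λ k → expTerm i x * (ι k * expTerm k y)) (suc-∸ i≤n)) ⟩
            expTerm i x * (ι (suc (n ℕ.∸ i)) * expTerm (suc (n ℕ.∸ i)) y)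
              ≈⟨ *-congˡ (expTerm-suc (n ℕ.∸ i) y) ⟩
            expTerm i x * (y * expTerm (n ℕ.∸ i) y)
              ≈⟨ solve (expTerm i x ∷ y ∷ expTerm (n ℕ.∸ i) y ∷ []) (var 0 ⊗ (var 1 ⊗ var 2))
                  (var 1 ⊗ (var 0 ⊗ var 2)) ⟩
            y * convolution n x y i ∎
          last : right (suc n) ≈ 0#
          last = begin
            right (suc n)
              ≈⟨ reflexive (≡.cong (λ k → expTerm (suc n) x * (ι k * expTerm k y)) (ℕₚ.n∸n≡0 (suc n))) ⟩
            expTerm (suc n) x * (ι 0 * expTerm 0 y)
              ≈⟨ solve (expTerm (suc n) x ∷ expTerm 0 y ∷ []) (var 0 ⊗ (con 0 ⊗ var 1)) 𝟎 ⟩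
            0# ∎

      -- The left side sums over the triangle `i + j < n`; passing to `suc n` adds one antidiagonal,
      -- which `binomial` evaluates.
      expSum-+ : ∀ n x y → ∑ (λ i → expTerm i x * expSum (n ℕ.∸ i) y) n ≈ expSum n (x + y)
      expSum-+ zero    x y = refl
      expSum-+ (suc n) x y = begin
        ∑ (λ i → expTerm i x * expSum (suc n ℕ.∸ i) y) (suc n)
          ≈⟨ ∑-cong (suc n) (λ i i<1+n → trans
              (reflexive (≡.cong (λ k → expTerm i x * expSum k y) (suc-∸ (ℕₚ.<⇒≤pred i<1+n))))
              (distribˡ _ _ _)) ⟩
        ∑ (λ i → expTerm i x * expSum (n ℕ.∸ i) y + convolution n x y i) (suc n)
          ≈⟨ ∑-+ _ _ (suc n) ⟩
        ∑ (λ i → expTerm i x * expSum (n ℕ.∸ i) y) n + expTerm n x * expSum (n ℕ.∸ n) y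
          + ∑ (convolution n x y) (suc n)
          ≈⟨ +-cong (+-cong (expSum-+ n x y)
              (trans (reflexive (≡.cong (λ k → expTerm n x * expSum k y) (ℕₚ.n∸n≡0 n))) (zeroʳ _)))
              (binomial n x y) ⟩
        expSum n (x + y) + 0# + expTerm n (x + y)
          ≈⟨ +-congʳ (+-identityʳ _) ⟩
        expSum n (x + y) + expTerm n (x + y) ∎
        where open ≈-R

    -- The product of two partial sums exceeds the partial sum at x + y by the
    -- terms above the diagonal.
    excess : ℕ → ℝ → ℝ → ℝ
    excess n x y = ∑ (λ i → expTerm i x * (expSum n y - expSum (n ℕ.∸ i) y)) n

    excess-spec : ∀ n x y → expSum n x * expSum n y ≈ expSum n (x + y) + excess n x y
    excess-spec n x y = begin
      expSum n x * expSum n y                         ≈⟨ *-comm _ _ ⟩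
      expSum n y * expSum n x                         ≈⟨ ∑-*ˡ (expSum n y) _ n ⟨
      ∑ (λ i → expSum n y * expTerm i x) n            ≈⟨ ∑-cong n (λ i _ →
          solve (expTerm i x ∷ expSum n y ∷ expSum (n ℕ.∸ i) y ∷ []) (var 1 ⊗ var 0)
              (var 0 ⊗ var 2 ⊕ var 0 ⊗ (var 1 ⊖ var 2))) ⟩
      ∑ (λ i → expTerm i x * expSum (n ℕ.∸ i) y
             + expTerm i x * (expSum n y - expSum (n ℕ.∸ i) y)) n
                                                      ≈⟨ ∑-+ _ _ n ⟩
      ∑ (λ i → expTerm i x * expSum (n ℕ.∸ i) y) n + excess n x y
                                                      ≈⟨ +-congʳ (expSum-+ n x y) ⟩
      expSum n (x + y) + excess n x y                 ∎
      where open ≈-R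

    -- Term by term, the part above the diagonal is dominated by the same part for larger
    -- nonnegative arguments. It is applied with `|x|` and `|y|`, so smallness need only be shown
    -- there.
    excess-within : ∀ n → Within x X → Within y Y → Within (excess n x y) (excess n X Y)
    excess-within {x} {X} {y} {Y} n wx wy = ∑-within n λ i _ →
      within-* (expTerm-within i wx) (tail-within (n ℕ.∸ i) n (ℕₚ.m∸n≤m n i))
      where
      open ≈-R
      tail : ∀ {m n} z → m ℕ.≤ n → expSum n z - expSum m z ≈ ∑ (λ k → expTerm (m ℕ.+ k) z) (n ℕ.∸ m)
      tail {m} {n} z m≤n = begin
        expSum n z - expSum m z
          ≈⟨ +-congʳ (reflexive (≡.cong (λ k → expSum k z) (≡.sym (ℕₚ.m+[n∸m]≡n m≤n)))) ⟩
        expSum (m ℕ.+ (n ℕ.∸ m)) z - expSum m z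
          ≈⟨ +-congʳ (∑-split _ m (n ℕ.∸ m)) ⟩
        expSum m z + ∑ (λ k → expTerm (m ℕ.+ k) z) (n ℕ.∸ m) - expSum m z
          ≈⟨ solve (expSum m z ∷ ∑ (λ k → expTerm (m ℕ.+ k) z) (n ℕ.∸ m) ∷ []) (var 0 ⊕ var 1 ⊖ var 0)
              (var 1) ⟩
        ∑ (λ k → expTerm (m ℕ.+ k) z) (n ℕ.∸ m) ∎
      tail-within : ∀ m n → m ℕ.≤ n → Within (expSum n y - expSum m y) (expSum n Y - expSum m Y)
      tail-within m n m≤n =
        let (a , b) = ∑-within (n ℕ.∸ m) (λ k _ → expTerm-within (m ℕ.+ k) wy)
        in ≤-trans (≤-reflexive (-‿cong (tail Y m≤n))) (≤-trans a (≤-reflexive (sym (tail y m≤n)))) ,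
           ≤-trans (≤-reflexive (tail y m≤n)) (≤-trans b (≤-reflexive (sym (tail Y m≤n))))

    -- The square `i , j < n` lies inside the triangle `i + j < 2n`, and all terms are nonnegative.
    expSum-product : 0# ≤ x → 0# ≤ y → ∀ n → expSum n x * expSum n y ≤ expSum (n ℕ.+ n) (x + y)
    expSum-product {x} {y} 0≤x 0≤y n = chain
      where
      term : ℕ → ℝ
      term i = expTerm i x * expSum (n ℕ.+ n ℕ.∸ i) y
      expSum-nonNeg : ∀ m → 0# ≤ expSum m y
      expSum-nonNeg m = ∑-nonNeg m λ k → expTerm-nonNeg k 0≤y
      below : ∀ i → i ℕ.< n → expSum n y * expTerm i x ≤ term i
      below i i<n = ≤-trans (≤-reflexive (*-comm _ _)) (expTerm-nonNeg i 0≤x *≤ expSum-mono 0≤y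
        (ℕₚ.≤-trans (ℕₚ.m≤m+n n (n ℕ.∸ i)) (ℕₚ.≤-reflexive (≡.sym (ℕₚ.+-∸-assoc n (ℕₚ.<⇒≤ i<n))))))
      chain : expSum n x * expSum n y ≤ expSum (n ℕ.+ n) (x + y)
      chain = ≤-trans (≤-reflexive (trans (*-comm _ _) (sym (∑-*ˡ (expSum n y) _ n))))
        (≤-trans (∑-mono n below)
        (≤-trans (≤-by (∑-nonNeg n λ i → *-nonNeg (expTerm-nonNeg (n ℕ.+ i) 0≤x) (expSum-nonNeg (n ℕ.+ n ℕ.∸ (n ℕ.+ i))))
          (solve (∑ term n ∷ ∑ (λ i → term (n ℕ.+ i)) n ∷ []) (var 0 ⊕ var 1 ⊖ var 0) (var 1 ⊖ 𝟎)))
        (≤-reflexive (trans (sym (∑-split term n n)) (expSum-+ (n ℕ.+ n) x y)))))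

    opaque
      -- By `expSum-product` at `|x|` and `|y|`, the excess is at most the difference between the
      -- partial sums of lengths `2n` and `n` at `|x| + |y|`, and this tends to 0.
      exp-+ : ∀ x y → exp (x + y) ≈ exp x * exp y
      exp-+ x y = antisym
        (lim-≤ 0 (λ n _ → ≤-by (≤-reflexive (sym (excess-spec n x y)) +≤ proj₁ (w n) +≤ small n)
            (solve (expSum n x ∷ expSum n y ∷ expSum n (x + y) ∷ excess n x y ∷ excess n ∣ x ∣ ∣ y ∣ ∷ expSum (n ℕ.+ n) (∣ x ∣ + ∣ y ∣) ∷ expSum n (∣ x ∣ + ∣ y ∣) ∷ [])
                (var 0 ⊗ var 1 ⊕ (var 5 ⊖ var 6) ⊖ var 2)
                (var 0 ⊗ var 1 ⊕ var 3 ⊕ (var 5 ⊖ var 6) ⊖ (var 2 ⊕ var 3 ⊖ var 4 ⊕ var 4))))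
          (exp-lim (x + y)) (limit′ product-lim))
        (lim-≤ 0 (λ n _ → ≤-by (≤-reflexive (excess-spec n x y) +≤ proj₂ (w n) +≤ small n)
            (solve (expSum n x ∷ expSum n y ∷ expSum n (x + y) ∷ excess n x y ∷ excess n ∣ x ∣ ∣ y ∣ ∷ expSum (n ℕ.+ n) (∣ x ∣ + ∣ y ∣) ∷ expSum n (∣ x ∣ + ∣ y ∣) ∷ [])
                (var 2 ⊕ (var 5 ⊖ var 6) ⊖ var 0 ⊗ var 1)
                (var 2 ⊕ var 3 ⊕ var 4 ⊕ (var 5 ⊖ var 6) ⊖ (var 0 ⊗ var 1 ⊕ var 3 ⊕ var 4))))
          product-lim (limit′ (exp-lim (x + y))))
        where
        w : ∀ n → Within (excess n x y) (excess n ∣ x ∣ ∣ y ∣)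
        w n = excess-within n (within-∣∣ x) (within-∣∣ y)
        defect : ℕ → ℝ
        defect n = expSum (n ℕ.+ n) (∣ x ∣ + ∣ y ∣) + - expSum n (∣ x ∣ + ∣ y ∣)
        small : ∀ n → excess n ∣ x ∣ ∣ y ∣ ≤ defect n
        small n = ≤-by (≤-reflexive (sym (excess-spec n ∣ x ∣ ∣ y ∣)) +≤ expSum-product (∣∣-nonNeg x) (∣∣-nonNeg y) n)
          (solve (expSum n ∣ x ∣ ∷ expSum n ∣ y ∣ ∷ expSum n (∣ x ∣ + ∣ y ∣) ∷ excess n ∣ x ∣ ∣ y ∣ ∷ expSum (n ℕ.+ n) (∣ x ∣ + ∣ y ∣) ∷ [])
              (var 4 ⊖ var 2 ⊖ var 3) (var 0 ⊗ var 1 ⊕ var 4 ⊖ (var 2 ⊕ var 3 ⊕ var 0 ⊗ var 1)))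
        product-lim : (λ n → expSum n x * expSum n y) ⟶ (exp x * exp y)
        product-lim = lim-* (exp-lim x) (exp-lim y)
        limit′ : ∀ {f l} → f ⟶ l → (λ n → f n + defect n) ⟶ l
        limit′ {f} {l} f⟶l = lim-resp (solve (l ∷ exp (∣ x ∣ + ∣ y ∣) ∷ []) (var 0 ⊕ (var 1 ⊖ var 1))
            (var 0))
          (lim-+ f⟶l (lim-+ (lim-double (exp-lim (∣ x ∣ + ∣ y ∣))) (lim-neg (exp-lim (∣ x ∣ + ∣ y ∣)))))
          where
          lim-resp : ∀ {g m m′} → m ≈ m′ → g ⟶ m → g ⟶ m′
          lim-resp {g} {m} {m′} eq g⟶m ε 0<ε = proj₁ (g⟶m ε 0<ε) , λ n p →
            let (a , b) = within-∣∣ (g n - m)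
            in ≤-<-trans (∣∣-≤ (≤-trans a (≤-reflexive (+-congˡ (-‿cong eq)))) (≤-trans (≤-reflexive (+-congˡ (-‿cong (sym eq)))) b))
                 (proj₂ (g⟶m ε 0<ε) n p)

  open CauchyProduct public

  -- Explicit bounds for `exp`, existence of logarithms, and real powers.

  module ExponentialAndLogarithm where
    open SemiringExp semiring using (^-congˡ)
    private variable
      x y t : ℝ

    opaque
      1+x≤exp : 0# ≤ x → 1# + x ≤ exp x
      1+x≤exp {x} 0≤x = lim-≤ 2 (λ n 2≤n → ≤-trans (≤-reflexive (sym two-terms)) (expSum-mono 0≤x 2≤n)) lim-const (exp-lim x)
        where
        open ≈-R
        two-terms : expSum 2 x ≈ 1# + x
        two-terms = +-cong (trans (+-identityˡ _) (expTerm-0 x)) (begin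
          expTerm 1 x         ≈⟨ trans (*-congʳ ι-1) (*-identityˡ _) ⟨
          ι 1 * expTerm 1 x   ≈⟨ expTerm-suc 0 x ⟩
          x * expTerm 0 x     ≈⟨ trans (*-congˡ (expTerm-0 x)) (*-identityʳ x) ⟩
          x                   ∎)

    opaque
      -- It is the square of `exp (x/2)`; for negative `x` the signs in the series give no direct
      -- information.
      exp-nonNeg : ∀ x → 0# ≤ exp x
      exp-nonNeg x = ≤-trans (sq-nonNeg (exp (½ * x))) (≤-reflexive (begin
        exp (½ * x) * exp (½ * x)  ≈⟨ exp-+ (½ * x) (½ * x) ⟨
        exp (½ * x + ½ * x)        ≈⟨ exp-cong (trans (solve (½ ∷ x ∷ [])
            (var 0 ⊗ var 1 ⊕ var 0 ⊗ var 1) (con 2 ⊗ var 0 ⊗ var 1)) (trans (*-congʳ ½-spec) (*-identityˡ x))) ⟩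
        exp x                      ∎))
        where open ≈-R

    opaque
      exp-0 : exp 0# ≈ 1#
      exp-0 = *-cancel-≈ (<-≤-trans 0<1 1≤exp0) (begin
        exp 0# * exp 0#   ≈⟨ exp-+ 0# 0# ⟨
        exp (0# + 0#)     ≈⟨ exp-cong (+-identityˡ 0#) ⟩
        exp 0#            ≈⟨ *-identityʳ _ ⟨
        exp 0# * 1#       ∎)
        where
        open ≈-R
        1≤exp0 : 1# ≤ exp 0#
        1≤exp0 = ≤-trans (≤-reflexive (sym (+-identityʳ 1#))) (1+x≤exp ≤-refl)

    opaque
      exp-inverse : ∀ x → exp x * exp (- x) ≈ 1#
      exp-inverse x = trans (sym (exp-+ x (- x))) (trans (exp-cong (-‿inverseʳ x)) exp-0)

    opaque
      exp-pos : ∀ x → 0# < exp x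
      exp-pos x = exp-nonNeg x , λ 0≈exp → 0≉1 (begin
        0#                 ≈⟨ zeroˡ _ ⟨
        0# * exp (- x)     ≈⟨ *-congʳ 0≈exp ⟩
        exp x * exp (- x)  ≈⟨ exp-inverse x ⟩
        1#                 ∎)
        where open ≈-R

    opaque
      exp-mono-< : x < y → exp x < exp y
      exp-mono-< {x} {y} x<y = <-≤-trans
        (<-by (*-pos (exp-pos x) (<⇒0< x<y)) (solve (exp x ∷ x ∷ y ∷ [])
            (var 0 ⊗ (𝟏 ⊕ (var 2 ⊖ var 1)) ⊖ var 0) (var 0 ⊗ (var 2 ⊖ var 1) ⊖ 𝟎)))
        (≤-trans (exp-nonNeg x *≤ 1+x≤exp (≤⇒0≤ (<⇒≤ x<y)))
          (≤-reflexive (trans (sym (exp-+ x (y - x))) (exp-cong (solve (x ∷ y ∷ [])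
              (var 0 ⊕ (var 1 ⊖ var 0)) (var 1))))))

    opaque
      exp-cancel-≤ : exp x ≤ exp y → x ≤ y
      exp-cancel-≤ p = ≮⇒≥ λ y<x → <⇒≱ (exp-mono-< y<x) p

    opaque
      exp-mono-≤ : x ≤ y → exp x ≤ exp y
      exp-mono-≤ x≤y = ≮⇒≥ λ p → proj₂ p (exp-cong (antisym (exp-cancel-≤ (<⇒≤ p)) x≤y))

    opaque
      -- Comparison with the geometric series: since `t^k / k!` is at most `t^k`, the quantity
      -- `(1 - t)` times the partial sum, plus `t^n`, never exceeds its initial value 1.
      exp-upper : 0# ≤ t → t < 1# → (1# - t) * exp t ≤ 1#
      exp-upper {t} 0≤t t<1 = lim-≤ 0 (λ n _ → ≤-by (partial n +≤ ^ℕ-nonNeg n 0≤t)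
          (solve (t ∷ expSum n t ∷ t ^ℕ n ∷ []) (𝟏 ⊖ (𝟏 ⊖ var 0) ⊗ var 1)
              (𝟏 ⊕ var 2 ⊖ ((𝟏 ⊖ var 0) ⊗ var 1 ⊕ var 2 ⊕ 𝟎)))) (lim-* lim-const (exp-lim t)) lim-const
        where
        partial : ∀ n → (1# - t) * expSum n t + t ^ℕ n ≤ 1#
        partial zero    = ≤-reflexive (solve (t ∷ []) ((𝟏 ⊖ var 0) ⊗ 𝟎 ⊕ 𝟏) 𝟏)
        partial (suc n) = ≤-by (partial n +≤ (≤⇒0≤ (<⇒≤ t<1)) *≤ expTerm-≤^ n 0≤t)
          (solve (t ∷ expSum n t ∷ t ^ℕ n ∷ expTerm n t ∷ [])
              (𝟏 ⊖ ((𝟏 ⊖ var 0) ⊗ (var 1 ⊕ var 3) ⊕ var 0 ⊗ var 2))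
              (𝟏 ⊕ (𝟏 ⊖ var 0) ⊗ var 2 ⊖ ((𝟏 ⊖ var 0) ⊗ var 1 ⊕ var 2 ⊕ (𝟏 ⊖ var 0) ⊗ var 3)))

    opaque
      exp-lower : 0# ≤ t → t < 1# → 1# - t ≤ exp (- t)
      exp-lower {t} 0≤t t<1 = *-cancel-≤ (exp-pos t) (≤-trans (≤-reflexive (*-comm _ _))
        (≤-trans (exp-upper 0≤t t<1) (≤-reflexive (sym (exp-inverse t)))))

    opaque
      relative-step : ∀ {v w} → 0# < v → v < w → ∃ λ τ → 0# < τ × τ < 1# × w * (1# - τ) ≈ v
      relative-step {v} {w} 0<v v<w = (w - v) / w ,
        *-pos (<⇒0< v<w) (⁻¹-pos 0<w) ,
        *-cancel-< (<⇒≤ 0<w) (≤-<-trans (≤-reflexive (/-cancel 0<w)) (<-by 0<v (solve (v ∷ w ∷ [])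
            (var 1 ⊗ 𝟏 ⊖ (var 1 ⊖ var 0)) (var 0 ⊖ 𝟎)))) ,
        (begin
          w * (1# - (w - v) / w)   ≈⟨ solve (w ∷ v ∷ w ⁻¹ ∷ []) (var 0 ⊗ (𝟏 ⊖ (var 0 ⊖ var 1) ⊗ var 2))
              (var 0 ⊖ var 0 ⊗ ((var 0 ⊖ var 1) ⊗ var 2)) ⟩
          w - w * ((w - v) / w)    ≈⟨ +-congˡ (-‿cong (/-cancel 0<w)) ⟩
          w - (w - v)              ≈⟨ solve (v ∷ w ∷ []) (var 1 ⊖ (var 1 ⊖ var 0)) (var 0) ⟩
          v                        ∎)
        where
        open ≈-R
        0<w : 0# < w
        0<w = ≤-<-trans (<⇒≤ 0<v) v<w

    opaque
      -- The intermediate value argument at a supremum, with `exp-upper` and `exp-lower` in place of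
      -- continuity. The condition `1# ≤ x` puts 0 into the set, and `1 + y ≤ exp y` bounds it by
      -- `x` itself.
      exp-surjective : 1# ≤ x → ∃ λ y → exp y ≈ x
      exp-surjective {x} 1≤x = s , antisym exp-s≤x x≤exp-s
        where
        0<x : 0# < x
        0<x = <-≤-trans 0<1 1≤x
        Below : ℝ → Set
        Below y = exp y ≤ x
        bounded : ∀ y → Below y → y ≤ x
        bounded y p = ≮⇒≥ λ x<y → <⇒≱ (<-≤-trans (<-by (0<1 +<≤ <⇒≤ x<y) (solve (x ∷ y ∷ [])
            (𝟏 ⊕ var 1 ⊖ var 0) (𝟏 ⊕ var 1 ⊖ (𝟎 ⊕ var 0))))
          (1+x≤exp (<⇒≤ (≤-<-trans (<⇒≤ 0<x) x<y)))) p
        supremum : ∃ (IsSupremum Below)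
        supremum = complete Below (0# , ≤-trans (≤-reflexive exp-0) 1≤x) (x , bounded)
        s : ℝ
        s = proj₁ supremum
        -- When one of v < w is exp s and the other is x, the relative step τ
        -- from s does not cross x.
        exp-s≤x : exp s ≤ x
        exp-s≤x = ≮⇒≥ λ p → let (τ , 0<τ , τ<1 , eq) = relative-step 0<x p in impossible τ 0<τ τ<1 eq
          where
          impossible : ∀ τ → 0# < τ → τ < 1# → ¬ (exp s * (1# - τ) ≈ x)
          impossible τ 0<τ τ<1 eq = <⇒≱ (<-by 0<τ (solve (s ∷ τ ∷ []) (var 0 ⊖ (var 0 ⊖ var 1))
              (var 1 ⊖ 𝟎)))
            (proj₂ (proj₂ supremum) (s - τ) λ y below → exp-cancel-≤ (≤-trans below
              (≤-trans (≤-reflexive (sym eq)) (≤-trans (exp-nonNeg s *≤ exp-lower (<⇒≤ 0<τ) τ<1)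
              (≤-reflexive (sym (exp-+ s (- τ))))))))
        x≤exp-s : x ≤ exp s
        x≤exp-s = ≮⇒≥ λ p → let (τ , 0<τ , τ<1 , eq) = relative-step (exp-pos s) p in impossible τ 0<τ τ<1 eq
          where
          impossible : ∀ τ → 0# < τ → τ < 1# → ¬ (x * (1# - τ) ≈ exp s)
          impossible τ 0<τ τ<1 eq = <⇒≱ (<-by 0<τ (solve (s ∷ τ ∷ []) (var 0 ⊕ var 1 ⊖ var 0)
              (var 1 ⊖ 𝟎)))
            (proj₁ (proj₂ supremum) (s + τ) (*-cancel-≤ (<⇒0< τ<1) (≤-trans
              (≤-reflexive (trans (*-congˡ (exp-+ s τ)) (solve (exp s ∷ exp τ ∷ τ ∷ [])
                  ((𝟏 ⊖ var 2) ⊗ (var 0 ⊗ var 1)) (var 0 ⊗ ((𝟏 ⊖ var 2) ⊗ var 1)))))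
              (≤-trans (exp-nonNeg s *≤ exp-upper (<⇒≤ 0<τ) τ<1)
              (≤-reflexive (trans (*-identityʳ _) (trans (sym eq) (*-comm _ _))))))))

    opaque
      exp-log : 1# ≤ x → exp (log x) ≈ x
      exp-log {x} 1≤x = the-spec (λ y → exp y ≈ x) (exp-surjective 1≤x)

    opaque
      exp-ι* : ∀ n x → exp (ι n * x) ≈ exp x ^ℕ n
      exp-ι* zero    x = trans (exp-cong (zeroˡ x)) exp-0
      exp-ι* (suc n) x = trans (exp-cong (solve (ι n ∷ x ∷ []) ((𝟏 ⊕ var 0) ⊗ var 1)
          (var 1 ⊕ var 0 ⊗ var 1))) (trans (exp-+ x (ι n * x)) (*-congˡ (exp-ι* n x)))

    opaque
      -- A rational substitute for log 2 ≥ 1/2. It suffices for lower bounds on logarithms of powers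
      -- of 2.
      exp-½≤2 : exp ½ ≤ ι 2
      exp-½≤2 = *-cancel-≤ 0<½ (≤-trans (≤-by (exp-upper (<⇒≤ 0<½) ½<1 +≤ ≤-reflexive (*-congʳ {exp ½} ½-spec)) (
          solve (½ ∷ exp ½ ∷ []) (𝟏 ⊖ var 0 ⊗ var 1)
          (𝟏 ⊕ 𝟏 ⊗ var 1 ⊖ ((𝟏 ⊖ var 0) ⊗ var 1 ⊕ con 2 ⊗ var 0 ⊗ var 1))))
          (≤-reflexive (trans (sym ½-spec) (*-comm _ _))))
        where
        ½<1 : ½ < 1#
        ½<1 = <-≤-trans (<-by 0<½ (solve (½ ∷ []) (con 2 ⊗ var 0 ⊖ var 0) (var 0 ⊖ 𝟎))) (≤-reflexive ½-spec)

    opaque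
      ^-exp : 1# ≤ x → ∀ y → x ^ y ≈ exp (y * log x)
      ^-exp {x} 1≤x y with lem {P = 0# < x}
      ... | yes _   = refl
      ... | no  0≮x = contradiction (<-≤-trans 0<1 1≤x) 0≮x

    opaque
      ^ℕ-mono : 0# ≤ x → x ≤ y → ∀ n → x ^ℕ n ≤ y ^ℕ n
      ^ℕ-mono 0≤x x≤y zero    = ≤-refl
      ^ℕ-mono 0≤x x≤y (suc n) = *-mono-≤ 0≤x x≤y (^ℕ-nonNeg n 0≤x) (^ℕ-mono 0≤x x≤y n)

    opaque
      ^ℕ-mono-< : 0# ≤ x → x < y → ∀ n → 1 ℕ.≤ n → x ^ℕ n < y ^ℕ n
      ^ℕ-mono-< {x} {y} 0≤x x<y (suc zero) _ = <-by x<y (solve (x ∷ y ∷ []) (var 1 ⊗ 𝟏 ⊖ var 0 ⊗ 𝟏)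
          (var 1 ⊖ var 0))
      ^ℕ-mono-< {x} {y} 0≤x x<y (suc n@(suc k)) _ = ≤-<-trans
        (0≤x *≤ <⇒≤ (^ℕ-mono-< 0≤x x<y n (ℕ.s≤s ℕ.z≤n)))
        (<-by (*-pos (≤-<-trans (^ℕ-nonNeg n 0≤x) (^ℕ-mono-< 0≤x x<y n (ℕ.s≤s ℕ.z≤n))) (<⇒0< x<y))
          (solve (x ∷ y ∷ y ^ℕ k ∷ []) (var 1 ⊗ (var 1 ⊗ var 2) ⊖ var 0 ⊗ (var 1 ⊗ var 2))
              (var 1 ⊗ var 2 ⊗ (var 1 ⊖ var 0) ⊖ 𝟎)))

    opaque
      -- Compare `d`-th powers: the `d`-th power of the real root is `a`, by `exp-ι*` and `exp-log`.
      root-≥ : ∀ d a n → 1 ℕ.≤ d → 1 ℕ.≤ a → n ℕ.^ d ℕ.≤ a → ι n ≤ ι a ^ (1# / ι d)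
      root-≥ d a n 1≤d 1≤a n^d≤a = ≮⇒≥ λ p → <⇒≱ (^ℕ-mono-< root-nonNeg p d 1≤d)
        (≤-trans (≤-reflexive (sym (ι-^ n d))) (≤-trans (ι-mono-≤ n^d≤a) (≤-reflexive (sym power))))
        where
        open ≈-R
        root-nonNeg : 0# ≤ ι a ^ (1# / ι d)
        root-nonNeg = ≤-trans (exp-nonNeg _) (≤-reflexive (sym (^-exp (1≤ι 1≤a) (1# / ι d))))
        power : (ι a ^ (1# / ι d)) ^ℕ d ≈ ι a
        power = begin
          (ι a ^ (1# / ι d)) ^ℕ d                   ≈⟨ ^-congˡ d (^-exp (1≤ι 1≤a) (1# / ι d)) ⟩
          exp (1# / ι d * log (ι a)) ^ℕ d           ≈⟨ exp-ι* d _ ⟨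
          exp (ι d * (1# / ι d * log (ι a)))        ≈⟨ exp-cong (trans (sym (*-assoc _ _ _))
                                                        (trans (*-congʳ (/-cancel (ι-pos 1≤d))) (*-identityˡ _))) ⟩
          exp (log (ι a))                           ≈⟨ exp-log (1≤ι 1≤a) ⟩
          ι a                                       ∎

  open ExponentialAndLogarithm public

  -- The blocks, the sequence, and the passage from counting to floors.

  module SequenceAndDiscrepancy where
    private variable
      x s t E : ℝ

    blockStart : ℕ → ℕ
    blockStart m = 2 ℕ.^ (2 ℕ.^ m)

    blockStart-mono : ∀ {m n} → m ℕ.≤ n → blockStart m ℕ.≤ blockStart n
    blockStart-mono m≤n = ℕₚ.^-monoʳ-≤ 2 (ℕₚ.^-monoʳ-≤ 2 m≤n)

    blockStart-mono-< : ∀ {m n} → m ℕ.< n → blockStart m ℕ.< blockStart n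
    blockStart-mono-< m<n = ℕₚ.^-monoʳ-< 2 (ℕ.s≤s (ℕ.s≤s ℕ.z≤n)) (ℕₚ.^-monoʳ-< 2 (ℕ.s≤s (ℕ.s≤s ℕ.z≤n)) m<n)

    1≤blockStart : ∀ m → 1 ℕ.≤ blockStart m
    1≤blockStart m = ℕₚ.m^n>0 2 (2 ℕ.^ m)

    -- level n = m for blockStart m ≤ n < blockStart (1 + m); level 0 = level 1 = 0.
    level : ℕ → ℕ
    level zero = 0
    level (suc n) with suc n ℕₚ.<? blockStart (suc (level n))
    ... | yes _ = level n
    ... | no _  = suc (level n)

    n<blockEnd : ∀ n → n ℕ.< blockStart (suc (level n))
    n<blockEnd zero = ℕ.s≤s ℕ.z≤n
    n<blockEnd (suc n) with suc n ℕₚ.<? blockStart (suc (level n))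
    ... | yes p = p
    ... | no _  = ℕₚ.≤-<-trans (n<blockEnd n) (blockStart-mono-< {suc (level n)} ℕₚ.≤-refl)

    level-mono : ∀ n → level n ℕ.≤ level (suc n)
    level-mono n with suc n ℕₚ.<? blockStart (suc (level n))
    ... | yes _ = ℕₚ.≤-refl
    ... | no _  = ℕₚ.n≤1+n (level n)

    -- The first alternative accommodates `n` = 0 and `n` = 1, which lie below `blockStart 0` = 2.
    level-start : ∀ n → level n ≡ 0 ⊎ blockStart (level n) ℕ.≤ n
    level-start zero = inj₁ ≡.refl
    level-start (suc n) with suc n ℕₚ.<? blockStart (suc (level n))
    ... | no p  = inj₂ (ℕₚ.≮⇒≥ p)
    ... | yes _ with level-start n
    ...   | inj₁ eq = inj₁ eq
    ...   | inj₂ p  = inj₂ (ℕₚ.m≤n⇒m≤1+n p)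

    level-≥ : ∀ {m n} → blockStart m ℕ.≤ n → m ℕ.≤ level n
    level-≥ {m} {n} p = ℕₚ.≮⇒≥ λ q → ℕₚ.<⇒≱ (n<blockEnd n) (ℕₚ.≤-trans (blockStart-mono q) p)

    level-≤ : ∀ {m n} → n ℕ.< blockStart (suc m) → level n ℕ.≤ m
    level-≤ {m} {n} p with level-start n
    ... | inj₁ eq = ℕₚ.≤-trans (ℕₚ.≤-reflexive eq) ℕ.z≤n
    ... | inj₂ q  = ℕₚ.≮⇒≥ λ m<level → ℕₚ.<⇒≱ p (ℕₚ.≤-trans (blockStart-mono m<level) q)

    module Sequence (d-1 : ℕ) where

      step : ℕ → ℕ
      step m = blockStart (suc m) ℕ.^ d-1

      a : ℕ → ℕ
      a n = n ℕ.* step (level n)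

      1≤step : ∀ m → 1 ℕ.≤ step m
      1≤step m = ℕₚ.m^n>0 (blockStart (suc m)) {{ℕ.>-nonZero (1≤blockStart (suc m))}} d-1

      step-mono : ∀ {m n} → m ℕ.≤ n → step m ℕ.≤ step n
      step-mono m≤n = ℕₚ.^-monoˡ-≤ d-1 (blockStart-mono (ℕ.s≤s m≤n))

      1≤a : ∀ n → 1 ℕ.≤ n → 1 ℕ.≤ a n
      1≤a n 1≤n = ℕₚ.*-mono-≤ 1≤n (1≤step (level n))

      a-growth : ∀ n → suc n ℕ.* a n ℕ.≤ n ℕ.* a (suc n)
      a-growth n = begin
        suc n ℕ.* (n ℕ.* step (level n))        ≡⟨ ℕₚ.*-assoc (suc n) n _ ⟨
        suc n ℕ.* n ℕ.* step (level n)          ≤⟨ ℕₚ.*-monoʳ-≤ (suc n ℕ.* n) (step-mono (level-mono n)) ⟩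
        suc n ℕ.* n ℕ.* step (level (suc n))    ≡⟨ ≡.cong (ℕ._* step (level (suc n))) (ℕₚ.*-comm (suc n) n) ⟩
        n ℕ.* suc n ℕ.* step (level (suc n))    ≡⟨ ℕₚ.*-assoc n (suc n) _ ⟩
        n ℕ.* a (suc n)                         ∎
        where open ℕₚ.≤-Reasoning

      a-mono : ∀ n → a n ℕ.< a (suc n)
      a-mono n = ℕₚ.<-≤-trans
        (ℕₚ.*-monoˡ-< (step (level n)) {{ℕ.>-nonZero (1≤step (level n))}} (ℕₚ.n<1+n n))
        (ℕₚ.*-monoʳ-≤ (suc n) (step-mono (level-mono n)))

      n^d≤a : ∀ n → n ℕ.^ suc d-1 ℕ.≤ a n
      n^d≤a n = ℕₚ.*-monoʳ-≤ n (ℕₚ.^-monoˡ-≤ d-1 (ℕₚ.<⇒≤ (n<blockEnd n)))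

      opaque
        -- The constant 1/2 buys strictness: for `d = 1` the sequence is `a n = n`, whose ratio is
        -- exactly 1 + 1/n. Multiplied by `n`, the left side contributes at most `n A + A/2`, which
        -- is below `(n + 1) A`, hence below `n A′`.
        a-gap : ∀ n → 1 ℕ.≤ n → 1# + ½ / (ι (a n) ^ (1# / ι (suc d-1))) < ι (a (suc n)) / ι (a n)
        a-gap n 1≤n = *-cancel-< (<⇒≤ 0<A) (<-≤-trans below (≤-reflexive (sym (/-cancel 0<A))))
          where
          A A′ ρ i : ℝ
          A  = ι (a n)
          A′ = ι (a (suc n))
          ρ  = ι (a n) ^ (1# / ι (suc d-1))
          i  = ρ ⁻¹
          0<A : 0# < A
          0<A = ι-pos (1≤a n 1≤n)
          n≤ρ : ι n ≤ ρ
          n≤ρ = root-≥ (suc d-1) (a n) n (ℕ.s≤s ℕ.z≤n) (1≤a n 1≤n) (n^d≤a n)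
          0<ρ : 0# < ρ
          0<ρ = <-≤-trans (ι-pos 1≤n) n≤ρ
          growth : ι (suc n) * A ≤ ι n * A′
          growth = ≤-trans (≤-reflexive (sym (ι-* (suc n) (a n))))
            (≤-trans (ι-mono-≤ (a-growth n)) (≤-reflexive (ι-* n (a (suc n)))))
          ni≤1 : ι n * i ≤ 1#
          ni≤1 = ≤-trans (≤-by (<⇒≤ (⁻¹-pos 0<ρ) *≤ n≤ρ) (solve (i ∷ ρ ∷ ι n ∷ [])
              (var 1 ⊗ var 0 ⊖ var 2 ⊗ var 0) (var 0 ⊗ var 1 ⊖ var 0 ⊗ var 2))) (≤-reflexive (⁻¹-inverse 0<ρ))
          ½<1 : ½ < 1#
          ½<1 = <-≤-trans (<-by 0<½ (solve (½ ∷ []) (con 2 ⊗ var 0 ⊖ var 0) (var 0 ⊖ 𝟎))) (≤-reflexive ½-spec)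
          below : A * (1# + ½ * i) < A′
          below = *-cancel-< (ι-nonNeg n) (<-by
            (0<A *< ½<1 +<≤ growth +<≤ (*-nonNeg (<⇒≤ 0<A) (<⇒≤ 0<½)) *≤ ni≤1)
            (solve (A ∷ A′ ∷ i ∷ ι n ∷ ½ ∷ []) (var 3 ⊗ var 1 ⊖ var 3 ⊗ (var 0 ⊗ (𝟏 ⊕ var 4 ⊗ var 2)))
                (var 0 ⊗ 𝟏 ⊕ var 3 ⊗ var 1 ⊕ var 0 ⊗ var 4 ⊗ 𝟏 ⊖ (var 0 ⊗ var 4 ⊕ (𝟏 ⊕ var 3) ⊗ var 0 ⊕ var 0 ⊗ var 4 ⊗ (var 3 ⊗ var 2)))))

    opaque
      -- For `s` between 0 and 1, the floor of `x - s` is `⌊ x ⌋` or `⌊ x ⌋ - 1` according as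
      -- `s ≤ frac x` or not. The half-open shape of the intervals is therefore exactly what a
      -- difference of floors detects.
      indicator-in : s ≤ frac x → frac x < t → 0# ≤ s → t ≤ 1# → ⌊ x - s ⌋ - ⌊ x - t ⌋ ≈ 1#
      indicator-in {s} {x} {t} p q 0≤s t≤1 = trans (+-cong
        (⌊⌋-unique (⌊⌋-int x) (≤-by p (solve (x ∷ ⌊ x ⌋ ∷ s ∷ []) (var 0 ⊖ var 2 ⊖ var 1)
            (var 0 ⊖ var 1 ⊖ var 2)))
          (<-by (frac<1 x +<≤ 0≤s) (solve (x ∷ ⌊ x ⌋ ∷ s ∷ []) (var 1 ⊕ 𝟏 ⊖ (var 0 ⊖ var 2))
              (𝟏 ⊕ var 2 ⊖ (var 0 ⊖ var 1 ⊕ 𝟎)))))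
        (-‿cong (⌊⌋-unique (int-- (⌊⌋-int x) int-1)
          (≤-by (frac-nonNeg x +≤ t≤1) (solve (x ∷ ⌊ x ⌋ ∷ t ∷ []) (var 0 ⊖ var 2 ⊖ (var 1 ⊖ 𝟏))
              (var 0 ⊖ var 1 ⊕ 𝟏 ⊖ (𝟎 ⊕ var 2))))
          (<-by q (solve (x ∷ ⌊ x ⌋ ∷ t ∷ []) (var 1 ⊖ 𝟏 ⊕ 𝟏 ⊖ (var 0 ⊖ var 2))
              (var 2 ⊖ (var 0 ⊖ var 1)))))))
        (solve (⌊ x ⌋ ∷ []) (var 0 ⊖ (var 0 ⊖ 𝟏)) 𝟏)

      indicator-below : frac x < s → s ≤ 1# → ⌊ x - s ⌋ ≈ ⌊ x ⌋ - 1#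
      indicator-below {x} {s} p s≤1 = ⌊⌋-unique (int-- (⌊⌋-int x) int-1)
          (≤-by (frac-nonNeg x +≤ s≤1) (solve (x ∷ ⌊ x ⌋ ∷ s ∷ []) (var 0 ⊖ var 2 ⊖ (var 1 ⊖ 𝟏))
              (var 0 ⊖ var 1 ⊕ 𝟏 ⊖ (𝟎 ⊕ var 2))))
          (<-by p (solve (x ∷ ⌊ x ⌋ ∷ s ∷ []) (var 1 ⊖ 𝟏 ⊕ 𝟏 ⊖ (var 0 ⊖ var 2))
              (var 2 ⊖ (var 0 ⊖ var 1))))

      indicator-above : s ≤ frac x → 0# ≤ s → ⌊ x - s ⌋ ≈ ⌊ x ⌋
      indicator-above {s} {x} p 0≤s = ⌊⌋-unique (⌊⌋-int x) (≤-by p (solve (x ∷ ⌊ x ⌋ ∷ s ∷ [])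
          (var 0 ⊖ var 2 ⊖ var 1) (var 0 ⊖ var 1 ⊖ var 2)))
          (<-by (frac<1 x +<≤ 0≤s) (solve (x ∷ ⌊ x ⌋ ∷ s ∷ []) (var 1 ⊕ 𝟏 ⊖ (var 0 ⊖ var 2))
              (𝟏 ⊕ var 2 ⊖ (var 0 ⊖ var 1 ⊕ 𝟎))))

      indicator-out : ¬ (s ≤ frac x × frac x < t) → 0# ≤ s → s < t → t ≤ 1# →
        ⌊ x - s ⌋ - ⌊ x - t ⌋ ≈ 0#
      indicator-out {s} {x} {t} ¬in 0≤s s<t t≤1 with ≤-or-> s (frac x)
      ... | inj₁ p = trans (+-cong (indicator-above p 0≤s)
          (-‿cong (indicator-above (≮⇒≥ λ q → ¬in (p , q)) (≤-trans 0≤s (<⇒≤ s<t))))) (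
              solve (⌊ x ⌋ ∷ []) (var 0 ⊖ var 0) 𝟎)
      ... | inj₂ p = trans (+-cong (indicator-below p (≤-trans (<⇒≤ s<t) t≤1))
          (-‿cong (indicator-below (<-≤-trans p (<⇒≤ s<t)) t≤1))) (solve (⌊ x ⌋ ∷ [])
              (var 0 ⊖ 𝟏 ⊖ (var 0 ⊖ 𝟏)) 𝟎)

    opaque
      -- The enumeration `f` is arbitrary because `applyUpTo` recurs by replacing `f` with
      -- `f ∘ suc`; `∑-head` peels the sum in the same order.
      ι-length-filter : ∀ {P : ℕ → Set} (P? : ∀ n → Dec (P n)) (χ : ℕ → ℝ) →
        (∀ n → P n → χ n ≈ 1#) → (∀ n → ¬ P n → χ n ≈ 0#) →
        ∀ f N → ι (length (filter P? (applyUpTo f N))) ≈ ∑ (λ i → χ (f i)) N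
      ι-length-filter P? χ χ-in χ-out f zero = refl
      ι-length-filter P? χ χ-in χ-out f (suc N) with P? (f 0)
      ... | yes p = trans (+-cong (sym (χ-in (f 0) p)) (ι-length-filter P? χ χ-in χ-out (f ∘ suc) N))
        (sym (∑-head (λ i → χ (f i)) N))
      ... | no ¬p = trans (sym (+-identityˡ _)) (trans (+-cong (sym (χ-out (f 0) ¬p)) (ι-length-filter P? χ χ-in χ-out (f ∘ suc) N))
        (sym (∑-head (λ i → χ (f i)) N)))

      count-spec : ∀ (X : ℕ → ℝ) N {s t} → 0# ≤ s → s < t → t ≤ 1# →
        ι (count (λ n → frac (X n)) N s t) ≈ ∑ (λ i → ⌊ X (suc i) - s ⌋ - ⌊ X (suc i) - t ⌋) N
      count-spec X N {s} {t} 0≤s s<t t≤1 = ι-length-filter (λ n → lem) (λ n → ⌊ X n - s ⌋ - ⌊ X n - t ⌋)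
        (λ n (p , q) → indicator-in p q 0≤s t≤1) (λ n ¬p → indicator-out ¬p 0≤s s<t t≤1) suc N

    opaque
      -- The supremum carries information only once its set is shown nonempty and bounded. `E / N`
      -- bounds it, and the interval [0, 1) gives an element, which also shows that the discrepancy
      -- is nonnegative.
      discrepancy-bound : ∀ x N → 1 ℕ.≤ N →
        (∀ s t → 0# ≤ s → s < t → t ≤ 1# → Within (ι (count x N s t) - ι N * (t - s)) E) →
        ∣ ι N * discrepancy x N ∣ ≤ E
      discrepancy-bound {E} x N 1≤N bounds = ∣∣-≤ (≤-trans -E≤0 0≤ND) ND≤E
        where
        0<N : 0# < ι N
        0<N = ι-pos 1≤N
        Value : ℝ → Set
        Value v = ∃₂ λ s t → 0# ≤ s × s < t × t ≤ 1# × v ≈ ∣ ι (count x N s t) / ι N - (t - s) ∣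
        scaled : ∀ s t → ι N * (ι (count x N s t) / ι N - (t - s)) ≈ ι (count x N s t) - ι N * (t - s)
        scaled s t = trans (distribˡ _ _ _) (+-cong (/-cancel 0<N) (solve (ι N ∷ s ∷ t ∷ [])
            (var 0 ⊗ (⊝ (var 2 ⊖ var 1))) (⊝ (var 0 ⊗ (var 2 ⊖ var 1)))))
        upper : ∀ v → Value v → v ≤ E / ι N
        upper v (s , t , 0≤s , s<t , t≤1 , eq) = ≤-trans (≤-reflexive eq) (∣∣-≤
          (*-cancel-≤ 0<N (≤-trans (≤-reflexive (trans (solve (ι N ∷ E ∷ ι N ⁻¹ ∷ [])
              (var 0 ⊗ (⊝ (var 1 ⊗ var 2))) (⊝ (var 0 ⊗ (var 1 ⊗ var 2)))) (-‿cong (/-cancel 0<N))))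
            (≤-trans (proj₁ w) (≤-reflexive (sym (scaled s t))))))
          (*-cancel-≤ 0<N (≤-trans (≤-reflexive (scaled s t)) (≤-trans (proj₂ w) (≤-reflexive (sym (/-cancel 0<N)))))))
          where
          w : Within (ι (count x N s t) - ι N * (t - s)) E
          w = bounds s t 0≤s s<t t≤1
        whole : Value ∣ ι (count x N 0# 1#) / ι N - (1# - 0#) ∣
        whole = 0# , 1# , ≤-refl , 0<1 , ≤-refl , refl
        isSup : IsSupremum Value (discrepancy x N)
        isSup = the-spec (IsSupremum Value) (complete Value (_ , whole) (E / ι N , upper))
        ND≤E : ι N * discrepancy x N ≤ E
        ND≤E = ≤-trans (<⇒≤ 0<N *≤ proj₂ isSup (E / ι N) upper) (≤-reflexive (/-cancel 0<N))
        0≤ND : 0# ≤ ι N * discrepancy x N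
        0≤ND = *-nonNeg (<⇒≤ 0<N) (≤-trans (∣∣-nonNeg _) (proj₁ isSup _ whole))
        -E≤0 : - E ≤ 0#
        -E≤0 = ≤-by (≤-trans 0≤ND ND≤E) (solve (E ∷ []) (𝟎 ⊖ ⊝ var 0) (var 0 ⊖ 𝟎))

  open SequenceAndDiscrepancy public

  -- The error of one block and its summation over blocks.

  module BlockErrors where
    -- blockBits and quality are K and T in the notation at the top.

    blockBits : ℕ → ℕ
    blockBits m = 2 ℕ.^ suc m

    quality : ℕ → ℕ
    quality m = 8 ℕ.* (blockBits m ℕ.* (suc m ℕ.* (suc (suc m) ℕ.* suc (suc (suc m)))))

    blockError : ℕ → ℕ
    blockError m = blockBits m ℕ.* (quality m ℕ.* 3)

    blockError-mono : ∀ {m n} → m ℕ.≤ n → blockError m ℕ.≤ blockError n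
    blockError-mono m≤n = ℕₚ.*-mono-≤ length≤ (ℕₚ.*-monoˡ-≤ 3 (ℕₚ.*-monoʳ-≤ 8 (ℕₚ.*-mono-≤ length≤
      (ℕₚ.*-mono-≤ (ℕ.s≤s m≤n) (ℕₚ.*-mono-≤ (ℕ.s≤s (ℕ.s≤s m≤n)) (ℕ.s≤s (ℕ.s≤s (ℕ.s≤s m≤n))))))))
      where length≤ = ℕₚ.^-monoʳ-≤ 2 (ℕ.s≤s m≤n)

    within-resp : ∀ {x y X} → x ≈ y → Within x X → Within y X
    within-resp eq (p , q) = ≤-trans p (≤-reflexive eq) , ≤-trans (≤-reflexive (sym eq)) q

    module _ (d-1 : ℕ) where
      open Sequence d-1

      Good : ℕ → ℝ → Set
      Good m α = BadlyApproximable (quality m) (blockStart (suc m)) (ι (step m) * α)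

      module Error (α : ℝ) (M₀ : ℕ) (good : ∀ m → M₀ ℕ.≤ m → Good m α)
                   (s t : ℝ) (0≤s : 0# ≤ s) (s<t : s < t) (t≤1 : t ≤ 1#) where

        χ g : ℕ → ℝ
        χ n = ⌊ ι (a n) * α - s ⌋ - ⌊ ι (a n) * α - t ⌋
        g n = χ n - (t - s)

        opaque
          -- This crude bound pays for the finitely many points before block `M₀`, where nothing is
          -- assumed about `α`.
          g-within : ∀ n → Within (g n) 1#
          g-within n with lem {P = s ≤ frac (ι (a n) * α) × frac (ι (a n) * α) < t}
          ... | yes (p , q) = within-resp (+-congʳ (sym (indicator-in p q 0≤s t≤1)))
            (≤-by (0≤1 +≤ t≤1 +≤ 0≤s) (solve (s ∷ t ∷ []) (𝟏 ⊖ (var 1 ⊖ var 0) ⊖ ⊝ 𝟏)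
                (𝟏 ⊕ 𝟏 ⊕ var 0 ⊖ (𝟎 ⊕ var 1 ⊕ 𝟎))) , ≤-by (<⇒≤ s<t) (solve (s ∷ t ∷ [])
                    (𝟏 ⊖ (𝟏 ⊖ (var 1 ⊖ var 0))) (var 1 ⊖ var 0)))
          ... | no ¬p = within-resp (+-congʳ (sym (indicator-out ¬p 0≤s s<t t≤1)))
            (≤-by (t≤1 +≤ 0≤s) (solve (s ∷ t ∷ []) (𝟎 ⊖ (var 1 ⊖ var 0) ⊖ ⊝ 𝟏) (𝟏 ⊕ var 0 ⊖ (var 1 ⊕ 𝟎))) , ≤-by (0≤1 +≤ <⇒≤ s<t) (
                solve (s ∷ t ∷ []) (𝟏 ⊖ (𝟎 ⊖ (var 1 ⊖ var 0))) (𝟏 ⊕ var 1 ⊖ (𝟎 ⊕ var 0))))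

          trivial : ∀ n → Within (∑ g n) (ι n)
          trivial n = within-mono (≤-reflexive (trans (∑-const 1# n) (*-identityʳ _)))
            (∑-within n λ i _ → g-within i)

        -- Initial segments of a block are treated, so that `N` may stop inside the last block.
        module _ (m k : ℕ) (fits : blockStart m ℕ.+ k ℕ.≤ blockStart (suc m)) where
          private
            θ γ γ′ : ℝ
            θ  = ι (step m) * α
            γ  = ι (blockStart m) * θ - s
            γ′ = ι (blockStart m) * θ - t

            k<end : k ℕ.< blockStart (suc m)
            k<end = ℕₚ.<-≤-trans (ℕₚ.m<n+m k (1≤blockStart m)) fits

            level-block : ∀ j → j ℕ.< k → level (blockStart m ℕ.+ j) ≡ m
            level-block j j<k = ℕₚ.≤-antisym
              (level-≤ (ℕₚ.<-≤-trans (ℕₚ.+-monoʳ-< (blockStart m) j<k) fits))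
              (level-≥ (ℕₚ.m≤m+n (blockStart m) j))

            point : ∀ j → j ℕ.< k → ι (a (blockStart m ℕ.+ j)) * α ≈ ι j * θ + ι (blockStart m) * θ
            point j j<k = begin
              ι (a n) * α                                    ≈⟨ *-congʳ (reflexive (≡.cong (λ l → ι (n ℕ.* step l)) (level-block j j<k))) ⟩
              ι (n ℕ.* step m) * α                           ≈⟨ *-congʳ (ι-* n (step m)) ⟩
              ι n * ι (step m) * α                           ≈⟨ *-congʳ (*-congʳ (ι-+ (blockStart m) j)) ⟩
              (ι (blockStart m) + ι j) * ι (step m) * α      ≈⟨
                  solve (ι (blockStart m) ∷ ι j ∷ ι (step m) ∷ α ∷ []) ((var 0 ⊕ var 1) ⊗ var 2 ⊗ var 3)
                  (var 1 ⊗ (var 2 ⊗ var 3) ⊕ var 0 ⊗ (var 2 ⊗ var 3)) ⟩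
              ι j * θ + ι (blockStart m) * θ                 ∎
              where
              open ≈-R
              n : ℕ
              n = blockStart m ℕ.+ j

            balanced : M₀ ℕ.≤ m → Balanced θ k (ι (blockError m))
            balanced M₀≤m = balanced-mono (≤-reflexive (sym (trans (ι-* (blockBits m) (quality m ℕ.* 3)) (*-congˡ (ι-* (quality m) 3)))))
              -- `blockStart (suc m)` is by definition `2 ^ blockBits m`, so `k<end` serves both for
              -- the number of rounds and for the range of admissible denominators.
              (badlyApproximable⇒balanced (quality m) (blockStart (suc m)) (good m M₀≤m)
                (blockBits m) k k<end (ℕₚ.<⇒≤ k<end))

          opaque
            block-sum : ∑ (λ j → g (blockStart m ℕ.+ j)) k ≈
              floorSum θ γ k - floorSum θ γ′ k - ι k * (t - s)
            block-sum = begin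
              ∑ (λ j → g (blockStart m ℕ.+ j)) k
                ≈⟨ ∑-cong k (λ j j<k → +-congʳ (+-cong
                    (⌊⌋-cong (trans (+-congʳ (point j j<k)) (+-assoc _ _ _)))
                    (-‿cong (⌊⌋-cong (trans (+-congʳ (point j j<k)) (+-assoc _ _ _)))))) ⟩
              ∑ (λ j → ⌊ ι j * θ + γ ⌋ - ⌊ ι j * θ + γ′ ⌋ - (t - s)) k
                ≈⟨ ∑-- _ _ k ⟩
              ∑ (λ j → ⌊ ι j * θ + γ ⌋ - ⌊ ι j * θ + γ′ ⌋) k - ∑ (λ _ → t - s) k
                ≈⟨ +-cong (∑-- _ _ k) (-‿cong (∑-const (t - s) k)) ⟩
              floorSum θ γ k - floorSum θ γ′ k - ι k * (t - s) ∎
              where open ≈-R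

            block-within : M₀ ℕ.≤ m →
              Within (∑ (λ j → g (blockStart m ℕ.+ j)) k) (ι (blockError m))
            block-within M₀≤m = within-resp (sym block-sum)
              ( ≤-by (balanced M₀≤m .bound γ′ γ)
                  (solve (floorSum θ γ k ∷ floorSum θ γ′ k ∷ ι k ∷ s ∷ t ∷ ι (blockError m) ∷ ι (blockStart m) ∷ ι (step m) ∷ α ∷ [])
                      (var 0 ⊖ var 1 ⊖ var 2 ⊗ (var 4 ⊖ var 3) ⊖ ⊝ var 5)
                      (var 2 ⊗ (var 6 ⊗ (var 7 ⊗ var 8) ⊖ var 4 ⊖ (var 6 ⊗ (var 7 ⊗ var 8) ⊖ var 3)) ⊕ var 5 ⊖ (var 1 ⊖ var 0)))
              , ≤-by (balanced M₀≤m .bound γ γ′)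
                  (solve (floorSum θ γ k ∷ floorSum θ γ′ k ∷ ι k ∷ s ∷ t ∷ ι (blockError m) ∷ ι (blockStart m) ∷ ι (step m) ∷ α ∷ [])
                      (var 5 ⊖ (var 0 ⊖ var 1 ⊖ var 2 ⊗ (var 4 ⊖ var 3)))
                      (var 2 ⊗ (var 6 ⊗ (var 7 ⊗ var 8) ⊖ var 3 ⊖ (var 6 ⊗ (var 7 ⊗ var 8) ⊖ var 4)) ⊕ var 5 ⊖ (var 0 ⊖ var 1))))

        opaque
          -- Points before block `M₀` are counted trivially. Each of the following `i` blocks adds
          -- its own error, and monotonicity replaces all these errors by the one at index `M₀ + i`.
          sum-within : ∀ i n → n ℕ.≤ blockStart (M₀ ℕ.+ i) →
            Within (∑ g n) (ι (blockStart M₀ ℕ.+ i ℕ.* blockError (M₀ ℕ.+ i)))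
          sum-within zero n n≤ = within-mono
            (ι-mono-≤ (ℕₚ.≤-trans n≤ (ℕₚ.≤-reflexive (≡.trans (≡.cong blockStart (ℕₚ.+-identityʳ M₀)) (≡.sym (ℕₚ.+-identityʳ _)))))) (trivial n)
          sum-within (suc i) n n≤ with ℕₚ.≤-total n (blockStart (M₀ ℕ.+ i))
          ... | inj₁ n≤′ = within-mono (ι-mono-≤ (ℕₚ.+-monoʳ-≤ (blockStart M₀)
            (ℕₚ.*-mono-≤ (ℕₚ.n≤1+n i) (blockError-mono (ℕₚ.+-monoʳ-≤ M₀ (ℕₚ.n≤1+n i)))))) (sum-within i n n≤′)
          ... | inj₂ start≤n = within-mono (≤-trans (≤-reflexive (sym (ι-+ (blockStart M₀ ℕ.+ i ℕ.* blockError m) (blockError m)))) (ι-mono-≤ total))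
            (within-resp (sym split) (within-+ (sum-within i (blockStart m) ℕₚ.≤-refl)
              (block-within m k fits (ℕₚ.m≤m+n M₀ i))))
            where
            m k : ℕ
            m = M₀ ℕ.+ i
            k = n ℕ.∸ blockStart m
            n≡ : blockStart m ℕ.+ k ≡ n
            n≡ = ℕₚ.m+[n∸m]≡n start≤n
            fits : blockStart m ℕ.+ k ℕ.≤ blockStart (suc m)
            fits = ℕₚ.≤-trans (ℕₚ.≤-reflexive n≡)
              (ℕₚ.≤-trans n≤ (ℕₚ.≤-reflexive (≡.cong blockStart (ℕₚ.+-suc M₀ i))))
            split : ∑ g n ≈ ∑ g (blockStart m) + ∑ (λ j → g (blockStart m ℕ.+ j)) k
            split = trans (reflexive (≡.cong (∑ g) (≡.sym n≡))) (∑-split g (blockStart m) k)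
            total : blockStart M₀ ℕ.+ i ℕ.* blockError m ℕ.+ blockError m ℕ.≤
                    blockStart M₀ ℕ.+ suc i ℕ.* blockError (M₀ ℕ.+ suc i)
            total = begin
              blockStart M₀ ℕ.+ i ℕ.* blockError m ℕ.+ blockError m    ≡⟨ ℕₚ.+-assoc (blockStart M₀) _ _ ⟩
              blockStart M₀ ℕ.+ (i ℕ.* blockError m ℕ.+ blockError m)  ≡⟨ ≡.cong (blockStart M₀ ℕ.+_) (ℕₚ.+-comm _ (blockError m)) ⟩
              blockStart M₀ ℕ.+ suc i ℕ.* blockError m                 ≤⟨ ℕₚ.+-monoʳ-≤ (blockStart M₀) (ℕₚ.*-monoʳ-≤ (suc i)
                                                                          (blockError-mono (ℕₚ.+-monoʳ-≤ M₀ (ℕₚ.n≤1+n i)))) ⟩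
              blockStart M₀ ℕ.+ suc i ℕ.* blockError (M₀ ℕ.+ suc i)    ∎
              where open ℕₚ.≤-Reasoning

          -- The sums ∑ g n start at index 0, the counting function at index 1.
          count-within : ∀ i N → N ℕ.< blockStart (M₀ ℕ.+ i) →
            Within (ι (count (λ n → frac (ι (a n) * α)) N s t) - ι N * (t - s))
                   (ι (suc (blockStart M₀ ℕ.+ i ℕ.* blockError (M₀ ℕ.+ i))))
          count-within i N N< = within-resp (sym count≈)
            (within-+ (≤-by (proj₂ (g-within 0)) (solve (g 0 ∷ []) (⊝ var 0 ⊖ ⊝ 𝟏) (𝟏 ⊖ var 0)) , ≤-by (proj₁ (g-within 0)) (
                solve (g 0 ∷ []) (𝟏 ⊖ ⊝ var 0) (var 0 ⊖ ⊝ 𝟏)))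
                      (sum-within i (suc N) N<))
            where
            open ≈-R
            count≈ : ι (count (λ n → frac (ι (a n) * α)) N s t) - ι N * (t - s) ≈ - g 0 + ∑ g (suc N)
            count≈ = begin
              ι (count (λ n → frac (ι (a n) * α)) N s t) - ι N * (t - s)
                ≈⟨ +-cong (count-spec (λ n → ι (a n) * α) N 0≤s s<t t≤1) (-‿cong (sym (∑-const (t - s) N))) ⟩
              ∑ (λ n → χ (suc n)) N - ∑ (λ _ → t - s) N
                ≈⟨ ∑-- _ _ N ⟨
              ∑ (λ n → g (suc n)) N
                ≈⟨ solve (g 0 ∷ ∑ (λ n → g (suc n)) N ∷ []) (var 1) (⊝ var 0 ⊕ (var 0 ⊕ var 1)) ⟩
              - g 0 + (g 0 + ∑ (λ n → g (suc n)) N)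
                ≈⟨ +-congˡ (∑-head g N) ⟨
              - g 0 + ∑ g (suc N) ∎

      opaque
        N*discrepancy-bound : ∀ α M₀ → (∀ m → M₀ ℕ.≤ m → Good m α) →
          ∀ i N → 1 ℕ.≤ N → N ℕ.< blockStart (M₀ ℕ.+ i) →
          ∣ ι N * discrepancy (λ n → frac (ι (a n) * α)) N ∣ ≤
          ι (suc (blockStart M₀ ℕ.+ i ℕ.* blockError (M₀ ℕ.+ i)))
        N*discrepancy-bound α M₀ good i N 1≤N N< =
          discrepancy-bound (λ n → frac (ι (a n) * α)) N 1≤N λ s t 0≤s s<t t≤1 →
            Error.count-within α M₀ good s t 0≤s s<t t≤1 i N N<

  open BlockErrors public

  -- Comparison of the accumulated error with powers of log N.

  module Growth where
    open CommutativeSemiringExp commutativeSemiring using (^-distrib-*)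

    opaque
      exp-½* : ∀ n → exp (ι n * ½) ≤ ι (2 ℕ.^ n)
      exp-½* n = ≤-trans (≤-reflexive (exp-ι* n ½))
        (≤-trans (^ℕ-mono (exp-nonNeg ½) exp-½≤2 n) (≤-reflexive (sym (ι-^ 2 n))))

    opaque
      -- `exp (2^m)` is the exponential of half of `2^(m+1)`, which by `exp-½≤2` is at most
      -- `2^(2^(m+1))`, the start of block `suc m`.
      log-blockStart : ∀ m N → blockStart (suc m) ℕ.≤ N → ι (2 ℕ.^ m) ≤ log (ι N)
      log-blockStart m N start≤N = exp-cancel-≤ (≤-trans (≤-reflexive (exp-cong (begin
          ι (2 ℕ.^ m)               ≈⟨ trans (sym (*-identityˡ _)) (*-congʳ (sym ½-spec)) ⟩
          ι 2 * ½ * ι (2 ℕ.^ m)     ≈⟨ solve (½ ∷ ι (2 ℕ.^ m) ∷ []) (con 2 ⊗ var 0 ⊗ var 1)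
              (con 2 ⊗ var 1 ⊗ var 0) ⟩
          ι 2 * ι (2 ℕ.^ m) * ½     ≈⟨ *-congʳ (ι-* 2 (2 ℕ.^ m)) ⟨
          ι (2 ℕ.^ suc m) * ½       ∎)))
        (≤-trans (exp-½* (2 ℕ.^ suc m)) (≤-trans (ι-mono-≤ start≤N) (≤-reflexive (sym
          (exp-log (1≤ι (ℕₚ.≤-trans (1≤blockStart (suc m)) start≤N))))))))
        where open ≈-R

    module _ (ε : ℝ) (0<ε : 0# < ε) where
      private
        κ : ℝ
        -- The value ε/8: the fourth power of `1 + m κ` is at most `exp (4 m κ) = exp (ε m/2)`, and
        -- `m/2` is the available lower bound for log log N.
        κ = ε * (½ * (½ * ½))
        0<κ : 0# < κ
        0<κ = *-pos 0<ε (*-pos 0<½ (*-pos 0<½ 0<½))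
        4κ : ι 4 * κ ≈ ε * ½
        4κ = begin
          ι 4 * κ                              ≈⟨ solve (ε ∷ ½ ∷ [])
              (con 4 ⊗ (var 0 ⊗ (var 1 ⊗ (var 1 ⊗ var 1))))
              (con 2 ⊗ var 1 ⊗ (con 2 ⊗ var 1) ⊗ (var 0 ⊗ var 1)) ⟩
          (ι 2 * ½) * (ι 2 * ½) * (ε * ½)      ≈⟨ *-congʳ (*-cong ½-spec ½-spec) ⟩
          1# * 1# * (ε * ½)                    ≈⟨ solve (ε ∷ ½ ∷ []) (𝟏 ⊗ 𝟏 ⊗ (var 0 ⊗ var 1))
              (var 0 ⊗ var 1) ⟩
          ε * ½                                ∎
          where open ≈-R

      -- Chosen to give `m + 5 ≤ Z (1 + m κ)`: the first summand, at least 1/κ, takes care of `m`,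
      -- and the second of the constant 5.
      Z : ℕ
      Z = proj₁ (archimedean (κ ⁻¹)) ℕ.+ 5

      opaque
        Z-bound : ∀ m → ι (m ℕ.+ 5) ≤ ι Z * (1# + ι m * κ)
        Z-bound m = ≤-trans (≤-reflexive (ι-+ m 5)) (≤-trans
          (≤-by (ι-nonNeg m *≤ 1≤zκ +≤ *-nonNeg (ι-nonNeg 5) (*-nonNeg (ι-nonNeg m) (<⇒≤ 0<κ)) +≤ ι-nonNeg z)
            (solve (ι m ∷ ι z ∷ κ ∷ []) ((var 1 ⊕ con 5) ⊗ (𝟏 ⊕ var 0 ⊗ var 2) ⊖ (var 0 ⊕ con 5))
                (var 0 ⊗ (var 1 ⊗ var 2) ⊕ con 5 ⊗ (var 0 ⊗ var 2) ⊕ var 1 ⊖ (var 0 ⊗ 𝟏 ⊕ 𝟎 ⊕ 𝟎))))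
          (≤-reflexive (*-congʳ (sym (ι-+ z 5)))))
          where
          z : ℕ
          z = proj₁ (archimedean (κ ⁻¹))
          1≤zκ : 1# ≤ ι z * κ
          1≤zκ = ≤-trans (≤-reflexive (sym (⁻¹-inverse 0<κ)))
            (≤-trans (<⇒≤ 0<κ *≤ proj₂ (archimedean (κ ⁻¹))) (≤-reflexive (*-comm _ _)))

      opaque
        -- Put `y = log N`. The factor `4^m` is at most `y²` because `2^m ≤ y`. Taking logarithms
        -- again gives `m/2 ≤ log y`, so the polynomial factor is at most
        -- `Z^4 exp (ε log y) = Z^4 y^ε`.
        log-power : ∀ m N → blockStart (suc m) ℕ.≤ N →
          ι (2 ℕ.^ m ℕ.* 2 ℕ.^ m ℕ.* (m ℕ.+ 5) ℕ.^ 4) ≤ ι (Z ℕ.^ 4) * log (ι N) ^ (ι 2 + ε)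
        log-power m N start≤N = conclusion
          where
          open ≈-R
          P y w δ : ℝ
          P = ι (2 ℕ.^ m)
          y = log (ι N)
          w = log y
          δ = ι m * κ
          P≤y : P ≤ y
          P≤y = log-blockStart m N start≤N
          1≤y : 1# ≤ y
          1≤y = ≤-trans (1≤ι (ℕₚ.m^n>0 2 m)) P≤y
          w≥ : ι m * ½ ≤ w
          w≥ = exp-cancel-≤ (≤-trans (exp-½* m) (≤-trans P≤y (≤-reflexive (sym (exp-log 1≤y)))))
          δ-nonNeg : 0# ≤ δ
          δ-nonNeg = *-nonNeg (ι-nonNeg m) (<⇒≤ 0<κ)
          exp-εw : (1# + δ) ^ℕ 4 ≤ exp (ε * w)
          exp-εw = ≤-trans (^ℕ-mono (+-nonNeg 0≤1 δ-nonNeg) (1+x≤exp δ-nonNeg) 4)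
            (≤-trans (≤-reflexive (trans (sym (exp-ι* 4 δ)) (exp-cong (begin
              ι 4 * (ι m * κ)    ≈⟨ solve (ι m ∷ κ ∷ []) (con 4 ⊗ (var 0 ⊗ var 1))
                  (var 0 ⊗ (con 4 ⊗ var 1)) ⟩
              ι m * (ι 4 * κ)    ≈⟨ *-congˡ 4κ ⟩
              ι m * (ε * ½)      ≈⟨ solve (ι m ∷ ε ∷ ½ ∷ []) (var 0 ⊗ (var 1 ⊗ var 2))
                  (var 1 ⊗ (var 0 ⊗ var 2)) ⟩
              ε * (ι m * ½)      ∎))))
            (exp-mono-≤ (<⇒≤ 0<ε *≤ w≥)))
          L : ℝ
          L = y ^ (ι 2 + ε)
          L≈ : L ≈ y * y * exp (ε * w)
          L≈ = begin
            y ^ (ι 2 + ε)                  ≈⟨ ^-exp 1≤y (ι 2 + ε) ⟩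
            exp ((ι 2 + ε) * w)            ≈⟨ exp-cong (solve (ε ∷ w ∷ []) ((con 2 ⊕ var 0) ⊗ var 1)
                (var 1 ⊕ var 1 ⊕ var 0 ⊗ var 1)) ⟩
            exp (w + w + ε * w)            ≈⟨ exp-+ (w + w) (ε * w) ⟩
            exp (w + w) * exp (ε * w)      ≈⟨ *-congʳ (exp-+ w w) ⟩
            exp w * exp w * exp (ε * w)    ≈⟨ *-congʳ (*-cong (exp-log 1≤y) (exp-log 1≤y)) ⟩
            y * y * exp (ε * w)            ∎
          power : ι ((m ℕ.+ 5) ℕ.^ 4) ≤ ι (Z ℕ.^ 4) * exp (ε * w)
          power = ≤-trans (≤-reflexive (ι-^ (m ℕ.+ 5) 4))
            (≤-trans (^ℕ-mono (ι-nonNeg (m ℕ.+ 5)) (Z-bound m) 4)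
            (≤-trans (≤-reflexive (trans (^-distrib-* (ι Z) (1# + δ) 4) (*-congʳ (sym (ι-^ Z 4)))))
            (ι-nonNeg (Z ℕ.^ 4) *≤ exp-εw)))
          conclusion : ι (2 ℕ.^ m ℕ.* 2 ℕ.^ m ℕ.* (m ℕ.+ 5) ℕ.^ 4) ≤ ι (Z ℕ.^ 4) * L
          conclusion = ≤-trans
            (≤-reflexive (trans (ι-* (2 ℕ.^ m ℕ.* 2 ℕ.^ m) ((m ℕ.+ 5) ℕ.^ 4)) (*-congʳ (ι-* (2 ℕ.^ m) (2 ℕ.^ m)))))
            (≤-trans (*-mono-≤ (*-nonNeg (ι-nonNeg (2 ℕ.^ m)) (ι-nonNeg (2 ℕ.^ m)))
                (*-mono-≤ (ι-nonNeg (2 ℕ.^ m)) P≤y (ι-nonNeg (2 ℕ.^ m)) P≤y) (ι-nonNeg ((m ℕ.+ 5) ℕ.^ 4)) power)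
            (≤-reflexive (trans (solve (y ∷ ι (Z ℕ.^ 4) ∷ exp (ε * w) ∷ [])
                (var 0 ⊗ var 0 ⊗ (var 1 ⊗ var 2)) (var 1 ⊗ (var 0 ⊗ var 0 ⊗ var 2))) (*-congˡ (sym L≈)))))

    private
      -- The index is raised by two because the accumulated error for `N` in block `suc m` is
      -- expressed at the next index, while `log-power` at `m` compares with `2^m`. Then `blockBits`
      -- is `8 · 2^m`, and 1536 is 8 · 8 from its two occurrences times 8 · 3.
      blockError-bound : ∀ m → blockError (suc (suc m)) ℕ.≤
        1536 ℕ.* (2 ℕ.^ m ℕ.* 2 ℕ.^ m ℕ.* ((m ℕ.+ 5) ℕ.^ 3))
      blockError-bound m = ℕₚ.≤-trans
        (ℕₚ.*-monoʳ-≤ (blockBits (suc (suc m))) (ℕₚ.*-monoˡ-≤ 3 (ℕₚ.*-monoʳ-≤ 8 (ℕₚ.*-monoʳ-≤ (blockBits (suc (suc m)))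
          (ℕₚ.*-mono-≤ (≤m+5 3 (ℕ.s≤s (ℕ.s≤s (ℕ.s≤s ℕ.z≤n)))) (ℕₚ.*-mono-≤ (≤m+5 4 (ℕ.s≤s (ℕ.s≤s (ℕ.s≤s (ℕ.s≤s ℕ.z≤n))))) (≤m+5 5 ℕₚ.≤-refl)))))))
        (ℕₚ.≤-reflexive (identity (2 ℕ.^ m) (m ℕ.+ 5)))
        where
        ≤m+5 : ∀ k → k ℕ.≤ 5 → k ℕ.+ m ℕ.≤ m ℕ.+ 5
        ≤m+5 k k≤5 = ℕₚ.≤-trans (ℕₚ.≤-reflexive (ℕₚ.+-comm k m)) (ℕₚ.+-monoʳ-≤ m k≤5)
        identity : ∀ p e → (2 ℕ.* (2 ℕ.* (2 ℕ.* p))) ℕ.* (8 ℕ.* ((2 ℕ.* (2 ℕ.* (2 ℕ.* p))) ℕ.* (e ℕ.* (e ℕ.* e))) ℕ.* 3) ≡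
          1536 ℕ.* (p ℕ.* p ℕ.* (e ℕ.* (e ℕ.* (e ℕ.* 1))))
        identity = ℕ-Solver.solve-∀

    opaque
      -- The number `i` of blocks supplies the fourth factor `m + 5`; the contribution of the
      -- initial points is absorbed because `Q` is at least 1.
      total-error : ∀ S i m → i ℕ.≤ suc (suc m) →
        suc (S ℕ.+ i ℕ.* blockError (suc (suc m))) ℕ.≤
        (suc S ℕ.+ 1536) ℕ.* (2 ℕ.^ m ℕ.* 2 ℕ.^ m ℕ.* (m ℕ.+ 5) ℕ.^ 4)
      total-error S i m i≤ = begin
        suc S ℕ.+ i ℕ.* blockError (suc (suc m))
          ≤⟨ ℕₚ.+-mono-≤ (ℕₚ.m≤m*n (suc S) Q {{ℕ.>-nonZero 1≤Q}}) (ℕₚ.*-mono-≤ i≤m+5 (blockError-bound m)) ⟩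
        suc S ℕ.* Q ℕ.+ (m ℕ.+ 5) ℕ.* (1536 ℕ.* (2 ℕ.^ m ℕ.* 2 ℕ.^ m ℕ.* ((m ℕ.+ 5) ℕ.^ 3)))
          ≡⟨ identity (suc S) (2 ℕ.^ m) (m ℕ.+ 5) ⟩
        (suc S ℕ.+ 1536) ℕ.* Q ∎
        where
        open ℕₚ.≤-Reasoning
        Q : ℕ
        Q = 2 ℕ.^ m ℕ.* 2 ℕ.^ m ℕ.* (m ℕ.+ 5) ℕ.^ 4
        1≤Q : 1 ℕ.≤ Q
        1≤Q = ℕₚ.*-mono-≤ (ℕₚ.*-mono-≤ (ℕₚ.m^n>0 2 m) (ℕₚ.m^n>0 2 m))
          (ℕₚ.m^n>0 (m ℕ.+ 5) {{ℕ.>-nonZero (ℕₚ.m≤n⇒m≤o+n m (ℕ.s≤s ℕ.z≤n))}} 4)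
        i≤m+5 : i ℕ.≤ m ℕ.+ 5
        i≤m+5 = ℕₚ.≤-trans i≤ (ℕₚ.≤-trans (ℕₚ.≤-reflexive (ℕₚ.+-comm 2 m)) (ℕₚ.+-monoʳ-≤ m (ℕ.s≤s (ℕ.s≤s ℕ.z≤n))))
        identity : ∀ s p e → s ℕ.* (p ℕ.* p ℕ.* (e ℕ.* (e ℕ.* (e ℕ.* (e ℕ.* 1))))) ℕ.+ e ℕ.* (1536 ℕ.* (p ℕ.* p ℕ.* (e ℕ.* (e ℕ.* (e ℕ.* 1))))) ≡
          (s ℕ.+ 1536) ℕ.* (p ℕ.* p ℕ.* (e ℕ.* (e ℕ.* (e ℕ.* (e ℕ.* 1)))))
        identity = ℕ-Solver.solve-∀

    opaque
      good⇒discrepancy : ∀ d-1 α M₀ → (∀ m → M₀ ℕ.≤ m → Good d-1 m α) → ∀ ε → 0# < ε →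
        (λ N → ι N * discrepancy (λ n → frac (ι (Sequence.a d-1 n) * α)) N)
          =O (λ N → log (ι N) ^ (ι 2 + ε))
      good⇒discrepancy d-1 α M₀ good ε 0<ε =
        -- From this threshold on, `level N` is a successor `suc m` with `M₀ ≤ m`, as `log-power`
        -- and `total-error` require.
        ι c * ι (Z ε 0<ε ℕ.^ 4) , blockStart (suc M₀) , λ N start≤N → bound-at N start≤N (level N) ≡.refl (level-≥ start≤N)
        where
        c : ℕ
        c = suc (blockStart M₀) ℕ.+ 1536
        bound-at : ∀ N → blockStart (suc M₀) ℕ.≤ N → ∀ l → level N ≡ l → suc M₀ ℕ.≤ l →
          ∣ ι N * discrepancy (λ n → frac (ι (Sequence.a d-1 n) * α)) N ∣ ≤
          ι c * ι (Z ε 0<ε ℕ.^ 4) * ∣ log (ι N) ^ (ι 2 + ε) ∣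
        bound-at N start≤N (suc m) eq (ℕ.s≤s M₀≤m) = ≤-trans
          (N*discrepancy-bound d-1 α M₀ good i N 1≤N (≡.subst (λ k → N ℕ.< blockStart k) end≡ (n<blockEnd N)))
          (≤-trans (ι-mono-≤ (≡.subst (λ k → suc (blockStart M₀ ℕ.+ i ℕ.* blockError k) ℕ.≤ c ℕ.* Q) (≡.sym M₀+i≡)
              (total-error (blockStart M₀) i m (ℕₚ.m∸n≤m (suc (suc m)) M₀))))
          (≤-trans (≤-reflexive (ι-* c Q))
          (≤-trans (ι-nonNeg c *≤ log-power ε 0<ε m N start)
          (≤-trans (≤-reflexive (sym (*-assoc _ _ _)))
            (*-nonNeg (ι-nonNeg c) (ι-nonNeg (Z ε 0<ε ℕ.^ 4)) *≤ x≤∣x∣ _)))))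
          where
          i Q : ℕ
          -- Makes `M₀ + i` the index of the block following the one that contains `N`.
          i = suc (suc m) ℕ.∸ M₀
          Q = 2 ℕ.^ m ℕ.* 2 ℕ.^ m ℕ.* (m ℕ.+ 5) ℕ.^ 4
          1≤N : 1 ℕ.≤ N
          1≤N = ℕₚ.≤-trans (1≤blockStart (suc M₀)) start≤N
          M₀+i≡ : M₀ ℕ.+ i ≡ suc (suc m)
          M₀+i≡ = ℕₚ.m+[n∸m]≡n (ℕₚ.m≤n⇒m≤1+n (ℕₚ.m≤n⇒m≤1+n M₀≤m))
          end≡ : suc (level N) ≡ M₀ ℕ.+ i
          end≡ = ≡.trans (≡.cong suc eq) (≡.sym M₀+i≡)
          start : blockStart (suc m) ℕ.≤ N
          start with level-start N
          ... | inj₁ eq′ = contradiction (≡.trans (≡.sym eq′) eq) λ ()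
          ... | inj₂ p   = ≡.subst (λ k → blockStart k ℕ.≤ N) eq p

  open Growth public

  -- The Borel-Cantelli argument with explicit interval covers.

  module ExceptionalSets where
    private variable
      x y : ℝ

    by-contradiction : ∀ {P : Set} → ¬ ¬ P → P
    by-contradiction {P} ¬¬p with lem {P = P}
    ... | yes p = p
    ... | no ¬p = contradiction ¬p ¬¬p

    Interval : Set
    Interval = ℝ × ℝ

    len : Interval → ℝ
    len (l , r) = r - l

    total : List Interval → ℝ
    total []       = 0#
    total (I ∷ Is) = len I + total Is

    Valid : Interval → Set
    Valid (l , r) = l ≤ r

    _∈ᴵ_ : ℝ → Interval → Set
    x ∈ᴵ (l , r) = l < x × x < r

    total-nonNeg : ∀ {Is} → All Valid Is → 0# ≤ total Is
    total-nonNeg []       = ≤-refl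
    total-nonNeg (p ∷ ps) = +-nonNeg (≤⇒0≤ p) (total-nonNeg ps)

    total-++ : ∀ Is Js → total (Is ++ Js) ≈ total Is + total Js
    total-++ []       Js = sym (+-identityˡ _)
    total-++ (I ∷ Is) Js = trans (+-congˡ (total-++ Is Js)) (sym (+-assoc _ _ _))

    total-applyUpTo : ∀ f n → total (applyUpTo f n) ≈ ∑ (λ i → len (f i)) n
    total-applyUpTo f zero    = refl
    total-applyUpTo f (suc n) = trans (+-congˡ (total-applyUpTo (f ∘ suc) n)) (sym (∑-head (λ i → len (f i)) n))

    total-concat : ∀ F n → total (List.concat (applyUpTo F n)) ≈ ∑ (λ i → total (F i)) n
    total-concat F zero    = refl
    total-concat F (suc n) = trans (total-++ (F 0) _)
      (trans (+-congˡ (total-concat (F ∘ suc) n)) (sym (∑-head (λ i → total (F i)) n)))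

    -- The empty interval before each G m makes the definition structural in the index.
    stream : List Interval → (ℕ → List Interval) → ℕ → Interval
    stream []       G zero    = 0# , 0#
    stream []       G (suc i) = stream (G 0) (G ∘ suc) i
    stream (I ∷ Is) G zero    = I
    stream (I ∷ Is) G (suc i) = stream Is G i

    stream-valid : ∀ {Is G} → All Valid Is → (∀ m → All Valid (G m)) → ∀ i → Valid (stream Is G i)
    stream-valid []       g zero    = ≤-refl
    stream-valid []       g (suc i) = stream-valid (g 0) (g ∘ suc) i
    stream-valid (p ∷ ps) g zero    = p
    stream-valid (p ∷ ps) g (suc i) = stream-valid ps g i

    -- Every list is preceded by one slot of length 0, so `n` slots cannot reach beyond `G (n - 1)`;
    -- intervals not yet reached have nonnegative length.
    stream-total : ∀ {Is G} → All Valid Is → (∀ m → All Valid (G m)) → ∀ n →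
      ∑ (λ i → len (stream Is G i)) n ≤ total Is + ∑ (λ m → total (G m)) n
    stream-total {Is} v g zero = ≤-by (total-nonNeg v) (solve (total Is ∷ []) (var 0 ⊕ 𝟎 ⊖ 𝟎)
        (var 0 ⊖ 𝟎))
    stream-total {[]} {G} [] g (suc n) = ≤-trans (≤-reflexive (∑-head (λ i → len (stream [] G i)) n))
      (≤-trans (≤-by (stream-total (g 0) (g ∘ suc) n)
          (solve (total (G 0) ∷ ∑ (λ m → total (G (suc m))) n ∷ ∑ (λ i → len (stream (G 0) (G ∘ suc) i)) n ∷ [])
              (𝟎 ⊕ (var 0 ⊕ var 1) ⊖ (𝟎 ⊖ 𝟎 ⊕ var 2)) (var 0 ⊕ var 1 ⊖ var 2)))
      (≤-reflexive (+-congˡ (sym (∑-head (λ m → total (G m)) n)))))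
    stream-total {I ∷ Is} {G} (p ∷ ps) g (suc n) = ≤-trans (≤-reflexive (∑-head (λ i → len (stream (I ∷ Is) G i)) n))
      (≤-by (stream-total ps g n +≤ total-nonNeg (g n))
        (solve (proj₁ I ∷ proj₂ I ∷ total Is ∷ total (G n) ∷ ∑ (λ m → total (G m)) n ∷ ∑ (λ i → len (stream Is G i)) n ∷ [])
            (var 1 ⊖ var 0 ⊕ var 2 ⊕ (var 4 ⊕ var 3) ⊖ (var 1 ⊖ var 0 ⊕ var 5))
            (var 2 ⊕ var 4 ⊕ var 3 ⊖ (var 5 ⊕ 𝟎))))

    module _ {P : Interval → Set} where

      stream-now : ∀ {Is} G → Any P Is → ∃ λ i → P (stream Is G i)
      stream-now G (here p)  = 0 , p
      stream-now G (there p) with (i , q) ← stream-now G p = suc i , q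

      stream-later : ∀ Is G m → Any P (G m) → ∃ λ i → P (stream Is G i)
      stream-later []       G zero    p with (i , q) ← stream-now (G ∘ suc) p = suc i , q
      stream-later []       G (suc m) p with (i , q) ← stream-later (G 0) (G ∘ suc) m p = suc i , q
      stream-later (_ ∷ Is) G m       p with (i , q) ← stream-later Is G m p = suc i , q

    ⁻¹-antitone : 0# < x → x ≤ y → y ⁻¹ ≤ x ⁻¹
    ⁻¹-antitone {x} {y} 0<x x≤y = *-cancel-≤ (*-pos 0<x 0<y) (≤-trans
      (≤-reflexive (trans (*-assoc _ _ _) (trans (*-congˡ (⁻¹-inverse 0<y)) (*-identityʳ x))))
      (≤-trans x≤y (≤-reflexive (sym (trans (solve (x ∷ y ∷ x ⁻¹ ∷ []) (var 0 ⊗ var 1 ⊗ var 2)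
          (var 1 ⊗ (var 0 ⊗ var 2))) (trans (*-congˡ (⁻¹-inverse 0<x)) (*-identityʳ y)))))))
      where
      0<y : 0# < y
      0<y = <-≤-trans 0<x x≤y

    harmonic : ℕ → ℝ
    harmonic n = ∑ (λ i → ι (suc i) ⁻¹) n

    opaque
      -- Doubling from `p = 2^k` adds `p` reciprocals, each at most 1/p, and thus at most 1 in
      -- total.
      harmonic-2^ : ∀ k → harmonic (2 ℕ.^ k) ≤ ι k + 1#
      harmonic-2^ zero = ≤-reflexive (+-congˡ (trans (sym (trans (*-congʳ ι-1) (*-identityˡ _))) (⁻¹-inverse (ι-pos {1} ℕₚ.≤-refl))))
      harmonic-2^ (suc k) = ≤-trans
        (≤-reflexive (trans (reflexive (≡.cong harmonic (≡.cong (p ℕ.+_) (ℕₚ.+-identityʳ p)))) (∑-split _ p p)))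
        (≤-by (harmonic-2^ k +≤ upper-half) (
            solve (ι k ∷ harmonic p ∷ ∑ (λ i → ι (suc (p ℕ.+ i)) ⁻¹) p ∷ [])
            (𝟏 ⊕ var 0 ⊕ 𝟏 ⊖ (var 1 ⊕ var 2)) (var 0 ⊕ 𝟏 ⊕ 𝟏 ⊖ (var 1 ⊕ var 2))))
        where
        p : ℕ
        p = 2 ℕ.^ k
        0<p : 0# < ι p
        0<p = ι-pos (ℕₚ.m^n>0 2 k)
        upper-half : ∑ (λ i → ι (suc (p ℕ.+ i)) ⁻¹) p ≤ 1#
        upper-half = ≤-trans (∑-mono p λ i _ → ⁻¹-antitone 0<p (ι-mono-≤ (ℕₚ.m≤n⇒m≤1+n (ℕₚ.m≤m+n p i))))
          (≤-reflexive (trans (∑-const (ι p ⁻¹) p) (⁻¹-inverse 0<p)))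

    telescope : ℕ → ℝ
    telescope m = ι (suc m ℕ.* suc (suc m)) ⁻¹

    opaque
      -- The remainder stands on the left to avoid a subtraction; dropping it bounds every partial
      -- sum from index `M` on by 1/(M + 1).
      telescope-sum : ∀ M n → ∑ (λ i → telescope (M ℕ.+ i)) n + ι (suc (M ℕ.+ n)) ⁻¹ ≈ ι (suc M) ⁻¹
      telescope-sum M zero    = trans (+-identityˡ _) (reflexive (≡.cong (λ k → ι (suc k) ⁻¹) (ℕₚ.+-identityʳ M)))
      telescope-sum M (suc n) = trans
        (trans (+-congˡ (reflexive (≡.cong (λ k → ι (suc k) ⁻¹) (ℕₚ.+-suc M n))))
          (trans (+-assoc _ _ _) (+-congˡ (step (M ℕ.+ n)))))
        (telescope-sum M n)
        where
        step : ∀ m → telescope m + ι (suc (suc m)) ⁻¹ ≈ ι (suc m) ⁻¹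
        step m = *-cancel-≈ (*-pos 0<A 0<B) (begin
          A * B * (c + b)            ≈⟨ solve (A ∷ B ∷ b ∷ c ∷ []) (var 0 ⊗ var 1 ⊗ (var 3 ⊕ var 2))
              (var 0 ⊗ var 1 ⊗ var 3 ⊕ var 0 ⊗ (var 1 ⊗ var 2)) ⟩
          (A * B * c) + A * (B * b)  ≈⟨ +-cong ABc (trans (*-congˡ (⁻¹-inverse 0<B)) (*-identityʳ A)) ⟩
          1# + A                     ≈⟨ *-identityʳ B ⟨
          B * 1#                     ≈⟨ *-congˡ (⁻¹-inverse 0<A) ⟨
          B * (A * a)                ≈⟨ solve (A ∷ B ∷ a ∷ []) (var 1 ⊗ (var 0 ⊗ var 2))
              (var 0 ⊗ var 1 ⊗ var 2) ⟩
          A * B * a                  ∎)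
          where
          open ≈-R
          A B a b c : ℝ
          A = ι (suc m)
          B = ι (suc (suc m))
          a = A ⁻¹
          b = B ⁻¹
          c = telescope m
          0<A : 0# < A
          0<A = ι-pos {suc m} (ℕ.s≤s ℕ.z≤n)
          0<B : 0# < B
          0<B = ι-pos {suc (suc m)} (ℕ.s≤s ℕ.z≤n)
          ABc : A * B * c ≈ 1#
          ABc = trans (*-congʳ (sym (ι-* (suc m) (suc (suc m))))) (⁻¹-inverse (ι-pos {suc m ℕ.* suc (suc m)} (ℕ.s≤s ℕ.z≤n)))

    module Exceptional (d-1 : ℕ) (m : ℕ) where
      open Sequence d-1 using (step; 1≤step)
      private
        h T K N : ℕ
        h = step m
        T = quality m
        K = blockBits m
        N = blockStart (suc m)
        1≤K : 1 ℕ.≤ K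
        1≤K = ℕₚ.m^n>0 2 (suc m)
        1≤T : 1 ℕ.≤ T
        1≤T = ℕₚ.*-mono-≤ {1} {8} (ℕ.s≤s ℕ.z≤n) (ℕₚ.*-mono-≤ 1≤K (ℕ.s≤s ℕ.z≤n))

      module _ (q : ℕ) (1≤q : 1 ℕ.≤ q) where
        private
          1≤qh : 1 ℕ.≤ q ℕ.* h
          1≤qh = ℕₚ.*-mono-≤ 1≤q (1≤step m)
          1≤qT : 1 ℕ.≤ q ℕ.* T
          1≤qT = ℕₚ.*-mono-≤ 1≤q 1≤T
          0<qh : 0# < ι (q ℕ.* h)
          0<qh = ι-pos 1≤qh
          0<qT : 0# < ι (q ℕ.* T)
          0<qT = ι-pos 1≤qT

        -- Bounds the relevant integers `u`: `|α| ≤ m + 1` and `|q h α - u| < 1` give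
        -- `|u| ≤ q h (m + 1) + 1`, hence at most `q h (m + 2)`. The index `j` of an interval stands
        -- for `u = j - range`.
        range : ℕ
        range = q ℕ.* h ℕ.* suc (suc m)

        radius : ℝ
        radius = ι (q ℕ.* h) ⁻¹ * ι (q ℕ.* T) ⁻¹

        interval : ℕ → Interval
        interval j = let c = (ι j - ι range) * ι (q ℕ.* h) ⁻¹ in c - radius , c + radius

        row : List Interval
        row = applyUpTo interval (suc (range ℕ.+ range))

        opaque
          0<radius : 0# < radius
          0<radius = *-pos (⁻¹-pos 0<qh) (⁻¹-pos 0<qT)

          row-valid : All Valid row
          row-valid = Allₚ.applyUpTo⁺₂ interval _ λ j → ≤-by (<⇒≤ 0<radius +≤ <⇒≤ 0<radius) (
              solve (ι j ∷ ι range ∷ ι (q ℕ.* h) ⁻¹ ∷ radius ∷ [])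
              ((var 0 ⊖ var 1) ⊗ var 2 ⊕ var 3 ⊖ ((var 0 ⊖ var 1) ⊗ var 2 ⊖ var 3))
              (var 3 ⊕ var 3 ⊖ (𝟎 ⊕ 𝟎)))

          -- At most `2 q h (m + 3)` intervals, each of length `2 / (q h · q T)`: the factor `q h`
          -- cancels, so the bound depends on neither `h` nor `d`.
          row-total : total row ≤ ι (4 ℕ.* suc (suc (suc m))) * ι T ⁻¹ * ι q ⁻¹
          row-total = ≤-trans (≤-reflexive (trans (total-applyUpTo interval (suc (range ℕ.+ range)))
              (trans (∑-cong {λ j → len (interval j)} {λ _ → ι 2 * radius} (suc (range ℕ.+ range)) λ j _ →
                  solve (ι j ∷ ι range ∷ ι (q ℕ.* h) ⁻¹ ∷ ι (q ℕ.* T) ⁻¹ ∷ [])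
                  ((var 0 ⊖ var 1) ⊗ var 2 ⊕ var 2 ⊗ var 3 ⊖ ((var 0 ⊖ var 1) ⊗ var 2 ⊖ var 2 ⊗ var 3))
                  (con 2 ⊗ (var 2 ⊗ var 3)))
                     (∑-const (ι 2 * radius) (suc (range ℕ.+ range))))))
            (≤-trans (≤-by (*-nonNeg (ι-nonNeg 2) (<⇒≤ 0<radius) *≤ ι-mono-≤ range≤)
              (solve (ι (range ℕ.+ range) ∷ ι (2 ℕ.* (q ℕ.* h ℕ.* suc (suc (suc m)))) ∷ ι (q ℕ.* h) ⁻¹ ∷ ι (q ℕ.* T) ⁻¹ ∷ [])
                  (con 2 ⊗ (var 2 ⊗ var 3) ⊗ var 1 ⊖ (𝟏 ⊕ var 0) ⊗ (con 2 ⊗ (var 2 ⊗ var 3)))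
                  (con 2 ⊗ (var 2 ⊗ var 3) ⊗ var 1 ⊖ con 2 ⊗ (var 2 ⊗ var 3) ⊗ (𝟏 ⊕ var 0))))
            (≤-reflexive (*-cancel-≈ (*-pos (ι-pos 1≤q) (ι-pos 1≤T)) (begin
              Q * S * (ι 2 * radius * ι (2 ℕ.* (q ℕ.* h ℕ.* e)))
                ≈⟨ *-congˡ (*-congˡ (trans (ι-* 2 (q ℕ.* h ℕ.* e)) (*-congˡ (ι-* (q ℕ.* h) e)))) ⟩
              Q * S * (ι 2 * (hi * ti) * (ι 2 * (ι (q ℕ.* h) * ι e)))
                ≈⟨ *-congʳ (ι-* q T) ⟨
              ι (q ℕ.* T) * (ι 2 * (hi * ti) * (ι 2 * (ι (q ℕ.* h) * ι e)))
                ≈⟨ solve (ι (q ℕ.* T) ∷ ι (q ℕ.* h) ∷ hi ∷ ti ∷ ι e ∷ [])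
                    (var 0 ⊗ (con 2 ⊗ (var 2 ⊗ var 3) ⊗ (con 2 ⊗ (var 1 ⊗ var 4))))
                    (con 4 ⊗ var 4 ⊗ (var 1 ⊗ var 2) ⊗ (var 0 ⊗ var 3)) ⟩
              ι 4 * ι e * (ι (q ℕ.* h) * hi) * (ι (q ℕ.* T) * ti)
                ≈⟨ *-cong (*-congˡ (⁻¹-inverse 0<qh)) (⁻¹-inverse 0<qT) ⟩
              ι 4 * ι e * 1# * 1#
                ≈⟨ *-cong (*-congˡ (⁻¹-inverse (ι-pos 1≤T))) (⁻¹-inverse (ι-pos 1≤q)) ⟨
              ι 4 * ι e * (S * S ⁻¹) * (Q * Q ⁻¹)
                ≈⟨ *-congʳ (*-congʳ (ι-* 4 e)) ⟨
              ι (4 ℕ.* e) * (S * S ⁻¹) * (Q * Q ⁻¹)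
                ≈⟨ solve (ι (4 ℕ.* e) ∷ S ∷ S ⁻¹ ∷ Q ∷ Q ⁻¹ ∷ [])
                    (var 0 ⊗ (var 1 ⊗ var 2) ⊗ (var 3 ⊗ var 4))
                    (var 3 ⊗ var 1 ⊗ (var 0 ⊗ var 2 ⊗ var 4)) ⟩
              Q * S * (ι (4 ℕ.* e) * S ⁻¹ * Q ⁻¹) ∎))))
            where
            open ≈-R
            e : ℕ
            e = suc (suc (suc m))
            Q S hi ti : ℝ
            Q = ι q
            S = ι T
            hi = ι (q ℕ.* h) ⁻¹
            ti = ι (q ℕ.* T) ⁻¹
            range≤ : suc (range ℕ.+ range) ℕ.≤ 2 ℕ.* (q ℕ.* h ℕ.* e)
            range≤ = ℕₚ.≤-trans (ℕₚ.+-monoˡ-≤ (range ℕ.+ range) (ℕₚ.≤-trans 1≤qh (ℕₚ.m≤m+n (q ℕ.* h) (q ℕ.* h))))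
              (ℕₚ.≤-reflexive (identity (q ℕ.* h) (suc (suc m))))
              where
              identity : ∀ a b → a ℕ.+ a ℕ.+ (a ℕ.* b ℕ.+ a ℕ.* b) ≡ 2 ℕ.* (a ℕ.* suc b)
              identity = ℕ-Solver.solve-∀

          -- The centre is `u / (q h)`. Multiplying by `C = q h · q T` clears the denominators of
          -- both centre and radius and turns membership into the two assumed inequalities.
          row-covers : ∀ {α u} → Within α (ι (suc m)) → IsInt u →
            - 1# < ι (q ℕ.* T) * (ι q * (ι h * α) - u) → ι (q ℕ.* T) * (ι q * (ι h * α) - u) < 1# →
            Any (α ∈ᴵ_) row
          row-covers {α} {u} (α≥ , α≤) int lo hi = Anyₚ.applyUpTo⁺ interval
            ( scale (<-by lo (begin
                C * α - C * ((ι j - ι range) * ai - radius)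
                  ≈⟨ solve (C ∷ α ∷ ι j ∷ ι range ∷ ai ∷ radius ∷ [])
                      (var 0 ⊗ var 1 ⊖ var 0 ⊗ ((var 2 ⊖ var 3) ⊗ var 4 ⊖ var 5))
                      (var 0 ⊗ var 1 ⊖ var 0 ⊗ (var 2 ⊖ var 3) ⊗ var 4 ⊕ var 0 ⊗ var 5) ⟩
                C * α - C * (ι j - ι range) * ai + C * radius
                  ≈⟨ +-cong (+-cong C*α (-‿cong center)) C*radius ⟩
                ι (q ℕ.* T) * (ι q * (ι h * α)) - ι (q ℕ.* T) * u + 1#
                  ≈⟨ solve (ι (q ℕ.* T) ∷ ι q ∷ ι h ∷ α ∷ u ∷ [])
                      (var 0 ⊗ (var 1 ⊗ (var 2 ⊗ var 3)) ⊖ var 0 ⊗ var 4 ⊕ 𝟏)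
                      (var 0 ⊗ (var 1 ⊗ (var 2 ⊗ var 3) ⊖ var 4) ⊖ ⊝ 𝟏) ⟩
                ι (q ℕ.* T) * (ι q * (ι h * α) - u) - - 1# ∎))
            , scale (<-by hi (begin
                C * ((ι j - ι range) * ai + radius) - C * α
                  ≈⟨ solve (C ∷ α ∷ ι j ∷ ι range ∷ ai ∷ radius ∷ [])
                      (var 0 ⊗ ((var 2 ⊖ var 3) ⊗ var 4 ⊕ var 5) ⊖ var 0 ⊗ var 1)
                      (var 0 ⊗ var 5 ⊖ (var 0 ⊗ var 1 ⊖ var 0 ⊗ (var 2 ⊖ var 3) ⊗ var 4)) ⟩
                C * radius - (C * α - C * (ι j - ι range) * ai)
                  ≈⟨ +-cong C*radius (-‿cong (+-cong C*α (-‿cong center))) ⟩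
                1# - (ι (q ℕ.* T) * (ι q * (ι h * α)) - ι (q ℕ.* T) * u)
                  ≈⟨ solve (ι (q ℕ.* T) ∷ ι q ∷ ι h ∷ α ∷ u ∷ [])
                      (𝟏 ⊖ (var 0 ⊗ (var 1 ⊗ (var 2 ⊗ var 3)) ⊖ var 0 ⊗ var 4))
                      (𝟏 ⊖ var 0 ⊗ (var 1 ⊗ (var 2 ⊗ var 3) ⊖ var 4)) ⟩
                1# - ι (q ℕ.* T) * (ι q * (ι h * α) - u) ∎)) )
            j<
            where
            open ≈-R
            ai C : ℝ
            ai = ι (q ℕ.* h) ⁻¹
            C = ι (q ℕ.* h) * ι (q ℕ.* T)
            0<C : 0# < C
            0<C = *-pos 0<qh 0<qT
            scale : ∀ {x y} → C * x < C * y → x < y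
            scale = *-cancel-< (<⇒≤ 0<C)
            A : ℝ
            A = ι (q ℕ.* h)
            A≈ : ι q * (ι h * α) ≈ A * α
            A≈ = trans (sym (*-assoc _ _ _)) (*-congʳ (sym (ι-* q h)))
            near : - 1# < 1# * (ι q * (ι h * α) - u) × 1# * (ι q * (ι h * α) - u) < 1#
            near = scale-down 0≤1 (1≤ι 1≤qT) lo hi
            ιrange : ι range ≈ A * (1# + ι (suc m))
            ιrange = ι-* (q ℕ.* h) (suc (suc m))
            1≤A : 1# ≤ A
            1≤A = 1≤ι 1≤qh
            0≤u+range : 0# ≤ u + ι range
            0≤u+range = ≤-by (<⇒≤ (proj₂ near) +≤ <⇒≤ 0<qh *≤ α≥ +≤ 1≤A +≤ ≤-reflexive (sym ιrange) +≤ ≤-reflexive (sym A≈))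
              (solve (ι q ∷ ι h ∷ A ∷ α ∷ u ∷ ι range ∷ ι (suc m) ∷ []) (var 4 ⊕ var 5 ⊖ 𝟎)
                  (𝟏 ⊕ var 2 ⊗ var 3 ⊕ var 2 ⊕ var 5 ⊕ var 0 ⊗ (var 1 ⊗ var 3) ⊖ (𝟏 ⊗ (var 0 ⊗ (var 1 ⊗ var 3) ⊖ var 4) ⊕ var 2 ⊗ (⊝ var 6) ⊕ 𝟏 ⊕ var 2 ⊗ (𝟏 ⊕ var 6) ⊕ var 2 ⊗ var 3)))
            found : ∃ λ j → u + ι range ≈ ι j
            found = int-nonNeg (int-+ int (int-ι range)) 0≤u+range
            j : ℕ
            j = proj₁ found
            ιj : ι j - ι range ≈ u
            ιj = trans (+-congʳ (sym (proj₂ found))) (solve (u ∷ ι range ∷ []) (var 0 ⊕ var 1 ⊖ var 1)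
                (var 0))
            j< : j ℕ.< suc (range ℕ.+ range)
            j< = ℕ.s≤s (ι-cancel-≤ (≤-trans (≤-reflexive (sym (proj₂ found))) (≤-trans
              (≤-by (<⇒≤ (proj₁ near) +≤ <⇒≤ 0<qh *≤ α≤ +≤ 1≤A +≤ ≤-reflexive (sym ιrange) +≤ ≤-reflexive A≈)
                (solve (ι q ∷ ι h ∷ A ∷ α ∷ u ∷ ι range ∷ ι (suc m) ∷ [])
                    (var 5 ⊕ var 5 ⊖ (var 4 ⊕ var 5))
                    (𝟏 ⊗ (var 0 ⊗ (var 1 ⊗ var 3) ⊖ var 4) ⊕ var 2 ⊗ var 6 ⊕ var 2 ⊕ var 5 ⊕ var 2 ⊗ var 3 ⊖ (⊝ 𝟏 ⊕ var 2 ⊗ var 3 ⊕ 𝟏 ⊕ var 2 ⊗ (𝟏 ⊕ var 6) ⊕ var 0 ⊗ (var 1 ⊗ var 3)))))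
              (≤-reflexive (sym (ι-+ range range))))))
            C*α : C * α ≈ ι (q ℕ.* T) * (ι q * (ι h * α))
            C*α = trans (solve (ι (q ℕ.* h) ∷ ι (q ℕ.* T) ∷ α ∷ []) (var 0 ⊗ var 1 ⊗ var 2)
                (var 1 ⊗ (var 0 ⊗ var 2))) (*-congˡ (sym A≈))
            center : C * (ι j - ι range) * ai ≈ ι (q ℕ.* T) * u
            center = begin
              C * (ι j - ι range) * ai                              ≈⟨
                  solve (ι (q ℕ.* h) ∷ ι (q ℕ.* T) ∷ ι j ∷ ι range ∷ ai ∷ [])
                  (var 0 ⊗ var 1 ⊗ (var 2 ⊖ var 3) ⊗ var 4) (var 0 ⊗ var 4 ⊗ (var 1 ⊗ (var 2 ⊖ var 3))) ⟩
              (A * ai) * (ι (q ℕ.* T) * (ι j - ι range))            ≈⟨ *-cong (⁻¹-inverse 0<qh) (*-congˡ ιj) ⟩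
              1# * (ι (q ℕ.* T) * u)                                ≈⟨ *-identityˡ _ ⟩
              ι (q ℕ.* T) * u                                       ∎
            C*radius : C * radius ≈ 1#
            C*radius = begin
              C * radius                                            ≈⟨
                  solve (ι (q ℕ.* h) ∷ ι (q ℕ.* T) ∷ ai ∷ ι (q ℕ.* T) ⁻¹ ∷ [])
                  (var 0 ⊗ var 1 ⊗ (var 2 ⊗ var 3)) (var 0 ⊗ var 2 ⊗ (var 1 ⊗ var 3)) ⟩
              (A * ai) * (ι (q ℕ.* T) * ι (q ℕ.* T) ⁻¹)             ≈⟨ *-cong (⁻¹-inverse 0<qh) (⁻¹-inverse 0<qT) ⟩
              1# * 1#                                               ≈⟨ *-identityˡ 1# ⟩
              1#                                                    ∎

      cover : List Interval
      cover = List.concat (applyUpTo (λ i → row (suc i) (ℕ.s≤s ℕ.z≤n)) N)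

      opaque
        cover-valid : All Valid cover
        cover-valid = Allₚ.concat⁺ (Allₚ.applyUpTo⁺₂ _ N λ i → row-valid (suc i) (ℕ.s≤s ℕ.z≤n))

        -- Summing `4 (m + 3) / (T q)` over `q ≤ 2^K` gives at most `4 (m + 3)(K + 1) / T`, hence at
        -- most `8 (m + 3) K / T`. The constant 8 and the factors of `quality` are chosen to make
        -- this exactly 1/((m + 1)(m + 2)).
        cover-total : total cover ≤ telescope m
        cover-total = ≤-trans (≤-reflexive (total-concat _ N))
          (≤-trans (∑-mono N λ i _ → row-total (suc i) (ℕ.s≤s ℕ.z≤n))
          (≤-trans (≤-reflexive (∑-*ˡ κ _ N))
          (≤-trans (*-nonNeg (ι-nonNeg (4 ℕ.* e)) (<⇒≤ (⁻¹-pos 0<T)) *≤ ≤-trans (harmonic-2^ K) K+1≤2K)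
          (≤-reflexive (*-cancel-≈ 0<T (begin
            ι T * (κ * (ι 2 * ι K))                          ≈⟨
                solve (ι T ∷ ι T ⁻¹ ∷ ι (4 ℕ.* e) ∷ ι K ∷ [])
                (var 0 ⊗ (var 2 ⊗ var 1 ⊗ (con 2 ⊗ var 3))) (var 0 ⊗ var 1 ⊗ (var 2 ⊗ (con 2 ⊗ var 3))) ⟩
            (ι T * ι T ⁻¹) * (ι (4 ℕ.* e) * (ι 2 * ι K))     ≈⟨ *-cong (⁻¹-inverse 0<T) (*-congˡ (sym (ι-* 2 K))) ⟩
            1# * (ι (4 ℕ.* e) * ι (2 ℕ.* K))                 ≈⟨ trans (*-identityˡ _) (sym (ι-* (4 ℕ.* e) (2 ℕ.* K))) ⟩
            ι (4 ℕ.* e ℕ.* (2 ℕ.* K))                        ≈⟨ *-identityʳ _ ⟨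
            ι (4 ℕ.* e ℕ.* (2 ℕ.* K)) * 1#                   ≈⟨ *-congˡ (⁻¹-inverse 0<b) ⟨
            ι (4 ℕ.* e ℕ.* (2 ℕ.* K)) * (ι b * ι b ⁻¹)       ≈⟨ *-assoc _ _ _ ⟨
            ι (4 ℕ.* e ℕ.* (2 ℕ.* K)) * ι b * ι b ⁻¹         ≈⟨ *-congʳ (ι-* (4 ℕ.* e ℕ.* (2 ℕ.* K)) b) ⟨
            ι (4 ℕ.* e ℕ.* (2 ℕ.* K) ℕ.* b) * ι b ⁻¹         ≈⟨ *-congʳ (reflexive (≡.cong ι (identity e K (suc m) (suc (suc m))))) ⟩
            ι T * telescope m                                ∎))))))
          where
          open ≈-R
          e b : ℕ
          e = suc (suc (suc m))
          b = suc m ℕ.* suc (suc m)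
          κ : ℝ
          κ = ι (4 ℕ.* e) * ι T ⁻¹
          0<T : 0# < ι T
          0<T = ι-pos 1≤T
          0<b : 0# < ι b
          0<b = ι-pos {b} (ℕ.s≤s ℕ.z≤n)
          K+1≤2K : ι K + 1# ≤ ι 2 * ι K
          K+1≤2K = ≤-by (1≤ι 1≤K) (solve (ι K ∷ []) (con 2 ⊗ var 0 ⊖ (var 0 ⊕ 𝟏)) (var 0 ⊖ 𝟏))
          identity : ∀ e k b₁ b₂ → 4 ℕ.* e ℕ.* (2 ℕ.* k) ℕ.* (b₁ ℕ.* b₂) ≡ 8 ℕ.* (k ℕ.* (b₁ ℕ.* (b₂ ℕ.* e)))
          identity = ℕ-Solver.solve-∀

        cover-covers : ∀ {α} → Within α (ι (suc m)) → ¬ Good d-1 m α → Any (α ∈ᴵ_) cover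
        cover-covers w bad = by-contradiction λ ¬p → bad λ { (suc i) u 1≤q q≤N int (lo , hi) →
          ¬p (Anyₚ.concat⁺ (Anyₚ.applyUpTo⁺ _ (row-covers (suc i) (ℕ.s≤s ℕ.z≤n) w int lo hi) q≤N)) }

    opaque
      -- Covers from index `M` on have total length at most 1/(M + 1), which is at most `δ`. The
      -- exceptional set is defined without reference to `ε`, so one cover serves all exponents at
      -- once.
      almostAll-good : ∀ d-1 → AlmostAll (λ α → ∀ ε → 0# < ε →
        (λ N → ι N * discrepancy (λ n → frac (ι (Sequence.a d-1 n) * α)) N)
          =O (λ N → log (ι N) ^ (ι 2 + ε)))
      almostAll-good d-1 δ 0<δ = (λ i → proj₁ (S i)) , (λ i → proj₂ (S i)) ,
        stream-valid [] valid , covers , λ n → ≤-trans (stream-total [] valid n) (small n)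
        where
        open Exceptional d-1
        M : ℕ
        M = proj₁ (archimedean (δ ⁻¹))
        G : ℕ → List Interval
        G i = cover (M ℕ.+ i)
        S : ℕ → Interval
        S = stream [] G
        valid : ∀ i → All Valid (G i)
        valid i = cover-valid (M ℕ.+ i)
        small : ∀ n → 0# + ∑ (λ i → total (G i)) n ≤ δ
        small n = ≤-trans (≤-by (∑-mono n (λ i _ → cover-total (M ℕ.+ i)) +≤ <⇒≤ (⁻¹-pos 0<end) +≤ ≤-reflexive (telescope-sum M n))
            (solve (∑ (λ i → total (G i)) n ∷ ∑ (λ i → telescope (M ℕ.+ i)) n ∷ ι (suc (M ℕ.+ n)) ⁻¹ ∷ ι (suc M) ⁻¹ ∷ [])
                (var 3 ⊖ (𝟎 ⊕ var 0)) (var 1 ⊕ var 2 ⊕ var 3 ⊖ (var 0 ⊕ 𝟎 ⊕ (var 1 ⊕ var 2)))))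
          (*-cancel-≤ 0<1+M (≤-trans (≤-reflexive (⁻¹-inverse 0<1+M)) 1≤))
          where
          0<end : 0# < ι (suc (M ℕ.+ n))
          0<end = ι-pos {suc (M ℕ.+ n)} (ℕ.s≤s ℕ.z≤n)
          0<1+M : 0# < ι (suc M)
          0<1+M = ι-pos {suc M} (ℕ.s≤s ℕ.z≤n)
          1≤ : 1# ≤ ι (suc M) * δ
          1≤ = ≤-trans (≤-reflexive (sym (⁻¹-inverse 0<δ))) (≤-trans (<⇒≤ 0<δ *≤
            ≤-trans (proj₂ (archimedean (δ ⁻¹))) (ι-mono-≤ (ℕₚ.n≤1+n M))) (≤-reflexive (*-comm _ _)))
        covers : ∀ α → ¬ (∀ ε → 0# < ε →
          (λ N → ι N * discrepancy (λ n → frac (ι (Sequence.a d-1 n) * α)) N)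
            =O (λ N → log (ι N) ^ (ι 2 + ε))) → ∃ λ i → proj₁ (S i) < α × α < proj₂ (S i)
        -- The covers in the stream start at index `M`, and from index `A ≥ |α|` on the window of a
        -- cover contains `α`; beyond both, an uncovered `α` must be good.
        covers α ¬P = by-contradiction λ ¬p → ¬P (good⇒discrepancy d-1 α (M ℕ.+ A) (good ¬p))
          where
          A : ℕ
          A = proj₁ (archimedean ∣ α ∣)
          good : ¬ (∃ λ i → α ∈ᴵ S i) → ∀ m → M ℕ.+ A ℕ.≤ m → Good d-1 m α
          good ¬p m M+A≤m = by-contradiction λ ¬g → ¬p (stream-later [] G (m ℕ.∸ M)
            (≡.subst (λ k → Any (α ∈ᴵ_) (cover k)) (≡.sym (ℕₚ.m+[n∸m]≡n (ℕₚ.m+n≤o⇒m≤o M M+A≤m)))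
              (cover-covers m (within-mono (≤-trans (proj₂ (archimedean ∣ α ∣))
                (ι-mono-≤ (ℕₚ.m≤n⇒m≤1+n (ℕₚ.m+n≤o⇒n≤o M M+A≤m)))) (within-∣∣ α)) ¬g)))

  open ExceptionalSets public

theorem5 : (lem : ExcludedMiddle 0ℓ) (R : CompleteOrderedField) →
    let open CompleteOrderedField R
        open Analysis lem R
    in
    ∀ (d : ℕ) → 1 ℕ.≤ d →
    ∃₂ λ (a : ℕ → ℕ) (c : ℝ) →
      (∀ n → 1 ℕ.≤ n → 1 ℕ.≤ a n) ×
      (∀ n → 1 ℕ.≤ n → a n ℕ.< a (suc n)) ×
      0# < c ×
      (∀ n → 1 ℕ.≤ n →
        1# + c / (ι (a n) ^ (1# / ι d)) < ι (a (suc n)) / ι (a n)) ×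
      AlmostAll (λ α → ∀ ε → 0# < ε →
        (λ N → ι N * discrepancy (λ n → frac (ι (a n) * α)) N)
          =O (λ N → log (ι N) ^ (ι 2 + ε)))
theorem5 lem R (suc d-1) _ = a , ½ , 1≤a , (λ n _ → a-mono n) , 0<½ , a-gap , almostAll-good d-1
  where
  open Development lem R
  open Sequence d-1
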